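{- Let $\mathbf{A}$ be a finite simple non-abelian Mal'cev algebra, let $e_1,\dots,e_n$ be all the idempotents of $\mathbf{A}$, let $\mathbf{B}$ be the countable atomless Boolean algebra, and let $x_1,\dots,x_n\in 2^\omega$ be distinct. (1) The class $\{\mathbf{A}^k : k\geq 1\}$ has the joint embedding property (JEP) and the amalgamation property (AP), and its generalized Fraïssé limit is isomorphic to the filtered Boolean power $(\mathbf{A}^{\mathbf{B}})^{x_1,\dots,x_n}_{e_1,\dots,e_n}$. (2) Let $\mathbf{F}$ be the free algebra of countable (infinite) rank in the variety $V$ generated by $\mathbf{A}$, and let $\theta$ be the smallest congruence of $\mathbf{F}$ such that $\mathbf{F}/\theta$ is in the variety $W$ generated by all proper subalgebras of $\mathbf{A}$. Then $\mathbf{F}$ embeds into $\mathbf{A}^{\mathbf{B}}$, and every $\theta$-class which is a subalgebra of $\mathbf{F}$ is isomorphic to $(\mathbf{A}^{\mathbf{B}})^{x_1,\dots,x_n}_{e_1,\dots,e_n}$.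
   Context: An algebra is a nonempty set with a family of finitary operations. It is Mal'cev if it has a ternary term operation $m$ satisfying $m(x,x,y)=y=m(y,x,x)$. A Mal'cev algebra is abelian if its basic operations can be represented as affine functions over a module; otherwise it is non-abelian. An element $e$ of an algebra $\mathbf{A}$ is an idempotent if $\{e\}$ is a subalgebra of $\mathbf{A}$. The Stone space $X$ of a Boolean algebra $\mathbf{B}$ is its set of ultrafilters with basic open sets $\{x\in X : b\in x\}$, $b\in B$. The countable atomless Boolean algebra is unique up to isomorphism and its Stone space is the Cantor space $2^\omega$. The Boolean power $\mathbf{A}^{\mathbf{B}}$ is the subalgebra of the direct power $\mathbf{A}^X$ whose elements are the continuous functions $f\colon X\to A$, where $A$ is discrete. For pairwise distinct $x_1,\dots,x_n\in X$ and idempotents $e_1,\dots,e_n$ of $\mathbf{A}$, the filtered Boolean power $(\mathbf{A}^{\mathbf{B}})^{x_1,\dots,x_n}_{e_1,\dots,e_n}$ is the subalgebra of $\mathbf{A}^{\mathbf{B}}$ with universe $\{f\in A^{\mathbf{B}} : f(x_1)=e_1,\dots,f(x_n)=e_n\}$. A class $K$ of structures has the JEP if any $\mathbf{P},\mathbf{Q}\in K$ both embed into some $\mathbf{R}\in K$. It has the AP if for all $\mathbf{P},\mathbf{Q},\mathbf{R}\in K$ and embeddings $\varphi\colon\mathbf{P}\to\mathbf{Q}$, $\psi\colon\mathbf{P}\to\mathbf{R}$ there exist $\mathbf{S}\in K$ and embeddings $\varphi'\colon\mathbf{Q}\to\mathbf{S}$, $\psi'\colon\mathbf{R}\to\mathbf{S}$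 with $\varphi'\varphi=\psi'\psi$. For a countable class $K$ of finitely generated structures of the same type with the JEP and AP, the generalized Fraïssé limit of $K$ is the (unique up to isomorphism) countable structure $\mathbf{D}$ such that: (i) up to isomorphism, the finitely generated substructures of $\mathbf{D}$ are exactly the finitely generated substructures of members of $K$; (ii) $\mathbf{D}$ is a direct limit of structures in $K$; (iii) every isomorphism between substructures of $\mathbf{D}$ that are isomorphic to members of $K$ extends to an automorphism of $\mathbf{D}$. -}

module Defs where

open import Level using (Level; 0ℓ) renaming (suc to lsuc)
open import Algebra.Bundles using (Ring)
open import Algebra.Lattice.Bundles using (BooleanAlgebra)
open import Algebra.Module.Bundles using (LeftModule)
import Algebra.Definitions.RawMonoid as RawMonoidDefs
import Algebra.Lattice.Properties.BooleanAlgebra as BAProps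
open import Data.Bool using (Bool; true)
open import Data.Fin using (Fin; zero; suc)
open import Data.Nat using (ℕ; zero; suc; _≤_)
open import Data.Product using (Σ; ∃; ∃-syntax; _×_; _,_; proj₁; proj₂)
open import Data.Sum using (_⊎_)
open import Data.Vec.Functional using (Vector; []; _∷_)
open import Function using (_∘_)
open import Function.Bundles using (Inverse; Surjection)
open import Function.Definitions using (Injective; Bijective)
open import Relation.Binary using (Setoid; Poset; Rel; IsEquivalence; _⇒_; _Respects_)
open import Relation.Binary.PropositionalEquality as ≡ using (_≡_)
open import Relation.Nullary using (¬_)
open import Relation.Unary using (Pred; _⊆_)

------------------------------------------------------------------------
-- Sets are setoids in `Set`.

Finite : Setoid 0ℓ 0ℓ → Set
Finite S = ∃[ m ] Inverse S (≡.setoid (Fin m))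

-- Finite or countably infinite, and nonempty.
Countable : Setoid 0ℓ 0ℓ → Set
Countable S = Surjection (≡.setoid ℕ) S

------------------------------------------------------------------------
-- Algebras

record Signature : Set₁ where
  field
    Op    : Set
    arity : Op → ℕ

open Signature

-- Nonemptiness is not a field.  It is required explicitly of the
-- substructures quantified over below, and it holds for every other
-- algebra considered: simple algebras, their powers, free algebras on ℕ
-- and countable algebras all have elements by definition.
record Algebra (𝑆 : Signature) : Set₁ where
  field
    setoid : Setoid 0ℓ 0ℓ
  open Setoid setoid public
  field
    ⟦_⟧     : (f : Op 𝑆) → Vector Carrier (arity 𝑆 f) → Carrier
    ⟦⟧-cong : ∀ f {u v} → (∀ i → u i ≈ v i) → ⟦ f ⟧ u ≈ ⟦ f ⟧ v

module _ {𝑆 : Signature} where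

  record Hom (𝐂 𝐃 : Algebra 𝑆) : Set where
    private
      module C = Algebra 𝐂
      module D = Algebra 𝐃
    field
      map      : C.Carrier → D.Carrier
      cong     : ∀ {x y} → x C.≈ y → map x D.≈ map y
      preserve : ∀ f u → map (C.⟦ f ⟧ u) D.≈ D.⟦ f ⟧ (map ∘ u)

  record Embedding (𝐂 𝐃 : Algebra 𝑆) : Set where
    field
      hom       : Hom 𝐂 𝐃
    open Hom hom public
    field
      injective : Injective (Algebra._≈_ 𝐂) (Algebra._≈_ 𝐃) map

  infix 4 _≅_
  record _≅_ (𝐂 𝐃 : Algebra 𝑆) : Set where
    field
      hom       : Hom 𝐂 𝐃
    open Hom hom public
    field
      bijective : Bijective (Algebra._≈_ 𝐂) (Algebra._≈_ 𝐃) map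

----------------------------------------------------------------------
-- Subalgebras, powers, congruences

  record IsSubuniverse (𝐂 : Algebra 𝑆) (P : Pred (Algebra.Carrier 𝐂) 0ℓ) : Set where
    open Algebra 𝐂
    field
      respects : P Respects _≈_
      closed   : ∀ f u → (∀ i → P (u i)) → P (⟦ f ⟧ u)

  subalgebra : (𝐂 : Algebra 𝑆) {P : Pred (Algebra.Carrier 𝐂) 0ℓ} →
               IsSubuniverse 𝐂 P → Algebra 𝑆
  subalgebra 𝐂 {P} P-sub = record
    { setoid  = record
      { Carrier       = Σ Carrier P
      ; _≈_           = λ a b → proj₁ a ≈ proj₁ b
      ; isEquivalence = record { refl = refl ; sym = sym ; trans = trans }
      }
    ; ⟦_⟧     = λ f u → ⟦ f ⟧ (proj₁ ∘ u) , closed f (proj₁ ∘ u) (proj₂ ∘ u)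
    ; ⟦⟧-cong = λ f → ⟦⟧-cong f
    }
    where
    open Algebra 𝐂
    open IsSubuniverse P-sub

  IsIdempotent : (𝐂 : Algebra 𝑆) → Algebra.Carrier 𝐂 → Set
  IsIdempotent 𝐂 e = IsSubuniverse 𝐂 (λ x → x ≈ e)
    where open Algebra 𝐂

  power : Algebra 𝑆 → Set → Algebra 𝑆
  power 𝐂 X = record
    { setoid  = record
      { Carrier       = X → Carrier
      ; _≈_           = λ g h → ∀ x → g x ≈ h x
      ; isEquivalence = record
        { refl  = λ _ → refl
        ; sym   = λ p x → sym (p x)
        ; trans = λ p q x → trans (p x) (q x)
        }
      }
    ; ⟦_⟧     = λ f u x → ⟦ f ⟧ (λ i → u i x)
    ; ⟦⟧-cong = λ f p x → ⟦⟧-cong f (λ i → p i x)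
    }
    where open Algebra 𝐂

  record Congruence (𝐂 : Algebra 𝑆) : Set₁ where
    open Algebra 𝐂
    field
      rel             : Rel Carrier 0ℓ
      rel-equivalence : IsEquivalence rel
      contains-≈      : _≈_ ⇒ rel
      compatible      : ∀ f {u v} → (∀ i → rel (u i) (v i)) → rel (⟦ f ⟧ u) (⟦ f ⟧ v)

  quotient : (𝐂 : Algebra 𝑆) → Congruence 𝐂 → Algebra 𝑆
  quotient 𝐂 θ = record
    { setoid  = record
      { Carrier = Carrier ; _≈_ = rel ; isEquivalence = rel-equivalence }
    ; ⟦_⟧     = ⟦_⟧
    ; ⟦⟧-cong = compatible
    }
    where
    open Algebra 𝐂
    open Congruence θ

  IsSimple : Algebra 𝑆 → Set₁
  IsSimple 𝐂 =
    (∃[ x ] ∃[ y ] ¬ x ≈ y) ×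
    (∀ (θ : Congruence 𝐂) →
      (Congruence.rel θ ⇒ _≈_) ⊎ (∀ x y → Congruence.rel θ x y))
    where open Algebra 𝐂

----------------------------------------------------------------------
-- Terms and varieties

data Term (𝑆 : Signature) (X : Set) : Set where
  var : X → Term 𝑆 X
  op  : (f : Op 𝑆) → Vector (Term 𝑆 X) (arity 𝑆 f) → Term 𝑆 X

Equation : Signature → Set
Equation 𝑆 = Term 𝑆 ℕ × Term 𝑆 ℕ

module _ {𝑆 : Signature} where

  eval : (𝐂 : Algebra 𝑆) {X : Set} → Term 𝑆 X → (X → Algebra.Carrier 𝐂) → Algebra.Carrier 𝐂
  eval 𝐂 (var x)  ρ = ρ x
  eval 𝐂 (op f t) ρ = Algebra.⟦_⟧ 𝐂 f (λ i → eval 𝐂 (t i) ρ)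

  Models : Pred (Equation 𝑆) 0ℓ → Algebra 𝑆 → Set
  Models E 𝐂 = ∀ {s t} → E (s , t) → ∀ ρ → eval 𝐂 s ρ ≈ eval 𝐂 t ρ
    where open Algebra 𝐂

  -- A variety is the class of models of a set E of equations; the variety
  -- generated by a family of algebras is the least one that contains it.
  InVarietyOf : ∀ {ℓ} {I : Set ℓ} → (I → Algebra 𝑆) → Algebra 𝑆 → Set (lsuc 0ℓ Level.⊔ ℓ)
  InVarietyOf 𝐊 𝐂 = (E : Pred (Equation 𝑆) 0ℓ) → (∀ i → Models E (𝐊 i)) → Models E 𝐂

  record IsFree {ℓ} (V : Pred (Algebra 𝑆) ℓ) (𝐅 : Algebra 𝑆)
                (gen : ℕ → Algebra.Carrier 𝐅) : Set (lsuc 0ℓ Level.⊔ ℓ) where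
    field
      member : V 𝐅
      extend : ∀ {𝐂} → V 𝐂 → (g : ℕ → Algebra.Carrier 𝐂) →
               Σ (Hom 𝐅 𝐂) λ h → ∀ i → Algebra._≈_ 𝐂 (Hom.map h (gen i)) (g i)
      unique : ∀ {𝐂} → V 𝐂 → (h k : Hom 𝐅 𝐂) →
               (∀ i → Algebra._≈_ 𝐂 (Hom.map h (gen i)) (Hom.map k (gen i))) →
               ∀ x → Algebra._≈_ 𝐂 (Hom.map h x) (Hom.map k x)

  record ProperSubalgebra (𝐂 : Algebra 𝑆) : Set₁ where
    open Algebra 𝐂
    field
      pred          : Pred Carrier 0ℓ
      isSubuniverse : IsSubuniverse 𝐂 pred
      nonempty      : ∃ pred
      proper        : ¬ (∀ x → pred x)

  properSubalgebras : (𝐂 : Algebra 𝑆) → ProperSubalgebra 𝐂 → Algebra 𝑆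
  properSubalgebras 𝐂 P = subalgebra 𝐂 (ProperSubalgebra.isSubuniverse P)

  record IsLeastCongruence {ℓ} (W : Pred (Algebra 𝑆) ℓ) (𝐂 : Algebra 𝑆)
                           (θ : Congruence 𝐂) : Set (lsuc 0ℓ Level.⊔ ℓ) where
    field
      member : W (quotient 𝐂 θ)
      least  : ∀ ψ → W (quotient 𝐂 ψ) → Congruence.rel θ ⇒ Congruence.rel ψ

----------------------------------------------------------------------
-- Mal'cev and abelian algebras

  IsMalcev : Algebra 𝑆 → Set
  IsMalcev 𝐂 = Σ (Term 𝑆 (Fin 3)) λ m → ∀ x y →
    (eval 𝐂 m (x ∷ x ∷ y ∷ []) ≈ y) × (eval 𝐂 m (y ∷ x ∷ x ∷ []) ≈ y)
    where open Algebra 𝐂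

  -- The definition of abelian for Mal'cev algebras only.
  record IsAbelian (𝐂 : Algebra 𝑆) : Set₁ where
    open Algebra 𝐂
    field
      ring       : Ring 0ℓ 0ℓ
      leftModule : LeftModule ring 0ℓ 0ℓ
    private
      module M = LeftModule leftModule
    open RawMonoidDefs M.+ᴹ-rawMonoid using (sum)
    field
      bijection : Inverse setoid M.≈ᴹ-setoid
    open Inverse bijection using (to)
    field
      coefficient : (f : Op 𝑆) → Vector (Ring.Carrier ring) (arity 𝑆 f)
      constant    : Op 𝑆 → M.Carrierᴹ
      affine      : ∀ f u →
        to (⟦ f ⟧ u) M.≈ᴹ (sum (λ i → coefficient f i M.*ₗ to (u i)) M.+ᴹ constant f)

------------------------------------------------------------------------
-- Boolean algebras and Stone spaces

module _ (𝐁 : BooleanAlgebra 0ℓ 0ℓ) where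
  open BooleanAlgebra 𝐁 renaming (¬_ to ∁_)

  infix 4 _⊑_
  _⊑_ : Rel Carrier 0ℓ
  a ⊑ b = a ∧ b ≈ a

  IsAtom : Pred Carrier 0ℓ
  IsAtom a = ¬ a ≈ ⊥ × (∀ b → b ⊑ a → b ≈ ⊥ ⊎ b ≈ a)

  -- The one-element Boolean algebra does not count as atomless.
  IsAtomless : Set
  IsAtomless = ¬ ⊤ ≈ ⊥ × (∀ a → ¬ IsAtom a)

  -- An ultrafilter is given by its characteristic function, which under
  -- excluded middle loses no generality and keeps the Stone space in `Set`.
  record Ultrafilter : Set where
    field
      χ : Carrier → Bool
    infix 4 ∋_
    ∋_ : Pred Carrier 0ℓ
    ∋ b = χ b ≡ true
    field
      upward   : ∀ {a b} → a ⊑ b → ∋ a → ∋ b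
      ∧-closed : ∀ {a b} → ∋ a → ∋ b → ∋ (a ∧ b)
      has-⊤    : ∋ ⊤
      proper   : ¬ (∋ ⊥)
      ultra    : ∀ b → (∋ b) ⊎ (∋ (∁ b))

module _ {𝐁 : BooleanAlgebra 0ℓ 0ℓ} where
  open BooleanAlgebra 𝐁 renaming (¬_ to ∁_)

  infix 4 _∈ᵤ_ _≈ᵤ_
  _∈ᵤ_ : Carrier → Ultrafilter 𝐁 → Set
  b ∈ᵤ x = Ultrafilter.∋_ x b

  _≈ᵤ_ : Rel (Ultrafilter 𝐁) 0ℓ
  x ≈ᵤ y = ∀ b → Ultrafilter.χ x b ≡ Ultrafilter.χ y b

  IsOpen : Pred (Ultrafilter 𝐁) 0ℓ → Set
  IsOpen U = ∀ x → U x → ∃[ b ] b ∈ᵤ x × (∀ y → b ∈ᵤ y → U y)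

  private
    ∧-⊑ˡ : ∀ a b → _⊑_ 𝐁 (a ∧ b) a
    ∧-⊑ˡ a b =
      trans (∧-assoc a b a) (trans (∧-congˡ (∧-comm b a))
        (trans (sym (∧-assoc a a b)) (∧-congʳ (BAProps.∧-idem 𝐁 a))))

    ∧-⊑ʳ : ∀ a b → _⊑_ 𝐁 (a ∧ b) b
    ∧-⊑ʳ a b = trans (∧-assoc a b b) (∧-congˡ (BAProps.∧-idem 𝐁 b))

  common : ∀ {n} (x : Ultrafilter 𝐁) (Q : Fin n → Pred (Ultrafilter 𝐁) 0ℓ) →
    (∀ i → ∃[ b ] b ∈ᵤ x × (∀ y → b ∈ᵤ y → Q i y)) →
    ∃[ b ] b ∈ᵤ x × (∀ y → b ∈ᵤ y → ∀ i → Q i y)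
  common {zero}  x Q p = ⊤ , Ultrafilter.has-⊤ x , λ _ _ ()
  common {suc n} x Q p
    with p zero | common x (Q ∘ suc) (p ∘ suc)
  ... | b , b∈x , hb | c , c∈x , hc =
    b ∧ c , Ultrafilter.∧-closed x b∈x c∈x , λ where
      y m zero    → hb y (Ultrafilter.upward y (∧-⊑ˡ b c) m)
      y m (suc i) → hc y (Ultrafilter.upward y (∧-⊑ʳ b c) m) i

------------------------------------------------------------------------
-- Boolean powers

module _ {𝑆 : Signature} (𝐀 : Algebra 𝑆) (𝐁 : BooleanAlgebra 0ℓ 0ℓ) where
  open Algebra 𝐀

  -- Continuity for the discrete topology on 𝐀, whose singletons form a
  -- base.  A continuous function automatically respects _≈ᵤ_.
  Continuous : Pred (Ultrafilter 𝐁 → Carrier) 0ℓ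
  Continuous g = ∀ a → IsOpen (λ x → g x ≈ a)

  continuous-isSubuniverse : IsSubuniverse (power 𝐀 (Ultrafilter 𝐁)) Continuous
  continuous-isSubuniverse = record
    { respects = λ {g} {h} g≈h g-cts a x hx≈a →
        let b , b∈x , p = g-cts a x (trans (g≈h x) hx≈a)
        in b , b∈x , λ y b∈y → trans (sym (g≈h y)) (p y b∈y)
    ; closed   = λ f u u-cts a x e →
        let b , b∈x , p = common x (λ i y → u i y ≈ u i x) (λ i → u-cts i (u i x) x refl)
        in b , b∈x , λ y b∈y → trans (⟦⟧-cong f (p y b∈y)) e
    }

  booleanPower : Algebra 𝑆
  booleanPower = subalgebra (power 𝐀 (Ultrafilter 𝐁)) continuous-isSubuniverse

  module _ {n : ℕ} (x : Fin n → Ultrafilter 𝐁) (e : Fin n → Carrier)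
           (e-idem : ∀ i → IsIdempotent 𝐀 (e i)) where

    filtered-isSubuniverse :
      IsSubuniverse booleanPower (λ g → ∀ i → proj₁ g (x i) ≈ e i)
    filtered-isSubuniverse = record
      { respects = λ g≈h p i → trans (sym (g≈h (x i))) (p i)
      ; closed   = λ f u p i → IsSubuniverse.closed (e-idem i) f (λ j → proj₁ (u j) (x i)) (λ j → p j i)
      }

    filteredBooleanPower : Algebra 𝑆
    filteredBooleanPower = subalgebra booleanPower filtered-isSubuniverse

------------------------------------------------------------------------
-- Amalgamation and generalized Fraïssé limits

module _ {𝑆 : Signature} where

  finitePowers : Algebra 𝑆 → ∃ (λ k → 1 ≤ k) → Algebra 𝑆
  finitePowers 𝐀 (k , _) = power 𝐀 (Fin k)

  IsFinitelyGenerated : (𝐂 : Algebra 𝑆) → Pred (Algebra.Carrier 𝐂) 0ℓ → Set₁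
  IsFinitelyGenerated 𝐂 P = ∃[ n ] Σ (Vector (Algebra.Carrier 𝐂) n) λ g →
    (∀ i → P (g i)) ×
    (∀ (Q : Pred (Algebra.Carrier 𝐂) 0ℓ) → IsSubuniverse 𝐂 Q → (∀ i → Q (g i)) → P ⊆ Q)

  record FGSubalgebra (𝐂 : Algebra 𝑆) : Set₁ where
    field
      pred                : Pred (Algebra.Carrier 𝐂) 0ℓ
      isSubuniverse       : IsSubuniverse 𝐂 pred
      nonempty            : ∃ pred
      isFinitelyGenerated : IsFinitelyGenerated 𝐂 pred

    algebra : Algebra 𝑆
    algebra = subalgebra 𝐂 isSubuniverse

  module _ {I : Set} (𝐊 : I → Algebra 𝑆) where

    JEP : Set
    JEP = ∀ p q → ∃[ r ] Embedding (𝐊 p) (𝐊 r) × Embedding (𝐊 q) (𝐊 r)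

    AP : Set
    AP = ∀ p q r (φ : Embedding (𝐊 p) (𝐊 q)) (ψ : Embedding (𝐊 p) (𝐊 r)) →
      ∃[ s ] Σ (Embedding (𝐊 q) (𝐊 s)) λ φ′ → Σ (Embedding (𝐊 r) (𝐊 s)) λ ψ′ →
        ∀ a → Algebra._≈_ (𝐊 s) (Embedding.map φ′ (Embedding.map φ a))
                                (Embedding.map ψ′ (Embedding.map ψ a))

    -- The connecting maps are embeddings, the morphisms of JEP and AP.
    -- φ-∘ with one factor φ ≼-refl makes φ independent of the proof of i ≼ j.
    record DirectSystem : Set₁ where
      field
        poset    : Poset 0ℓ 0ℓ 0ℓ
      open Poset poset public
        using () renaming (Carrier to J; _≤_ to _≼_; refl to ≼-refl)
      field
        inhabited : J
        directed  : ∀ i j → ∃[ k ] i ≼ k × j ≼ k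
        obj       : J → I
        φ         : ∀ {i j} → i ≼ j → Embedding (𝐊 (obj i)) (𝐊 (obj j))
        φ-id      : ∀ {i} a →
          Algebra._≈_ (𝐊 (obj i)) (Embedding.map (φ {i} ≼-refl) a) a
        φ-∘       : ∀ {i j k} (p : i ≼ j) (q : j ≼ k) (r : i ≼ k) a →
          Algebra._≈_ (𝐊 (obj k)) (Embedding.map (φ r) a)
                                  (Embedding.map (φ q) (Embedding.map (φ p) a))

    -- The direct limit is the disjoint union of the stages, in which two
    -- elements are identified when they agree at some later stage.
    record IsDirectLimit (𝐃 : Algebra 𝑆) (𝒮 : DirectSystem) : Set where
      open DirectSystem 𝒮
      private
        module D = Algebra 𝐃
      field
        ι         : ∀ j → Hom (𝐊 (obj j)) 𝐃
        commute   : ∀ {i j} (p : i ≼ j) a →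
          Hom.map (ι j) (Embedding.map (φ p) a) D.≈ Hom.map (ι i) a
        covers    : ∀ d → ∃[ j ] ∃[ a ] Hom.map (ι j) a D.≈ d
        separates : ∀ i j a b → Hom.map (ι i) a D.≈ Hom.map (ι j) b →
          ∃[ k ] Σ (i ≼ k) λ p → Σ (j ≼ k) λ q →
            Algebra._≈_ (𝐊 (obj k)) (Embedding.map (φ p) a) (Embedding.map (φ q) b)

    record IsGeneralizedFraisseLimit (𝐃 : Algebra 𝑆) : Set₁ where
      private
        module D = Algebra 𝐃
      field
        countable    : Countable D.setoid
        age⊆         : ∀ (P : FGSubalgebra 𝐃) → ∃[ i ] Σ (FGSubalgebra (𝐊 i)) λ Q →
                       FGSubalgebra.algebra P ≅ FGSubalgebra.algebra Q
        age⊇         : ∀ i (Q : FGSubalgebra (𝐊 i)) → Σ (FGSubalgebra 𝐃) λ P →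
                       FGSubalgebra.algebra P ≅ FGSubalgebra.algebra Q
        directLimit  : Σ DirectSystem (IsDirectLimit 𝐃)
        homogeneous  : ∀ {P Q : Pred D.Carrier 0ℓ}
          (P-sub : IsSubuniverse 𝐃 P) (Q-sub : IsSubuniverse 𝐃 Q) →
          ∃ (λ i → subalgebra 𝐃 P-sub ≅ 𝐊 i) →
          ∃ (λ j → subalgebra 𝐃 Q-sub ≅ 𝐊 j) →
          (σ : subalgebra 𝐃 P-sub ≅ subalgebra 𝐃 Q-sub) →
          Σ (𝐃 ≅ 𝐃) λ α → ∀ a → _≅_.map α (proj₁ a) D.≈ proj₁ (_≅_.map σ a)

    -- The limit is a definite description: 𝐃 is a limit, and every limit is
    -- isomorphic to 𝐃.
    GeneralizedFraisseLimitIs : Algebra 𝑆 → Set₁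
    GeneralizedFraisseLimitIs 𝐃 =
      IsGeneralizedFraisseLimit 𝐃 × (∀ 𝐋 → IsGeneralizedFraisseLimit 𝐋 → 𝐋 ≅ 𝐃)

{-# OPTIONS --safe #-}

-- The kernel of a surjection h : 𝐂 → 𝐀 onto a simple non-abelian Mal'cev algebra is prime:
-- α ∩ β ⊆ ker h implies α ⊆ ker h or β ⊆ ker h, since otherwise the Mal'cev term commutes with
-- the operations of 𝐀, which makes 𝐀 affine.  So, if 𝐀 is finite and ker h contains the
-- intersection of finitely many kernels of homomorphisms gᵢ : 𝐂 → 𝐀, then h is some gᵢ
-- followed by an automorphism.  For 𝐂 = 𝐀ᵖ this shows that homomorphisms 𝐀ᵖ → 𝐀 extend along
-- embeddings 𝐀ᵖ → 𝐀ʳ, whence AP.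
--
-- Call a countable algebra rich if its finite subsets lie in copies of powers of 𝐀, and if every
-- copy of 𝐀ᵏ in it lies in a copy of 𝐀ᵏ⁺¹ as the graph of any given homomorphism 𝐀ᵏ → 𝐀.  By
-- back and forth, any two rich algebras are isomorphic, and they are the generalized Fraïssé
-- limits of the powers.  The filtered Boolean power is rich because its Stone space has no
-- isolated points.  An element of 𝐅 is a function 𝐀^ω → 𝐀 of finitely many coordinates, and θ
-- is agreement at the sequences that do not generate 𝐀.  By primeness an element of 𝐅 that
-- depends on K coordinates can be given any value at a generating K-tuple, with no change
-- outside its orbit under Aut 𝐀; therefore the θ-classes that are subalgebras are rich.
module Submission where

open import Defs
open import Level using (0ℓ; Lift; lift) renaming (suc to lsuc)
open import Algebra.Bundles using (AbelianGroup; Ring)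
open import Algebra.Lattice.Bundles using (BooleanAlgebra)
open import Algebra.Module.Bundles using (LeftModule)
import Algebra.Definitions.RawMonoid as RawMonoidDefs
import Algebra.Lattice.Properties.BooleanAlgebra as BAProps
import Algebra.Properties.AbelianGroup as AbelianGroupProps
open import Axiom.ExcludedMiddle using (ExcludedMiddle)
open import Data.Bool using (true; false; if_then_else_)
open import Data.Fin using
  (Fin; zero; suc; toℕ; fromℕ<; _↑ˡ_; _↑ʳ_; splitAt; funToFin; finToFun; punchOut)
import Data.Fin.Properties as Fin
open import Data.Nat using (ℕ; zero; suc; _+_; _^_; _⊔_; _≤_; _<_; _≤′_; ≤′-refl; ≤′-step; z≤n; s≤s)
import Data.Nat.Properties as ℕ
open import Data.Product using (Σ; ∃; ∃-syntax; _×_; _,_; proj₁; proj₂)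
open import Data.Sum using (_⊎_; inj₁; inj₂; [_,_]′)
open import Data.Unit using (⊤; tt)
open import Data.Vec.Functional using (Vector; []; _∷_)
open import Function using (_∘_; id)
open import Function.Bundles using (Inverse; Surjection)
open import Function.Definitions using (Injective)
open import Relation.Binary using (Setoid; Rel; IsEquivalence; _⇒_)
open import Relation.Binary.PropositionalEquality as ≡ using (_≡_)
import Relation.Binary.Reasoning.Setoid as SetoidReasoning
open import Relation.Nullary using (¬_; Dec; does; yes; no; contradiction)
open import Relation.Unary using (Pred; _⊆_)

open Signature

-- A homomorphism from a power of 𝐀 to 𝐀 that is not onto is constant with an idempotent value, and
-- primeness does not reach it. This is why all idempotents enter. In `adjoin` a coordinate that
-- coincides with `h` on the old copy has to become independent of it: at a place where the old copy
-- already takes the values of `h` up to an automorphism, the values are overwritten. For a constant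
-- `h` with value `e i` such a place is found from the point `x i`, respectively from the constant
-- sequence `e i`, since every element has the value `e i` there. Overwriting must neither touch the
-- prescribed values, at the `x i` or at nongenerating sequences, nor lose information on the old
-- copy. So in the Stone space it happens on one part of a nonzero element without any `x i`, and
-- the other part keeps the old values; in 𝐅 it happens at a sequence made generating by a listing
-- of 𝐀 beyond the coordinates in use, and a second sequence, different in one more coordinate,
-- keeps the old values.

module _ {𝑆 : Signature} where

  -- Homomorphisms, embeddings, isomorphisms and subalgebras.

  infix 4 _∋_≈_
  _∋_≈_ : (𝐂 : Algebra 𝑆) → Rel (Algebra.Carrier 𝐂) 0ℓ
  𝐂 ∋ x ≈ y = Algebra._≈_ 𝐂 x y

  infixr 8 _↑_
  _↑_ : Algebra 𝑆 → ℕ → Algebra 𝑆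
  𝐂 ↑ k = power 𝐂 (Fin k)

  eval-cong : (𝐂 : Algebra 𝑆) {X : Set} (t : Term 𝑆 X) {ρ ρ′ : X → Algebra.Carrier 𝐂} →
    (∀ x → 𝐂 ∋ ρ x ≈ ρ′ x) → 𝐂 ∋ eval 𝐂 t ρ ≈ eval 𝐂 t ρ′
  eval-cong 𝐂 (var x)   p = p x
  eval-cong 𝐂 (op f ts) p = Algebra.⟦⟧-cong 𝐂 f (λ i → eval-cong 𝐂 (ts i) p)

  module _ {𝐂 𝐃 : Algebra 𝑆} (h : Hom 𝐂 𝐃) where
    open Hom h
    private module D = Algebra 𝐃

    eval-hom : {X : Set} (t : Term 𝑆 X) (ρ : X → Algebra.Carrier 𝐂) →
      𝐃 ∋ map (eval 𝐂 t ρ) ≈ eval 𝐃 t (map ∘ ρ)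
    eval-hom (var x)   ρ = D.refl
    eval-hom (op f ts) ρ = D.trans (preserve f _) (D.⟦⟧-cong f (λ i → eval-hom (ts i) ρ))

    kernel : Congruence 𝐂
    kernel = record
      { rel             = λ x y → map x D.≈ map y
      ; rel-equivalence = record { refl = D.refl ; sym = D.sym ; trans = D.trans }
      ; contains-≈      = cong
      ; compatible      = λ f p →
          D.trans (preserve f _) (D.trans (D.⟦⟧-cong f p) (D.sym (preserve f _)))
      }

    IsSurjective : Set
    IsSurjective = ∀ y → ∃[ x ] map x D.≈ y

  intersection : {𝐂 : Algebra 𝑆} {I : Set} → (I → Congruence 𝐂) → Congruence 𝐂
  intersection α = record
    { rel             = λ x y → ∀ i → rel (α i) x y
    ; rel-equivalence = record
      { refl  = λ i → IsEquivalence.refl (rel-equivalence (α i))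
      ; sym   = λ p i → IsEquivalence.sym (rel-equivalence (α i)) (p i)
      ; trans = λ p q i → IsEquivalence.trans (rel-equivalence (α i)) (p i) (q i)
      }
    ; contains-≈      = λ e i → contains-≈ (α i) e
    ; compatible      = λ f p i → compatible (α i) f (λ j → p j i)
    }
    where open Congruence

  idHom : (𝐂 : Algebra 𝑆) → Hom 𝐂 𝐂
  idHom 𝐂 = record { map = id ; cong = id ; preserve = λ _ _ → Algebra.refl 𝐂 }

  infixr 9 _∘ₕ_
  _∘ₕ_ : {𝐂 𝐃 𝐄 : Algebra 𝑆} → Hom 𝐃 𝐄 → Hom 𝐂 𝐃 → Hom 𝐂 𝐄
  _∘ₕ_ {𝐄 = 𝐄} g h = record
    { map      = G.map ∘ H.map
    ; cong     = G.cong ∘ H.cong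
    ; preserve = λ f u → Algebra.trans 𝐄 (G.cong (H.preserve f u)) (G.preserve f _)
    }
    where
    module G = Hom g
    module H = Hom h

  infixr 9 _∘ₑ_
  _∘ₑ_ : {𝐂 𝐃 𝐄 : Algebra 𝑆} → Embedding 𝐃 𝐄 → Embedding 𝐂 𝐃 → Embedding 𝐂 𝐄
  g ∘ₑ h = record
    { hom       = Embedding.hom g ∘ₕ Embedding.hom h
    ; injective = Embedding.injective h ∘ Embedding.injective g
    }

  projection : (𝐂 : Algebra 𝑆) {X : Set} → X → Hom (power 𝐂 X) 𝐂
  projection 𝐂 x = record
    { map = λ g → g x ; cong = λ p → p x ; preserve = λ _ _ → Algebra.refl 𝐂 }

  tuple : {𝐂 𝐃 : Algebra 𝑆} {X : Set} → (X → Hom 𝐂 𝐃) → Hom 𝐂 (power 𝐃 X)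
  tuple h = record
    { map      = λ c x → Hom.map (h x) c
    ; cong     = λ p x → Hom.cong (h x) p
    ; preserve = λ f u x → Hom.preserve (h x) f u
    }

  diagonal : (𝐂 : Algebra 𝑆) {l : ℕ} → 1 ≤ l → Embedding (𝐂 ↑ 1) (𝐂 ↑ l)
  diagonal 𝐂 (s≤s z≤n) = record
    { hom       = tuple (λ _ → projection 𝐂 zero)
    ; injective = λ { p zero → p zero }
    }

  constHom : {𝐂 𝐃 : Algebra 𝑆} (e : Algebra.Carrier 𝐃) → IsIdempotent 𝐃 e → Hom 𝐂 𝐃
  constHom {𝐃 = 𝐃} e e-idem = record
    { map      = λ _ → e
    ; cong     = λ _ → Algebra.refl 𝐃
    ; preserve = λ f u → Algebra.sym 𝐃
        (IsSubuniverse.closed e-idem f (λ _ → e) (λ _ → Algebra.refl 𝐃))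
    }

  subalgebra-inclusion : (𝐂 : Algebra 𝑆) {P : Pred (Algebra.Carrier 𝐂) 0ℓ}
    (P-sub : IsSubuniverse 𝐂 P) → Embedding (subalgebra 𝐂 P-sub) 𝐂
  subalgebra-inclusion 𝐂 P-sub = record
    { hom = record { map = proj₁ ; cong = id ; preserve = λ _ _ → Algebra.refl 𝐂 }
    ; injective = id
    }

  bijection⇒≅ : {𝐂 𝐃 : Algebra 𝑆} (h : Hom 𝐂 𝐃) →
    Injective (Algebra._≈_ 𝐂) (Algebra._≈_ 𝐃) (Hom.map h) → IsSurjective h → 𝐂 ≅ 𝐃
  bijection⇒≅ {𝐃 = 𝐃} h inj surj = record
    { hom       = h
    ; bijective = inj , λ y →
        proj₁ (surj y) , λ p → Algebra.trans 𝐃 (Hom.cong h p) (proj₂ (surj y))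
    }

  module Iso {𝐂 𝐃 : Algebra 𝑆} (α : 𝐂 ≅ 𝐃) where
    open _≅_ α public
    private
      module C = Algebra 𝐂
      module D = Algebra 𝐃

    injective : ∀ {x y} → map x D.≈ map y → x C.≈ y
    injective = proj₁ bijective

    from : D.Carrier → C.Carrier
    from y = proj₁ (proj₂ bijective y)

    map∘from : ∀ y → map (from y) D.≈ y
    map∘from y = proj₂ (proj₂ bijective y) C.refl

    from∘map : ∀ x → from (map x) C.≈ x
    from∘map x = injective (map∘from (map x))

    from-cong : ∀ {x y} → x D.≈ y → from x C.≈ from y
    from-cong p = injective (D.trans (map∘from _) (D.trans p (D.sym (map∘from _))))

    from-hom : Hom 𝐃 𝐂
    from-hom = record
      { map      = from
      ; cong     = from-cong
      ; preserve = λ f u → injective (D.trans (map∘from _)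
          (D.trans (D.⟦⟧-cong f (λ i → D.sym (map∘from (u i)))) (D.sym (preserve f _))))
      }

    embedding : Embedding 𝐂 𝐃
    embedding = record { hom = hom ; injective = injective }

    inverse : 𝐃 ≅ 𝐂
    inverse = bijection⇒≅ from-hom
      (λ p → D.trans (D.sym (map∘from _)) (D.trans (cong p) (map∘from _)))
      (λ x → map x , from∘map x)

  ≅-trans : {𝐂 𝐃 𝐄 : Algebra 𝑆} → 𝐂 ≅ 𝐃 → 𝐃 ≅ 𝐄 → 𝐂 ≅ 𝐄
  ≅-trans {𝐄 = 𝐄} α β = bijection⇒≅ (_≅_.hom β ∘ₕ _≅_.hom α)
    (Iso.injective α ∘ Iso.injective β)
    (λ z → Iso.from α (Iso.from β z) ,
      Algebra.trans 𝐄 (Iso.cong β (Iso.map∘from α _)) (Iso.map∘from β z))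

  everything : (𝐂 : Algebra 𝑆) → IsSubuniverse 𝐂 (λ _ → ⊤)
  everything 𝐂 = record { respects = λ _ _ → tt ; closed = λ _ _ _ → tt }

  module Image {𝐂 𝐋 : Algebra 𝑆} (w : Embedding 𝐂 𝐋) where
    open Embedding w
    private
      module C = Algebra 𝐂
      module L = Algebra 𝐋

    preimage-isSubuniverse : {P : Pred L.Carrier 0ℓ} →
      IsSubuniverse 𝐋 P → IsSubuniverse 𝐂 (P ∘ map)
    preimage-isSubuniverse P-sub = record
      { respects = λ p → respects (cong p)
      ; closed   = λ f u p → respects (L.sym (preserve f u)) (closed f _ p)
      }
      where open IsSubuniverse P-sub

    image : Pred C.Carrier 0ℓ → Pred L.Carrier 0ℓ
    image Q y = ∃[ b ] Q b × map b L.≈ y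

    image-isSubuniverse : {Q : Pred C.Carrier 0ℓ} →
      IsSubuniverse 𝐂 Q → IsSubuniverse 𝐋 (image Q)
    image-isSubuniverse Q-sub = record
      { respects = λ { p (b , q , r) → b , q , L.trans r p }
      ; closed   = λ f u p →
          C.⟦ f ⟧ (proj₁ ∘ p) , closed f _ (proj₁ ∘ proj₂ ∘ p) ,
          L.trans (preserve f _) (L.⟦⟧-cong f (proj₂ ∘ proj₂ ∘ p))
      }
      where open IsSubuniverse Q-sub

    image-≅ : {Q : Pred C.Carrier 0ℓ} (Q-sub : IsSubuniverse 𝐂 Q) →
      subalgebra 𝐂 Q-sub ≅ subalgebra 𝐋 (image-isSubuniverse Q-sub)
    image-≅ Q-sub = bijection⇒≅
      (record { map      = λ { (b , q) → map b , b , q , L.refl }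
              ; cong     = cong
              ; preserve = λ f u → preserve f (proj₁ ∘ u) })
      injective
      (λ { (y , b , q , p) → (b , q) , p })

    range : Pred L.Carrier 0ℓ
    range = image (λ _ → ⊤)

    range-isSubuniverse : IsSubuniverse 𝐋 range
    range-isSubuniverse = image-isSubuniverse (everything 𝐂)

    range-≅ : 𝐂 ≅ subalgebra 𝐋 range-isSubuniverse
    range-≅ = bijection⇒≅
      (record { map      = λ b → map b , b , tt , L.refl
              ; cong     = cong
              ; preserve = preserve })
      injective
      (λ { (y , b , _ , p) → b , p })

    -- Preimages under `map` are unique up to `≈`, so choosing them is automatically a homomorphism.
    factor : {𝐃 : Algebra 𝑆} (u : Embedding 𝐃 𝐋) →
      (∀ d → ∃[ b ] map b L.≈ Embedding.map u d) →
      Σ (Embedding 𝐃 𝐂) λ v → ∀ d → map (Embedding.map v d) L.≈ Embedding.map u d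
    factor {𝐃} u p = record
      { hom = record
        { map      = proj₁ ∘ p
        ; cong     = λ q → injective
            (L.trans (proj₂ (p _)) (L.trans (U.cong q) (L.sym (proj₂ (p _)))))
        ; preserve = λ f x → injective
            (L.trans (proj₂ (p _)) (L.trans (U.preserve f x)
              (L.trans (L.⟦⟧-cong f (λ i → L.sym (proj₂ (p (x i))))) (L.sym (preserve f _)))))
        }
      ; injective = λ q → U.injective
          (L.trans (L.sym (proj₂ (p _))) (L.trans (cong q) (proj₂ (p _))))
      } , proj₂ ∘ p
      where module U = Embedding u

-- An abelian group as a module over its endomorphism ring.

module EndomorphismRing (G : AbelianGroup 0ℓ 0ℓ) where
  open AbelianGroup G
  open AbelianGroupProps G using (⁻¹-∙-comm)

  record Endomorphism : Set where
    field
      apply   : Carrier → Carrier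
      ap-cong : ∀ {x y} → x ≈ y → apply x ≈ apply y
      homo    : ∀ x y → apply (x ∙ y) ≈ apply x ∙ apply y
  open Endomorphism

  interchange : ∀ a b c d → (a ∙ b) ∙ (c ∙ d) ≈ (a ∙ c) ∙ (b ∙ d)
  interchange a b c d = begin
    (a ∙ b) ∙ (c ∙ d) ≈⟨ assoc a b (c ∙ d) ⟩
    a ∙ (b ∙ (c ∙ d)) ≈⟨ ∙-congˡ (assoc b c d) ⟨
    a ∙ ((b ∙ c) ∙ d) ≈⟨ ∙-congˡ (∙-congʳ (comm b c)) ⟩
    a ∙ ((c ∙ b) ∙ d) ≈⟨ ∙-congˡ (assoc c b d) ⟩
    a ∙ (c ∙ (b ∙ d)) ≈⟨ assoc a c (b ∙ d) ⟨
    (a ∙ c) ∙ (b ∙ d) ∎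
    where open SetoidReasoning setoid

  homo-ε : (r : Endomorphism) → apply r ε ≈ ε
  homo-ε r = begin
    apply r ε                                  ≈⟨ identityʳ _ ⟨
    apply r ε ∙ ε                              ≈⟨ ∙-congˡ (inverseʳ (apply r ε)) ⟨
    apply r ε ∙ (apply r ε ∙ (apply r ε) ⁻¹)   ≈⟨ assoc _ _ _ ⟨
    (apply r ε ∙ apply r ε) ∙ (apply r ε) ⁻¹   ≈⟨ ∙-congʳ (homo r ε ε) ⟨
    apply r (ε ∙ ε) ∙ (apply r ε) ⁻¹           ≈⟨ ∙-congʳ (ap-cong r (identityʳ ε)) ⟩
    apply r ε ∙ (apply r ε) ⁻¹                 ≈⟨ inverseʳ _ ⟩
    ε                                          ∎
    where open SetoidReasoning setoid

  endomorphismRing : Ring 0ℓ 0ℓ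
  endomorphismRing = record
    { Carrier = Endomorphism
    ; _≈_     = λ r s → ∀ x → apply r x ≈ apply s x
    ; _+_     = λ r s → record
      { apply   = λ x → apply r x ∙ apply s x
      ; ap-cong = λ p → ∙-cong (ap-cong r p) (ap-cong s p)
      ; homo    = λ x y → trans (∙-cong (homo r x y) (homo s x y)) (interchange _ _ _ _)
      }
    ; _*_     = λ r s → record
      { apply   = apply r ∘ apply s
      ; ap-cong = ap-cong r ∘ ap-cong s
      ; homo    = λ x y → trans (ap-cong r (homo s x y)) (homo r _ _)
      }
    ; -_      = λ r → record
      { apply   = λ x → apply r x ⁻¹
      ; ap-cong = ⁻¹-cong ∘ ap-cong r
      ; homo    = λ x y → trans (⁻¹-cong (homo r x y)) (sym (⁻¹-∙-comm _ _))
      }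
    ; 0#      = record
      { apply   = λ _ → ε
      ; ap-cong = λ _ → refl
      ; homo    = λ _ _ → sym (identityʳ ε)
      }
    ; 1#      = record { apply = id ; ap-cong = id ; homo = λ _ _ → refl }
    ; isRing  = record
      { +-isAbelianGroup = record
        { isGroup = record
          { isMonoid = record
            { isSemigroup = record
              { isMagma = record
                { isEquivalence = record
                  { refl  = λ _ → refl
                  ; sym   = λ p x → sym (p x)
                  ; trans = λ p q x → trans (p x) (q x)
                  }
                ; ∙-cong = λ p q x → ∙-cong (p x) (q x)
                }
              ; assoc = λ r s t x → assoc _ _ _
              }
            ; identity = (λ r x → identityˡ _) , (λ r x → identityʳ _)
            }
          ; inverse = (λ r x → inverseˡ _) , (λ r x → inverseʳ _)
          ; ⁻¹-cong = λ p x → ⁻¹-cong (p x)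
          }
        ; comm = λ r s x → comm _ _
        }
      ; *-cong     = λ {r} p q x → trans (ap-cong r (q x)) (p _)
      ; *-assoc    = λ r s t x → refl
      ; *-identity = (λ r x → refl) , (λ r x → refl)
      ; distrib    = (λ r s t x → homo r _ _) , (λ r s t x → refl)
      }
    }

  endomorphismModule : LeftModule endomorphismRing 0ℓ 0ℓ
  endomorphismModule = record
    { Carrierᴹ     = Carrier
    ; _≈ᴹ_         = _≈_
    ; _+ᴹ_         = _∙_
    ; _*ₗ_         = apply
    ; 0ᴹ           = ε
    ; -ᴹ_          = _⁻¹
    ; isLeftModule = record
      { isLeftSemimodule = record
        { +ᴹ-isCommutativeMonoid = isCommutativeMonoid
        ; isPreleftSemimodule = record
          { *ₗ-cong      = λ {r} p q → trans (ap-cong r q) (p _)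
          ; *ₗ-zeroˡ     = λ _ → refl
          ; *ₗ-distribʳ  = λ _ _ _ → refl
          ; *ₗ-identityˡ = λ _ → refl
          ; *ₗ-assoc     = λ _ _ _ → refl
          ; *ₗ-zeroʳ     = homo-ε
          ; *ₗ-distribˡ  = homo
          }
        }
      ; -ᴹ‿cong    = ⁻¹-cong
      ; -ᴹ‿inverse = inverse
      }
    }

  open RawMonoidDefs rawMonoid using (sum)

  -- Recursive, so that `single (suc i) a` unfolds to `ε ∷ single i a` and the tail of the sum in
  -- `additive-expansion` is literally the induction hypothesis.
  single : ∀ {k} → Fin k → Carrier → Vector Carrier k
  single zero    a = a ∷ λ _ → ε
  single (suc i) a = ε ∷ single i a

  module _ {k : ℕ} (g : Vector Carrier k → Carrier)
           (g-cong : ∀ {u v} → (∀ i → u i ≈ v i) → g u ≈ g v)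
           (g-homo : ∀ u v → g (λ i → u i ∙ v i) ≈ g u ∙ g v) where

    additive-ε : g (λ _ → ε) ≈ ε
    additive-ε = begin
      g (λ _ → ε)                                  ≈⟨ identityʳ _ ⟨
      g (λ _ → ε) ∙ ε                              ≈⟨ ∙-congˡ (inverseʳ (g (λ _ → ε))) ⟨
      g (λ _ → ε) ∙ (g (λ _ → ε) ∙ g (λ _ → ε) ⁻¹) ≈⟨ assoc _ _ _ ⟨
      (g (λ _ → ε) ∙ g (λ _ → ε)) ∙ g (λ _ → ε) ⁻¹ ≈⟨ ∙-congʳ (g-homo _ _) ⟨
      g (λ _ → ε ∙ ε) ∙ g (λ _ → ε) ⁻¹             ≈⟨ ∙-congʳ (g-cong (λ _ → identityʳ ε)) ⟩
      g (λ _ → ε) ∙ g (λ _ → ε) ⁻¹                 ≈⟨ inverseʳ _ ⟩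
      ε                                            ∎
      where open SetoidReasoning setoid

    coordinate : Fin k → Endomorphism
    coordinate i = record
      { apply   = g ∘ single i
      ; ap-cong = λ p → g-cong (single-cong i p)
      ; homo    = λ x y → trans (g-cong (single-homo i x y)) (g-homo _ _)
      }
      where
      single-cong : ∀ {k} (i : Fin k) {a b} → a ≈ b → ∀ j → single i a j ≈ single i b j
      single-cong zero    p zero    = p
      single-cong zero    p (suc j) = refl
      single-cong (suc i) p zero    = refl
      single-cong (suc i) p (suc j) = single-cong i p j

      single-homo : ∀ {k} (i : Fin k) a b j → single i (a ∙ b) j ≈ single i a j ∙ single i b j
      single-homo zero    a b zero    = refl
      single-homo zero    a b (suc j) = sym (identityʳ ε)
      single-homo (suc i) a b zero    = sym (identityʳ ε)
      single-homo (suc i) a b (suc j) = single-homo i a b j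

  additive-expansion : ∀ {k} (g : Vector Carrier k → Carrier)
    (g-cong : ∀ {u v} → (∀ i → u i ≈ v i) → g u ≈ g v)
    (g-homo : ∀ u v → g (λ i → u i ∙ v i) ≈ g u ∙ g v) →
    ∀ u → g u ≈ sum (λ i → g (single i (u i)))
  additive-expansion {zero} g g-cong g-homo u =
    trans (g-cong (λ ())) (additive-ε g g-cong g-homo)
  additive-expansion {suc k} g g-cong g-homo u = begin
    g u
      ≈⟨ g-cong (λ { zero → sym (identityʳ _) ; (suc i) → sym (identityˡ _) }) ⟩
    g (λ i → (u zero ∷ λ _ → ε) i ∙ (ε ∷ (u ∘ suc)) i)
      ≈⟨ g-homo _ _ ⟩
    g (u zero ∷ λ _ → ε) ∙ g (ε ∷ (u ∘ suc))
      ≈⟨ ∙-congˡ (additive-expansion (λ v → g (ε ∷ v))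
           (λ p → g-cong (λ { zero → refl ; (suc i) → p i }))
           (λ v w → trans
             (g-cong (λ { zero → sym (identityʳ ε) ; (suc i) → refl }))
             (g-homo _ _)) (u ∘ suc)) ⟩
    sum (λ i → g (single i (u i))) ∎
    where open SetoidReasoning setoid

-- Mal'cev terms, and the module structure given by a commuting one.

module _ {𝑆 : Signature} where

  IsMalcevTerm : Term 𝑆 (Fin 3) → Algebra 𝑆 → Set
  IsMalcevTerm t 𝐂 = ∀ x y →
    (𝐂 ∋ eval 𝐂 t (x ∷ x ∷ y ∷ []) ≈ y) × (𝐂 ∋ eval 𝐂 t (y ∷ x ∷ x ∷ []) ≈ y)

  module Malcev (t : Term 𝑆 (Fin 3)) (𝐂 : Algebra 𝑆) where
    open Algebra 𝐂

    m : Carrier → Carrier → Carrier → Carrier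
    m x y z = eval 𝐂 t (x ∷ y ∷ z ∷ [])

    m-cong : ∀ {x x′ y y′ z z′} → x ≈ x′ → y ≈ y′ → z ≈ z′ → m x y z ≈ m x′ y′ z′
    m-cong p q r = eval-cong 𝐂 t (λ { zero → p ; (suc zero) → q ; (suc (suc zero)) → r })

  module _ (t : Term 𝑆 (Fin 3)) {𝐂 𝐃 : Algebra 𝑆} (h : Hom 𝐂 𝐃) where
    private
      module C = Malcev t 𝐂
      module D = Malcev t 𝐃
    open Hom h

    m-hom : ∀ x y z → 𝐃 ∋ map (C.m x y z) ≈ D.m (map x) (map y) (map z)
    m-hom x y z = Algebra.trans 𝐃 (eval-hom h t _)
      (eval-cong 𝐃 t (λ { zero → Algebra.refl 𝐃
                        ; (suc zero) → Algebra.refl 𝐃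
                        ; (suc (suc zero)) → Algebra.refl 𝐃 }))

  malcev-separated : (t : Term 𝑆 (Fin 3)) {𝐂 𝐃 : Algebra 𝑆} → IsMalcevTerm t 𝐃 →
    {I : Set} (g : I → Hom 𝐂 𝐃) →
    (∀ x y → (∀ i → 𝐃 ∋ Hom.map (g i) x ≈ Hom.map (g i) y) → 𝐂 ∋ x ≈ y) →
    IsMalcevTerm t 𝐂
  malcev-separated t {𝐂} {𝐃} mal g sep x y =
    sep _ _ (λ i → Algebra.trans 𝐃 (m-hom t (g i) x x y) (proj₁ (mal _ _))) ,
    sep _ _ (λ i → Algebra.trans 𝐃 (m-hom t (g i) y x x) (proj₂ (mal _ _)))

  Commutes : Term 𝑆 (Fin 3) → Algebra 𝑆 → Set
  Commutes t 𝐂 = ∀ f (x y z : Vector Carrier (arity 𝑆 f)) →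
    m (⟦ f ⟧ x) (⟦ f ⟧ y) (⟦ f ⟧ z) ≈ ⟦ f ⟧ (λ i → m (x i) (y i) (z i))
    where
    open Algebra 𝐂
    open Malcev t 𝐂

  module Affine (t : Term 𝑆 (Fin 3)) (𝐂 : Algebra 𝑆) (mal : IsMalcevTerm t 𝐂)
                (comm : Commutes t 𝐂) (0# : Algebra.Carrier 𝐂) where
    open Algebra 𝐂
    open Malcev t 𝐂

    m-left : ∀ x y → m x x y ≈ y
    m-left x y = proj₁ (mal x y)

    m-right : ∀ x y → m y x x ≈ y
    m-right x y = proj₂ (mal x y)

    commutes-term : {X : Set} (s : Term 𝑆 X) (x y z : X → Carrier) →
      m (eval 𝐂 s x) (eval 𝐂 s y) (eval 𝐂 s z) ≈ eval 𝐂 s (λ i → m (x i) (y i) (z i))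
    commutes-term (var i)   x y z = refl
    commutes-term (op f ts) x y z =
      trans (comm f _ _ _) (⟦⟧-cong f (λ i → commutes-term (ts i) x y z))

    -- A 3 by 3 matrix may be evaluated by rows or by columns, since `m` is itself given by a term.
    -- The group laws below come from matrices whose rows and columns collapse by the Mal'cev
    -- identities.
    medial : ∀ x₁ x₂ x₃ y₁ y₂ y₃ z₁ z₂ z₃ →
      m (m x₁ x₂ x₃) (m y₁ y₂ y₃) (m z₁ z₂ z₃) ≈ m (m x₁ y₁ z₁) (m x₂ y₂ z₂) (m x₃ y₃ z₃)
    medial x₁ x₂ x₃ y₁ y₂ y₃ z₁ z₂ z₃ = trans (commutes-term t _ _ _)
      (eval-cong 𝐂 t λ { zero → refl ; (suc zero) → refl ; (suc (suc zero)) → refl })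

    -- The term `m x y z` is read as x - y + z, with an arbitrary element as zero.
    group : AbelianGroup 0ℓ 0ℓ
    group = record
      { Carrier = Carrier
      ; _≈_     = _≈_
      ; _∙_     = λ x y → m x 0# y
      ; ε       = 0#
      ; _⁻¹     = λ x → m 0# x 0#
      ; isAbelianGroup = record
        { isGroup = record
          { isMonoid = record
            { isSemigroup = record
              { isMagma = record
                { isEquivalence = Setoid.isEquivalence setoid
                ; ∙-cong = λ p q → m-cong p refl q
                }
              ; assoc = λ x y z → begin
                  m (m x 0# y) 0# z
                    ≈⟨ m-cong refl (m-left 0# 0#) (m-left 0# z) ⟨
                  m (m x 0# y) (m 0# 0# 0#) (m 0# 0# z)
                    ≈⟨ medial _ _ _ _ _ _ _ _ _ ⟩
                  m (m x 0# 0#) (m 0# 0# 0#) (m y 0# z)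
                    ≈⟨ m-cong (m-right 0# x) (m-left 0# 0#) refl ⟩
                  m x 0# (m y 0# z) ∎
              }
            ; identity = m-left 0# , m-right 0#
            }
          ; inverse = (λ x → trans (plus-comm _ _) (inverseʳ x)) , inverseʳ
          ; ⁻¹-cong = λ p → m-cong refl p refl
          }
        ; comm = plus-comm
        }
      }
      where
      open SetoidReasoning setoid

      plus-comm : ∀ x y → m x 0# y ≈ m y 0# x
      plus-comm x y = begin
        m x 0# y
          ≈⟨ m-cong (m-left 0# x) (m-left 0# 0#) (m-right 0# y) ⟨
        m (m 0# 0# x) (m 0# 0# 0#) (m y 0# 0#)
          ≈⟨ medial _ _ _ _ _ _ _ _ _ ⟩
        m (m 0# 0# y) (m 0# 0# 0#) (m x 0# 0#)
          ≈⟨ m-cong (m-left 0# y) (m-left 0# 0#) (m-right 0# x) ⟩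
        m y 0# x ∎

      inverseʳ : ∀ x → m x 0# (m 0# x 0#) ≈ 0#
      inverseʳ x = begin
        m x 0# (m 0# x 0#)
          ≈⟨ m-cong (m-left x x) (m-left x 0#) refl ⟨
        m (m x x x) (m x x 0#) (m 0# x 0#)
          ≈⟨ medial _ _ _ _ _ _ _ _ _ ⟩
        m (m x x 0#) (m x x x) (m x 0# 0#)
          ≈⟨ m-cong (m-left x 0#) (m-left x x) (m-right 0# x) ⟩
        m 0# x x
          ≈⟨ m-right x 0# ⟩
        0# ∎

    open EndomorphismRing group

    module _ (f : Op 𝑆) where
      origin : Carrier
      origin = ⟦ f ⟧ (λ _ → 0#)

      -- In the group this is f(u) - f(0), the part of the operation that should be additive.
      linear : Vector Carrier (arity 𝑆 f) → Carrier
      linear u = m (⟦ f ⟧ u) origin 0#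

      linear-cong : ∀ {u v} → (∀ i → u i ≈ v i) → linear u ≈ linear v
      linear-cong p = m-cong (⟦⟧-cong f p) refl refl

      linear-homo : ∀ u v → linear (λ i → m (u i) 0# (v i)) ≈ m (linear u) 0# (linear v)
      linear-homo u v = begin
        m (⟦ f ⟧ (λ i → m (u i) 0# (v i))) origin 0#
          ≈⟨ m-cong (comm f u _ v) (m-left origin origin) (m-left 0# 0#) ⟨
        m (m (⟦ f ⟧ u) origin (⟦ f ⟧ v)) (m origin origin origin) (m 0# 0# 0#)
          ≈⟨ medial _ _ _ _ _ _ _ _ _ ⟩
        m (linear u) (m origin origin 0#) (linear v)
          ≈⟨ m-cong refl (m-left origin 0#) refl ⟩
        m (linear u) 0# (linear v) ∎
        where open SetoidReasoning setoid

      linear-origin : ∀ u → m (linear u) 0# origin ≈ ⟦ f ⟧ u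
      linear-origin u = begin
        m (m (⟦ f ⟧ u) origin 0#) 0# origin
          ≈⟨ m-cong refl (m-left 0# 0#) (m-left 0# origin) ⟨
        m (m (⟦ f ⟧ u) origin 0#) (m 0# 0# 0#) (m 0# 0# origin)
          ≈⟨ medial _ _ _ _ _ _ _ _ _ ⟩
        m (m (⟦ f ⟧ u) 0# 0#) (m origin 0# 0#) (m 0# 0# origin)
          ≈⟨ m-cong (m-right 0# _) (m-right 0# origin) (m-left 0# origin) ⟩
        m (⟦ f ⟧ u) origin origin
          ≈⟨ m-right origin _ ⟩
        ⟦ f ⟧ u ∎
        where open SetoidReasoning setoid

    isAbelian : IsAbelian 𝐂
    isAbelian = record
      { ring        = endomorphismRing
      ; leftModule  = endomorphismModule
      ; bijection   = record
        { to = id ; from = id ; to-cong = id ; from-cong = id ; inverse = id , id }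
      ; coefficient = λ f → coordinate (linear f) (linear-cong f) (linear-homo f)
      ; constant    = origin
      ; affine      = λ f u → trans (sym (linear-origin f u))
          (m-cong (additive-expansion (linear f) (linear-cong f) (linear-homo f) u) refl refl)
      }

injective⇒surjective : ∀ {k} (g : Fin k → Fin k) → Injective _≡_ _≡_ g → ∀ y → ∃[ i ] g i ≡ y
injective⇒surjective {suc k} g inj y with Fin.any? (λ i → g i Fin.≟ y)
... | yes found = found
-- If `y` is missed, `punchOut` removes it from the codomain, and `suc k` elements are injected into
-- `k`.
... | no  none  = contradiction
  (Fin.injective⇒≤ {f = λ i → punchOut (y≢g i)}
    (λ p → inj (Fin.punchOut-injective (y≢g _) (y≢g _) p)))
  ℕ.1+n≰n
  where
  y≢g : ∀ i → ¬ y ≡ g i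
  y≢g i p = none (i , ≡.sym p)

module Classical (em : ExcludedMiddle 0ℓ) where

  decide : (P : Set) → Dec P
  decide P = em

  by-contradiction : {P : Set} → ¬ ¬ P → P
  by-contradiction {P} ¬¬p with decide P
  ... | yes p = p
  ... | no ¬p = contradiction ¬p ¬¬p

  find : {I : Set} {P : Pred I 0ℓ} → ¬ (∀ i → ¬ P i) → ∃ P
  find p = by-contradiction (λ q → p (λ i r → q (i , r)))

  find-failure : {I : Set} {P : Pred I 0ℓ} → ¬ (∀ i → P i) → ∃[ i ] ¬ P i
  find-failure p = find (λ q → p (λ i → by-contradiction (q i)))

-- Simple Mal'cev algebras and finite codes for their tuples.

record SimpleMalcevAlgebra (𝑆 : Signature) : Set₁ where
  field
    excludedMiddle : ExcludedMiddle 0ℓ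
    𝐀              : Algebra 𝑆
    finite         : Finite (Algebra.setoid 𝐀)
    simple         : IsSimple 𝐀
    term           : Term 𝑆 (Fin 3)
    malcev         : IsMalcevTerm term 𝐀
    nonabelian     : ¬ IsAbelian 𝐀

  open Classical excludedMiddle public

module Tuples {𝑆 : Signature} (𝒮 : SimpleMalcevAlgebra 𝑆) where
  open SimpleMalcevAlgebra 𝒮 public
  open Algebra 𝐀 public
  open Malcev term 𝐀 public

  M : ℕ
  M = proj₁ finite

  private module F = Inverse (proj₂ finite)
  open F public using (to; from; to-cong)

  from∘to : ∀ a → from (to a) ≈ a
  from∘to = F.strictlyInverseʳ

  to-injective : ∀ {a b} → to a ≡ to b → a ≈ b
  to-injective p = trans (sym (from∘to _)) (trans (F.from-cong p) (from∘to _))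

  x₀ x₁ : Carrier
  x₀ = proj₁ (proj₁ simple)
  x₁ = proj₁ (proj₂ (proj₁ simple))

  x₀≉x₁ : ¬ x₀ ≈ x₁
  x₀≉x₁ = proj₂ (proj₂ (proj₁ simple))

  different : ∀ a → ∃[ b ] ¬ b ≈ a
  different a with decide (x₀ ≈ a)
  ... | yes p = x₁ , λ q → x₀≉x₁ (trans p (sym q))
  ... | no  p = x₀ , p

  encode : ∀ {k} → Vector Carrier k → Fin (M ^ k)
  encode u = funToFin (to ∘ u)

  decode : ∀ {k} → Fin (M ^ k) → Vector Carrier k
  decode c = from ∘ finToFun c

  decode∘encode : ∀ {k} (u : Vector Carrier k) i → decode (encode u) i ≈ u i
  decode∘encode u i = trans (F.from-cong (Fin.finToFun-funToFin (to ∘ u) i)) (from∘to (u i))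

  encode-injective : ∀ {k} {u v : Vector Carrier k} → encode u ≡ encode v → ∀ i → u i ≈ v i
  encode-injective {u = u} {v} p i = trans (sym (decode∘encode u i))
    (trans (reflexive (≡.cong (λ c → decode c i) p)) (decode∘encode v i))

  -- Homomorphisms out of a finite power fall into finitely many tables, even when they are indexed
  -- by an infinite set of points.
  table : ∀ {k} → (Vector Carrier k → Carrier) → Fin (M ^ (M ^ k))
  table g = encode (g ∘ decode)

  Extensional : ∀ {k} → (Vector Carrier k → Carrier) → Set
  Extensional g = ∀ {u v} → (∀ i → u i ≈ v i) → g u ≈ g v

  table-injective : ∀ {k} {g h : Vector Carrier k → Carrier} →
    Extensional g → Extensional h → table g ≡ table h → ∀ u → g u ≈ h u
  table-injective g-ext h-ext p u = trans (g-ext (λ i → sym (decode∘encode u i)))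
    (trans (encode-injective p (encode u)) (h-ext (decode∘encode u)))

  self-injective⇒surjective : (g : Carrier → Carrier) → Injective _≈_ _≈_ g → ∀ y → ∃[ x ] g x ≈ y
  self-injective⇒surjective g inj y =
    let i , p = injective⇒surjective (to ∘ g ∘ from)
                  (λ q → ≡.trans (≡.sym (F.strictlyInverseˡ _))
                    (≡.trans (to-cong (inj (to-injective q))) (F.strictlyInverseˡ _)))
                  (to y)
    in from i , to-injective p

  m-left : ∀ x y → m x x y ≈ y
  m-left x y = proj₁ (malcev x y)

  m-right : ∀ x y → m y x x ≈ y
  m-right x y = proj₂ (malcev x y)

  power-malcev : ∀ {X} → IsMalcevTerm term (power 𝐀 X)
  power-malcev = malcev-separated term malcev (projection 𝐀) (λ x y p → p)

-- Primeness of the kernel of a surjection onto 𝐀.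

module Prime {𝑆 : Signature} (𝒮 : SimpleMalcevAlgebra 𝑆) {𝐂 : Algebra 𝑆}
             (malcevᶜ : IsMalcevTerm (SimpleMalcevAlgebra.term 𝒮) 𝐂)
             (h : Hom 𝐂 (SimpleMalcevAlgebra.𝐀 𝒮)) (h-surj : IsSurjective h) where
  open Tuples 𝒮
  open Hom h
  open Congruence
  private
    module C = Algebra 𝐂
    module Cₘ = Malcev term 𝐂
    module Eq (α : Congruence 𝐂) = IsEquivalence (rel-equivalence α)

  m-compatible : (α : Congruence 𝐂) → ∀ {x x′ y y′ z z′} →
    rel α x x′ → rel α y y′ → rel α z z′ → rel α (Cₘ.m x y z) (Cₘ.m x′ y′ z′)
  m-compatible α p q r = term-compatible term
    (λ { zero → p ; (suc zero) → q ; (suc (suc zero)) → r })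
    where
    term-compatible : ∀ {X : Set} (s : Term 𝑆 X) {ρ ρ′} →
      (∀ i → rel α (ρ i) (ρ′ i)) → rel α (eval 𝐂 s ρ) (eval 𝐂 s ρ′)
    term-compatible (var i)   p = p i
    term-compatible (op f ts) p = compatible α f (λ i → term-compatible (ts i) p)

  pushforward : Congruence 𝐂 → Congruence 𝐀
  pushforward α = record
    { rel             = λ a b → ∃[ x ] ∃[ y ] rel α x y × map x ≈ a × map y ≈ b
    ; rel-equivalence = record
      { refl  = let x , p = h-surj _ in x , x , Eq.refl α , p , p
      ; sym   = λ { (x , y , r , p , q) → y , x , Eq.sym α r , q , p }
      -- `y` and `y′` have the same image but need not be `α`-related. The Mal'cev term bridges
      -- them: `m x y y′` is `α`-related to `m y y y′`, that is to `y′` and hence to `z`, and it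
      -- still lies above the image of `x`.
      ; trans = λ { (x , y , r , p , q) (y′ , z , s , p′ , q′) →
          Cₘ.m x y y′ , z ,
          Eq.trans α (m-compatible α r (Eq.refl α) (Eq.refl α))
            (Eq.trans α (contains-≈ α (proj₁ (malcevᶜ y y′))) s) ,
          trans (m-hom term h x y y′)
            (trans (m-cong p q p′) (m-right _ _)) ,
          q′ }
      }
    ; contains-≈      = λ e → let x , p = h-surj _ in x , x , Eq.refl α , p , trans p e
    ; compatible      = λ f p →
        C.⟦ f ⟧ (proj₁ ∘ p) , C.⟦ f ⟧ (proj₁ ∘ proj₂ ∘ p) ,
        compatible α f (λ i → proj₁ (proj₂ (proj₂ (p i)))) ,
        trans (preserve f _) (⟦⟧-cong f (λ i → proj₁ (proj₂ (proj₂ (proj₂ (p i)))))) ,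
        trans (preserve f _) (⟦⟧-cong f (λ i → proj₂ (proj₂ (proj₂ (proj₂ (p i))))))
    }

  _⊆ker : Congruence 𝐂 → Set
  α ⊆ker = ∀ {x y} → rel α x y → map x ≈ map y

  Transversal : Congruence 𝐂 → Set
  Transversal α = ∀ c a → ∃[ c′ ] rel α c′ c × map c′ ≈ a

  -- Simplicity of 𝐀 is applied to `pushforward α`. If that is full, there is a related pair `x`,
  -- `y` above `a` and `map c`, and the Mal'cev term carries it to the pair `m x y c`, `c`.
  ⊆ker-or-transversal : (α : Congruence 𝐂) → α ⊆ker ⊎ Transversal α
  ⊆ker-or-transversal α with proj₂ simple (pushforward α)
  ... | inj₁ trivial = inj₁ (λ r → trivial (_ , _ , r , refl , refl))
  ... | inj₂ full    = inj₂ λ c a →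
    let x , y , r , p , q = full a (map c) in
    Cₘ.m x y c ,
    Eq.trans α (m-compatible α r (Eq.refl α) (Eq.refl α)) (contains-≈ α (proj₁ (malcevᶜ y c))) ,
    trans (m-hom term h x y c) (trans (m-cong p q refl) (m-right _ _))

  -- With lifts x′ α y′ β z′ of a triple of tuples, both sides of the
  -- commutation equation are α-related to f z′ and β-related to f x′.
  transversal⇒commutes : (α β : Congruence 𝐂) →
    (∀ {x y} → rel α x y → rel β x y → map x ≈ map y) →
    Transversal α → Transversal β → Commutes term 𝐀
  transversal⇒commutes α β α∩β α-trans β-trans f x y z = begin
    m (⟦ f ⟧ x) (⟦ f ⟧ y) (⟦ f ⟧ z)
      ≈⟨ m-cong (⟦⟧-cong f (proj₂ ∘ proj₂ ∘ X)) (⟦⟧-cong f (proj₂ ∘ Y))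
           (⟦⟧-cong f (proj₂ ∘ proj₂ ∘ Z)) ⟨
    m (⟦ f ⟧ (map ∘ x′)) (⟦ f ⟧ (map ∘ y′)) (⟦ f ⟧ (map ∘ z′))
      ≈⟨ m-cong (preserve f x′) (preserve f y′) (preserve f z′) ⟨
    m (map (C.⟦ f ⟧ x′)) (map (C.⟦ f ⟧ y′)) (map (C.⟦ f ⟧ z′))
      ≈⟨ m-hom term h _ _ _ ⟨
    map (Cₘ.m (C.⟦ f ⟧ x′) (C.⟦ f ⟧ y′) (C.⟦ f ⟧ z′))
      ≈⟨ α∩β α-related β-related ⟩
    map (C.⟦ f ⟧ (λ i → Cₘ.m (x′ i) (y′ i) (z′ i)))
      ≈⟨ preserve f _ ⟩
    ⟦ f ⟧ (λ i → map (Cₘ.m (x′ i) (y′ i) (z′ i)))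
      ≈⟨ ⟦⟧-cong f (λ i → trans (m-hom term h _ _ _)
           (m-cong (proj₂ (proj₂ (X i))) (proj₂ (Y i)) (proj₂ (proj₂ (Z i))))) ⟩
    ⟦ f ⟧ (λ i → m (x i) (y i) (z i)) ∎
    where
    open SetoidReasoning setoid
    Y : ∀ i → ∃[ y′ ] map y′ ≈ y i
    Y i = h-surj (y i)
    y′ = proj₁ ∘ Y
    X : ∀ i → ∃[ x′ ] rel α x′ (y′ i) × map x′ ≈ x i
    X i = α-trans (y′ i) (x i)
    x′ = proj₁ ∘ X
    Z : ∀ i → ∃[ z′ ] rel β z′ (y′ i) × map z′ ≈ z i
    Z i = β-trans (y′ i) (z i)
    z′ = proj₁ ∘ Z

    α-related : rel α (Cₘ.m (C.⟦ f ⟧ x′) (C.⟦ f ⟧ y′) (C.⟦ f ⟧ z′))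
                      (C.⟦ f ⟧ (λ i → Cₘ.m (x′ i) (y′ i) (z′ i)))
    α-related = Eq.trans α
      (m-compatible α (compatible α f (proj₁ ∘ proj₂ ∘ X)) (Eq.refl α) (Eq.refl α))
      (Eq.trans α (contains-≈ α (proj₁ (malcevᶜ _ _)))
        (compatible α f (λ i → Eq.sym α (Eq.trans α
          (m-compatible α (proj₁ (proj₂ (X i))) (Eq.refl α) (Eq.refl α))
          (contains-≈ α (proj₁ (malcevᶜ _ _)))))))

    β-related : rel β (Cₘ.m (C.⟦ f ⟧ x′) (C.⟦ f ⟧ y′) (C.⟦ f ⟧ z′))
                      (C.⟦ f ⟧ (λ i → Cₘ.m (x′ i) (y′ i) (z′ i)))
    β-related = Eq.trans β
      (m-compatible β (Eq.refl β) (Eq.refl β) (compatible β f (proj₁ ∘ proj₂ ∘ Z)))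
      (Eq.trans β (contains-≈ β (proj₂ (malcevᶜ _ _)))
        (compatible β f (λ i → Eq.sym β (Eq.trans β
          (m-compatible β (Eq.refl β) (Eq.refl β) (proj₁ (proj₂ (Z i))))
          (contains-≈ β (proj₂ (malcevᶜ _ _)))))))

  prime : (α β : Congruence 𝐂) →
    (∀ {x y} → rel α x y → rel β x y → map x ≈ map y) → α ⊆ker ⊎ β ⊆ker
  prime α β α∩β with ⊆ker-or-transversal α | ⊆ker-or-transversal β
  ... | inj₁ p | _      = inj₁ p
  ... | inj₂ _ | inj₁ q = inj₂ q
  ... | inj₂ p | inj₂ q = contradiction
    (Affine.isAbelian term 𝐀 malcev (transversal⇒commutes α β α∩β p q) x₀) nonabelian

  not-constant : ¬ (∀ x y → map x ≈ map y)
  not-constant p =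
    let y₀ , q₀ = h-surj x₀ ; y₁ , q₁ = h-surj x₁
    in x₀≉x₁ (trans (sym q₀) (trans (p y₀ y₁) q₁))

  prime-finite : ∀ {N} (α : Fin N → Congruence 𝐂) →
    intersection α ⊆ker → ∃[ i ] α i ⊆ker
  -- The empty intersection is the full relation, which only a constant map has in its kernel.
  prime-finite {zero}  α p = contradiction (λ x y → p (λ ())) not-constant
  prime-finite {suc N} α p
    with prime (α zero) (intersection (α ∘ suc)) (λ r s → p (λ { zero → r ; (suc i) → s i }))
  ... | inj₁ q = zero , q
  ... | inj₂ q = let i , r = prime-finite (α ∘ suc) q in suc i , r

  module _ {I : Set} (g : I → Hom 𝐂 𝐀) {N : ℕ} (code : I → Fin N)
           (code-faithful : ∀ {i j} → code i ≡ code j → ∀ x → Hom.map (g i) x ≈ Hom.map (g j) x)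
           (jointly : ∀ {x y} → (∀ i → Hom.map (g i) x ≈ Hom.map (g i) y) → map x ≈ map y) where

    -- The index set may be infinite, so kernels are grouped by code: each group consists of equal
    -- kernels, and primeness applies to the finitely many group intersections. The code found is
    -- attained, because an empty group would give the full relation.
    kernel-below : ∃[ i ] kernel (g i) ⊆ker
    kernel-below
      with prime-finite (λ n → intersection {I = ∃[ i ] code i ≡ n} (λ { (i , _) → kernel (g i) }))
             (λ p → jointly (λ i → p (code i) (i , ≡.refl)))
    ... | n , q = i , λ {x} {y} r → q (λ { (j , cj) →
          let e = code-faithful (≡.trans cj (≡.sym ci))
          in trans (e x) (trans r (sym (e y))) })
      where
      attained : ∃[ i ] code i ≡ n
      attained = find (λ none → not-constant
        (λ x y → q (λ { (i , ci) → contradiction ci (none i) })))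
      i = proj₁ attained
      ci = proj₂ attained

    -- As the kernel of `g i` lies in that of `h`, the map `g i` is injective on a set of
    -- representatives of the values of `h`. On the finite set 𝐀 this makes `g i` after `section` a
    -- permutation, and its inverse is the automorphism.
    factors-through-automorphism :
      ∃[ i ] Σ (𝐀 ≅ 𝐀) λ σ → ∀ x → map x ≈ _≅_.map σ (Hom.map (g i) x)
    factors-through-automorphism = i , bijection⇒≅ σ σ-inj σ-surj , factorisation
      where
      i = proj₁ kernel-below
      module G = Hom (g i)
      below : ∀ {x y} → G.map x ≈ G.map y → map x ≈ map y
      below = proj₂ kernel-below

      -- Going through `from ∘ to` gives `≈`-equal arguments propositionally equal lifts.
      section : Carrier → C.Carrier
      section a = proj₁ (h-surj (from (to a)))

      section-cong : ∀ {a b} → a ≈ b → section a ≡ section b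
      section-cong p = ≡.cong (λ i → proj₁ (h-surj (from i))) (to-cong p)

      map-section : ∀ a → map (section a) ≈ a
      map-section a = trans (proj₂ (h-surj (from (to a)))) (from∘to a)

      G-section-surj : ∀ b → ∃[ a ] G.map (section a) ≈ b
      G-section-surj = self-injective⇒surjective (G.map ∘ section)
        (λ p → trans (sym (map-section _)) (trans (below p) (map-section _)))

      factorisation : ∀ x → map x ≈ proj₁ (G-section-surj (G.map x))
      factorisation x = trans (below (sym (proj₂ (G-section-surj (G.map x))))) (map-section _)

      σ : Hom 𝐀 𝐀
      σ = record
        { map      = proj₁ ∘ G-section-surj
        ; cong     = λ p → σ-cong p
        ; preserve = λ f u →
            let x = λ j → section (proj₁ (G-section-surj (u j)))
            in trans (σ-cong (trans (⟦⟧-cong f (λ j → sym (proj₂ (G-section-surj (u j)))))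
                               (sym (G.preserve f x))))
               (trans (sym (factorisation (C.⟦ f ⟧ x)))
               (trans (preserve f x) (⟦⟧-cong f (λ j → map-section _))))
        }
        where
        σ-cong : ∀ {a b} → a ≈ b → proj₁ (G-section-surj a) ≈ proj₁ (G-section-surj b)
        σ-cong p = trans (sym (map-section _)) (trans
          (below (trans (proj₂ (G-section-surj _)) (trans p (sym (proj₂ (G-section-surj _))))))
          (map-section _))

      σ-inj : Injective _≈_ _≈_ (Hom.map σ)
      σ-inj p = trans (sym (proj₂ (G-section-surj _)))
        (trans (reflexive (≡.cong G.map (section-cong p))) (proj₂ (G-section-surj _)))

      σ-surj : IsSurjective σ
      σ-surj a = G.map (section a) , trans (sym (factorisation (section a))) (map-section a)

-- Homomorphisms between finite powers, JEP and AP.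

module Homs {𝑆 : Signature} (𝒮 : SimpleMalcevAlgebra 𝑆) where
  open Tuples 𝒮

  constant⇒idempotent : {𝐂 : Algebra 𝑆} (h : Hom 𝐂 𝐀) (e : Carrier) → Algebra.Carrier 𝐂 →
    (∀ c → Hom.map h c ≈ e) → IsIdempotent 𝐀 e
  constant⇒idempotent {𝐂} h e c₀ const = record
    { respects = λ p q → trans (sym p) q
    ; closed   = λ f u p → trans (⟦⟧-cong f (λ i → trans (p i) (sym (const c₀))))
        (trans (sym (Hom.preserve h f (λ _ → c₀))) (const _))
    }

  identity-automorphism : 𝐀 ≅ 𝐀
  identity-automorphism = bijection⇒≅ (idHom 𝐀) id (λ a → a , refl)

  module _ {p : ℕ} (h : Hom (𝐀 ↑ suc p) 𝐀) where
    open Hom h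

    plug : Vector Carrier p → Carrier → Carrier
    plug u a = map (a ∷ u)

    plug-cong : ∀ {u a b} → a ≈ b → plug u a ≈ plug u b
    plug-cong e = cong (λ { zero → e ; (suc i) → refl })

    -- Coordinatewise `m (b ∷ u) (a ∷ u) (a ∷ v)` collapses to `b ∷ v`, while after `map` the
    -- equality in the context `u` turns the same term into `plug v a`.
    change-context : ∀ {a b} u v → plug u a ≈ plug u b → plug v a ≈ plug v b
    change-context {a} {b} u v e = begin
      plug v a                                  ≈⟨ m-left _ _ ⟨
      m (plug u a) (plug u a) (plug v a)        ≈⟨ m-cong e refl refl ⟩
      m (plug u b) (plug u a) (plug v a)        ≈⟨ m-hom term h _ _ _ ⟨
      map (P.m (b ∷ u) (a ∷ u) (a ∷ v))         ≈⟨ cong pointwise ⟩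
      plug v b                                  ∎
      where
      open SetoidReasoning setoid
      module P = Malcev term (𝐀 ↑ suc p)
      pointwise : ∀ i → P.m (b ∷ u) (a ∷ u) (a ∷ v) i ≈ (b ∷ v) i
      pointwise zero    = trans (m-hom term (projection 𝐀 zero) _ _ _) (m-right _ _)
      pointwise (suc i) = trans (m-hom term (projection 𝐀 (suc i)) _ _ _) (m-left _ _)

    preserve-∷ : ∀ f u (v : Fin (arity 𝑆 f) → Vector Carrier p) →
      map (⟦ f ⟧ u ∷ λ i → ⟦ f ⟧ (λ j → v j i)) ≈ ⟦ f ⟧ (λ j → plug (v j) (u j))
    preserve-∷ f u v = trans (cong (λ { zero → refl ; (suc i) → refl }))
      (preserve f (λ j → u j ∷ v j))

    headCongruence : Congruence 𝐀
    headCongruence = record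
      { rel             = λ a b → ∀ u → plug u a ≈ plug u b
      ; rel-equivalence = record
        { refl  = λ _ → refl
        ; sym   = λ e u → sym (e u)
        ; trans = λ e e′ u → trans (e u) (e′ u)
        }
      ; contains-≈      = λ e u → plug-cong e
      -- The operation also acts on the context, entry by entry on constant families;
      -- `change-context` returns to `u`.
      ; compatible      = λ f e u → change-context _ u (trans (preserve-∷ f _ (λ _ → u))
          (trans (⟦⟧-cong f (λ i → e i u)) (sym (preserve-∷ f _ (λ _ → u)))))
      }

  -- Induction on the number of arguments: if the head congruence is trivial, varying the head alone
  -- is an injective, hence surjective, self-map of the finite 𝐀; if it is full, the head has no
  -- influence and is fixed at `x₀`.
  ¬surjective⇒constant : ∀ {p} (h : Hom (𝐀 ↑ p) 𝐀) → ¬ IsSurjective h →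
    ∀ u v → Hom.map h u ≈ Hom.map h v
  ¬surjective⇒constant {zero}  h ¬surj u v = Hom.cong h (λ ())
  ¬surjective⇒constant {suc p} h ¬surj u v with proj₂ simple (headCongruence h)
  ... | inj₁ trivial = contradiction
    (λ y → let a , e = self-injective⇒surjective (plug h (u ∘ suc))
                         (λ e → trivial (λ w → change-context h (u ∘ suc) w e)) y
           in a ∷ (u ∘ suc) , e)
    ¬surj
  ... | inj₂ full = begin
      map u            ≈⟨ to-tail u ⟩
      plug h (u ∘ suc) x₀ ≈⟨ ¬surjective⇒constant tail-hom (λ s → ¬surj (λ y →
                            let w , e = s y in x₀ ∷ w , e)) (u ∘ suc) (v ∘ suc) ⟩
      plug h (v ∘ suc) x₀ ≈⟨ to-tail v ⟨
      map v            ∎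
    where
    open Hom h
    open SetoidReasoning setoid
    to-tail : ∀ w → map w ≈ plug h (w ∘ suc) x₀
    to-tail w = trans (cong (λ { zero → refl ; (suc i) → refl })) (full (w zero) x₀ (w ∘ suc))

    tail-hom : Hom (𝐀 ↑ p) 𝐀
    tail-hom = record
      { map      = λ w → plug h w x₀
      ; cong     = λ e → cong (λ { zero → refl ; (suc i) → e i })
      ; preserve = λ f w → trans (full x₀ (⟦ f ⟧ (λ _ → x₀)) _) (preserve-∷ h f (λ _ → x₀) w)
      }

  surjective-or-constant : ∀ {p} (h : Hom (𝐀 ↑ p) 𝐀) →
    IsSurjective h ⊎ (∃[ e ] IsIdempotent 𝐀 e × (∀ u → Hom.map h u ≈ e))
  surjective-or-constant h with decide (IsSurjective h)
  ... | yes surj = inj₁ surj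
  ... | no ¬surj =
    inj₂ (_ , constant⇒idempotent h _ (λ _ → x₀) const , const)
    where const = λ u → ¬surjective⇒constant h ¬surj u (λ _ → x₀)

  -- The components of `ψ` separate points, so a surjective `h` is one of them followed by an
  -- automorphism, and this automorphism after the projection of `𝐀 ↑ r` is the extension. A
  -- constant `h` extends as a constant.
  extend-hom : ∀ {p r} (ψ : Embedding (𝐀 ↑ p) (𝐀 ↑ r)) (h : Hom (𝐀 ↑ p) 𝐀) →
    Σ (Hom (𝐀 ↑ r) 𝐀) λ τ → ∀ u → Hom.map τ (Embedding.map ψ u) ≈ Hom.map h u
  extend-hom ψ h with surjective-or-constant h
  ... | inj₂ (e , e-idem , const) = constHom e e-idem , λ u → sym (const u)
  ... | inj₁ surj =
    let i , σ , p = Prime.factors-through-automorphism 𝒮 power-malcev h surj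
                      (λ i → projection 𝐀 i ∘ₕ Embedding.hom ψ) id
                      (λ { ≡.refl x → refl })
                      (λ q → Hom.cong h (Embedding.injective ψ q))
    in _≅_.hom σ ∘ₕ projection 𝐀 i , λ u → sym (p u)

  module _ {𝐂 : Algebra 𝑆} {p q : ℕ} (f : Fin p → Hom 𝐂 𝐀) (g : Fin q → Hom 𝐂 𝐀) where

    pairing : Hom 𝐂 (𝐀 ↑ (p + q))
    pairing = tuple (λ z → [ f , g ]′ (splitAt p z))

    pairing-↑ˡ : ∀ c i → Hom.map pairing c (i ↑ˡ q) ≡ Hom.map (f i) c
    pairing-↑ˡ c i = ≡.cong (λ s → Hom.map ([ f , g ]′ s) c) (Fin.splitAt-↑ˡ p i q)

    pairing-↑ʳ : ∀ c i → Hom.map pairing c (p ↑ʳ i) ≡ Hom.map (g i) c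
    pairing-↑ʳ c i = ≡.cong (λ s → Hom.map ([ f , g ]′ s) c) (Fin.splitAt-↑ʳ p q i)

  graphˡ : ∀ {p q} → (Fin q → Hom (𝐀 ↑ p) 𝐀) → Embedding (𝐀 ↑ p) (𝐀 ↑ (p + q))
  graphˡ {p} {q} g = record
    { hom       = pairing (projection 𝐀) g
    ; injective = λ {u} {v} e i → trans (sym (reflexive (pairing-↑ˡ (projection 𝐀) g u i)))
        (trans (e (i ↑ˡ q)) (reflexive (pairing-↑ˡ (projection 𝐀) g v i)))
    }

  graphʳ : ∀ {p q} → (Fin q → Hom (𝐀 ↑ p) 𝐀) → Embedding (𝐀 ↑ p) (𝐀 ↑ (q + p))
  graphʳ {p} {q} g = record
    { hom       = pairing g (projection 𝐀)
    ; injective = λ {u} {v} e i → trans (sym (reflexive (pairing-↑ʳ g (projection 𝐀) u i)))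
        (trans (e (q ↑ʳ i)) (reflexive (pairing-↑ʳ g (projection 𝐀) v i)))
    }

  1≤+ : ∀ {p} q → 1 ≤ p → 1 ≤ p + q
  1≤+ q 1≤p = ℕ.≤-trans 1≤p (ℕ.m≤m+n _ q)

  powers-JEP : JEP (finitePowers 𝐀)
  powers-JEP (suc p , 1≤p) (suc q , _) =
    (suc p + suc q , 1≤+ (suc q) 1≤p) ,
    graphˡ (λ _ → projection 𝐀 zero) , graphʳ {q = suc p} (λ _ → projection 𝐀 zero)

  -- Each coordinate of `ψ` is extended to `𝐀 ↑ q` and each coordinate of `φ` to `𝐀 ↑ r`; along the
  -- graphs of these extensions both images of `u` are the pair of `φ u` and `ψ u`.
  powers-AP : AP (finitePowers 𝐀)
  powers-AP (p , _) (q , 1≤q) (r , _) φ ψ =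
    (q + r , 1≤+ r 1≤q) , graphˡ (proj₁ ∘ right) , graphʳ (proj₁ ∘ left) , agree
    where
    left : ∀ j → Σ (Hom (𝐀 ↑ r) 𝐀) λ τ → ∀ u → Hom.map τ (Embedding.map ψ u) ≈ Embedding.map φ u j
    left j = extend-hom ψ (projection 𝐀 j ∘ₕ Embedding.hom φ)

    right : ∀ j → Σ (Hom (𝐀 ↑ q) 𝐀) λ τ → ∀ u → Hom.map τ (Embedding.map φ u) ≈ Embedding.map ψ u j
    right j = extend-hom φ (projection 𝐀 j ∘ₕ Embedding.hom ψ)

    agree : ∀ u z → Embedding.map (graphˡ (proj₁ ∘ right)) (Embedding.map φ u) z ≈
                    Embedding.map (graphʳ (proj₁ ∘ left)) (Embedding.map ψ u) z
    agree u z with splitAt q z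
    ... | inj₁ j = sym (proj₂ (left j) u)
    ... | inj₂ j = proj₂ (right j) u

upperBound : ∀ {k} (b : Fin k → ℕ) → ∃[ N ] (∀ i → b i ≤ N)
upperBound {zero}  b = 0 , λ ()
upperBound {suc k} b =
  let N , b≤N = upperBound (b ∘ suc)
  in b zero ⊔ N , λ { zero    → ℕ.m≤m⊔n (b zero) N
                    ; (suc i) → ℕ.≤-trans (b≤N i) (ℕ.m≤n⊔m (b zero) N) }

-- Rich algebras: back and forth, and generalized Fraïssé limits.

module RichAlgebras {𝑆 : Signature} (𝒮 : SimpleMalcevAlgebra 𝑆) where
  open Tuples 𝒮
  open Homs 𝒮

  -- adjoin is the one-step form of the extension property of the Fraïssé limit.
  record Rich (𝐋 : Algebra 𝑆) : Set where
    private module L = Algebra 𝐋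
    field
      countable : Countable L.setoid
      cover     : ∀ {N} (d : Fin N → L.Carrier) →
        ∃[ l ] 1 ≤ l × Σ (Embedding (𝐀 ↑ l) 𝐋) λ w → ∀ i → ∃[ b ] Embedding.map w b L.≈ d i
      adjoin    : ∀ {k} → 1 ≤ k → (u : Embedding (𝐀 ↑ k) 𝐋) (h : Hom (𝐀 ↑ k) 𝐀) →
        Σ (Embedding (𝐀 ↑ suc k) 𝐋) λ w →
          ∀ a → Embedding.map w (Hom.map h a ∷ a) L.≈ Embedding.map u a

  module _ {𝐋 : Algebra 𝑆} (rich : Rich 𝐋) where
    open Rich rich
    private module L = Algebra 𝐋

    -- New coordinates are added in front, so the old copy stays in the last `k` places, from which
    -- each `v i` is read off. Constraining `b` coordinatewise avoids reassociating concatenated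
    -- tuples.
    adjoin-family : ∀ {k} → 1 ≤ k → (u : Embedding (𝐀 ↑ k) 𝐋) →
      ∀ {q} (v : Fin q → Hom (𝐀 ↑ k) 𝐀) →
      Σ (Embedding (𝐀 ↑ (q + k)) 𝐋) λ w → ∀ a b →
        (∀ i → b (i ↑ˡ k) ≈ Hom.map (v i) a) → (∀ j → b (q ↑ʳ j) ≈ a j) →
        Embedding.map w b L.≈ Embedding.map u a
    adjoin-family 1≤k u {zero}  v = u , λ a b _ p → Embedding.cong u p
    adjoin-family {k} 1≤k u {suc q} v =
      let w , w-spec = adjoin-family 1≤k u (v ∘ suc)
          h          = v zero ∘ₕ tuple (λ j → projection 𝐀 (q ↑ʳ j))
          w′ , agree = adjoin (ℕ.≤-trans 1≤k (ℕ.m≤n+m k q)) w h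
      in w′ , λ a b p r → L.trans
        (Embedding.cong w′ λ { zero → trans (p zero) (Hom.cong (v zero) (λ j → sym (r j)))
                             ; (suc i) → refl })
        (L.trans (agree (b ∘ suc)) (w-spec a (b ∘ suc) (p ∘ suc) r))

    -- All coordinates of `v` are adjoined to the given copy of `𝐀 ↑ k`. Inside the resulting copy
    -- of `𝐀 ↑ (l + k)` sits `𝐀 ↑ l`, as the graph of homomorphisms that recover the old coordinates
    -- from `v`.
    extend : ∀ {k l} → 1 ≤ k → (u : Embedding (𝐀 ↑ k) 𝐋) (v : Embedding (𝐀 ↑ k) (𝐀 ↑ l)) →
      Σ (Embedding (𝐀 ↑ l) 𝐋) λ w →
        ∀ a → Embedding.map w (Embedding.map v a) L.≈ Embedding.map u a
    extend {k} {l} 1≤k u v =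
      let w , w-spec = adjoin-family 1≤k u (λ i → projection 𝐀 i ∘ₕ Embedding.hom v)
          τ          = λ j → extend-hom v (projection 𝐀 j)
      in w ∘ₑ graphˡ (proj₁ ∘ τ) , λ a → w-spec a _
        (λ i → reflexive (pairing-↑ˡ (projection 𝐀) (proj₁ ∘ τ) _ i))
        (λ j → trans (reflexive (pairing-↑ʳ (projection 𝐀) (proj₁ ∘ τ) _ j)) (proj₂ (τ j) a))

    -- Covering the empty family yields a copy of some power; its diagonal is a copy of `𝐀 ↑ 1`,
    -- which is then extended along the diagonal of `𝐀 ↑ k`.
    power-embedding : ∀ {k} → 1 ≤ k → Embedding (𝐀 ↑ k) 𝐋
    power-embedding 1≤k =
      let l , 1≤l , w , _ = cover {0} (λ ())
      in proj₁ (extend (s≤s z≤n) (w ∘ₑ diagonal 𝐀 1≤l) (diagonal 𝐀 1≤k))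

    cover-range : ∀ {k} (u : Embedding (𝐀 ↑ k) 𝐋) y →
      ∃[ l ] 1 ≤ l × Σ (Embedding (𝐀 ↑ l) 𝐋) λ w →
        (∀ a → ∃[ b ] Embedding.map w b L.≈ Embedding.map u a) × (∃[ b ] Embedding.map w b L.≈ y)
    cover-range u y =
      let l , 1≤l , w , p = cover (y ∷ (Embedding.map u ∘ decode))
      in l , 1≤l , w ,
        (λ a → let b , q = p (suc (encode a))
               in b , L.trans q (Embedding.cong u (decode∘encode a))) ,
        p zero

  -- A partial isomorphism is kept as two parametrisations by one power, so that both sides can be
  -- extended along the same embedding of powers: in `forth`, a covering copy in `𝐋` determines this
  -- embedding, and `extend` follows it in `𝐋′`.
  record PartialIso (𝐋 𝐋′ : Algebra 𝑆) : Set where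
    field
      {size}   : ℕ
      positive : 1 ≤ size
      left     : Embedding (𝐀 ↑ size) 𝐋
      right    : Embedding (𝐀 ↑ size) 𝐋′
    module Left  = Embedding left
    module Right = Embedding right
  open PartialIso

  flip : ∀ {𝐋 𝐋′} → PartialIso 𝐋 𝐋′ → PartialIso 𝐋′ 𝐋
  flip s = record { positive = positive s ; left = right s ; right = left s }

  infix 4 _⊴_
  _⊴_ : ∀ {𝐋 𝐋′} → Rel (PartialIso 𝐋 𝐋′) 0ℓ
  _⊴_ {𝐋} {𝐋′} s s′ = Σ (Vector Carrier (size s) → Vector Carrier (size s′)) λ v → ∀ a →
    (𝐋 ∋ Left.map s′ (v a) ≈ Left.map s a) × (𝐋′ ∋ Right.map s′ (v a) ≈ Right.map s a)

  ⊴-refl : ∀ {𝐋 𝐋′} {s : PartialIso 𝐋 𝐋′} → s ⊴ s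
  ⊴-refl {𝐋} {𝐋′} = id , λ a → Algebra.refl 𝐋 , Algebra.refl 𝐋′

  ⊴-trans : ∀ {𝐋 𝐋′} {s s′ s″ : PartialIso 𝐋 𝐋′} → s ⊴ s′ → s′ ⊴ s″ → s ⊴ s″
  ⊴-trans {𝐋} {𝐋′} (v , p) (w , q) = w ∘ v , λ a →
    Algebra.trans 𝐋 (proj₁ (q (v a))) (proj₁ (p a)) ,
    Algebra.trans 𝐋′ (proj₂ (q (v a))) (proj₂ (p a))

  forth : ∀ {𝐋 𝐋′} → Rich 𝐋 → Rich 𝐋′ → (s : PartialIso 𝐋 𝐋′) (y : Algebra.Carrier 𝐋) →
    Σ (PartialIso 𝐋 𝐋′) λ s′ → s ⊴ s′ × ∃[ b ] 𝐋 ∋ Left.map s′ b ≈ y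
  forth rich rich′ s y =
    let l , 1≤l , w , contains , y∈w = cover-range rich (left s) y
        v , wv≈left  = Image.factor w (left s) contains
        w′ , w′v≈right = extend rich′ (positive s) (right s) v
    in record { positive = 1≤l ; left = w ; right = w′ } ,
       (Embedding.map v , λ a → wv≈left a , w′v≈right a) , y∈w

  module BackAndForth {𝐋 𝐋′ : Algebra 𝑆} (rich : Rich 𝐋) (rich′ : Rich 𝐋′)
                      (start : PartialIso 𝐋 𝐋′) where
    private
      module L  = Algebra 𝐋
      module L′ = Algebra 𝐋′
      module E  = Surjection (Rich.countable rich)
      module E′ = Surjection (Rich.countable rich′)

    module _ (s : PartialIso 𝐋 𝐋′) (n : ℕ) where
      private
        s₁ = forth rich rich′ s (E.to n)
        s₂ = forth rich′ rich (flip (proj₁ s₁)) (E′.to n)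

      next : PartialIso 𝐋 𝐋′
      next = flip (proj₁ s₂)

      back-⊴ : proj₁ s₁ ⊴ next
      back-⊴ = let v , p = proj₁ (proj₂ s₂) in v , λ a → proj₂ (p a) , proj₁ (p a)

      next-⊴ : s ⊴ next
      next-⊴ = ⊴-trans {s = s} {proj₁ s₁} {next} (proj₁ (proj₂ s₁)) back-⊴

      next-left : ∃[ b ] Left.map next b L.≈ E.to n
      next-left = let b , p = proj₂ (proj₂ s₁)
                  in proj₁ back-⊴ b , L.trans (proj₁ (proj₂ back-⊴ b)) p

      next-right : ∃[ b ] Right.map next b L′.≈ E′.to n
      next-right = proj₂ (proj₂ s₂)

    chain : ℕ → PartialIso 𝐋 𝐋′
    chain zero    = start
    chain (suc n) = next (chain n) n

    chain-⊴ : ∀ {n k} → n ≤ k → chain n ⊴ chain k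
    chain-⊴ {n} n≤k = go (ℕ.≤⇒≤′ n≤k)
      where
      go : ∀ {k} → n ≤′ k → chain n ⊴ chain k
      go {k} ≤′-refl = ⊴-refl {s = chain k}
      go {suc k} (≤′-step p) =
        ⊴-trans {s = chain n} {chain k} {chain (suc k)} (go p) (next-⊴ (chain k) k)

    Matched : ℕ → L.Carrier → L′.Carrier → Set
    Matched n y y′ = ∃[ b ] Left.map (chain n) b L.≈ y × Right.map (chain n) b L′.≈ y′

    matched-mono : ∀ {n k y y′} → n ≤ k → Matched n y y′ → Matched k y y′
    matched-mono n≤k (b , p , q) =
      let v , r = chain-⊴ n≤k
      in v b , L.trans (proj₁ (r b)) p , L′.trans (proj₂ (r b)) q

    infix 4 _∼_
    _∼_ : L.Carrier → L′.Carrier → Set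
    y ∼ y′ = ∃[ n ] Matched n y y′

    module _ {y y′ z z′} (μ : y ∼ y′) (ν : z ∼ z′) where
      private
        n = proj₁ μ
        k = proj₁ ν
        μ̂ = matched-mono (ℕ.m≤m⊔n n k) (proj₂ μ)
        ν̂ = matched-mono (ℕ.m≤n⊔m n k) (proj₂ ν)
        s = chain (n ⊔ k)

      matched-right : y L.≈ z → y′ L′.≈ z′
      matched-right p = L′.trans (L′.sym (proj₂ (proj₂ μ̂))) (L′.trans
        (Right.cong s (Left.injective s
          (L.trans (proj₁ (proj₂ μ̂)) (L.trans p (L.sym (proj₁ (proj₂ ν̂)))))))
        (proj₂ (proj₂ ν̂)))

      matched-left : y′ L′.≈ z′ → y L.≈ z
      matched-left p = L.trans (L.sym (proj₁ (proj₂ μ̂))) (L.trans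
        (Left.cong s (Right.injective s
          (L′.trans (proj₂ (proj₂ μ̂)) (L′.trans p (L′.sym (proj₂ (proj₂ ν̂)))))))
        (proj₁ (proj₂ ν̂)))

    matched-op : ∀ f {y : Vector L.Carrier (arity 𝑆 f)} {y′} →
      (∀ i → y i ∼ y′ i) → L.⟦ f ⟧ y ∼ L′.⟦ f ⟧ y′
    matched-op f μ =
      let N , ≤N = upperBound (proj₁ ∘ μ)
          ν      = λ i → matched-mono (≤N i) (proj₂ (μ i))
      in N , Algebra.⟦_⟧ (𝐀 ↑ _) f (proj₁ ∘ ν) ,
        L.trans (Left.preserve (chain N) f _) (L.⟦⟧-cong f (proj₁ ∘ proj₂ ∘ ν)) ,
        L′.trans (Right.preserve (chain N) f _) (L′.⟦⟧-cong f (proj₂ ∘ proj₂ ∘ ν))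

    total : ∀ y → ∃[ y′ ] y ∼ y′
    total y =
      let n , hit = E.surjective y
          b , p   = next-left (chain n) n
      in _ , suc n , b , L.trans p (hit ≡.refl) , L′.refl

    iso : 𝐋 ≅ 𝐋′
    iso = bijection⇒≅
      (record
        { map      = proj₁ ∘ total
        ; cong     = λ {y} {z} → matched-right (matched y) (matched z)
        ; preserve = λ f u → matched-right (matched (L.⟦ f ⟧ u))
                       (matched-op f (proj₂ ∘ total ∘ u)) L.refl
        })
      (λ {y} {z} → matched-left (matched y) (matched z))
      (λ y′ →
        let n , hit = E′.surjective y′
            b , p   = next-right (chain n) n
            y       = Left.map (chain (suc n)) b
        in y , matched-right (matched y)
                 (suc n , b , L.refl , L′.trans p (hit ≡.refl)) L.refl)
      where
      matched : ∀ y → y ∼ proj₁ (total y)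
      matched y = proj₂ (total y)

    iso-extends : ∀ a → _≅_.map iso (Left.map start a) L′.≈ Right.map start a
    iso-extends a = matched-right (proj₂ (total (Left.map start a)))
      (0 , a , L.refl , L′.refl) L.refl

  rich-unique : ∀ {𝐋 𝐋′} → Rich 𝐋 → Rich 𝐋′ → 𝐋 ≅ 𝐋′
  rich-unique rich rich′ = BackAndForth.iso rich rich′ record
    { positive = s≤s z≤n
    ; left     = power-embedding rich {1} (s≤s z≤n)
    ; right    = power-embedding rich′ {1} (s≤s z≤n)
    }

  module _ {𝐋 : Algebra 𝑆} (rich : Rich 𝐋) where
    private module L = Algebra 𝐋

    rich-homogeneous : ∀ {P Q : Pred L.Carrier 0ℓ}
      (P-sub : IsSubuniverse 𝐋 P) (Q-sub : IsSubuniverse 𝐋 Q) →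
      ∃ (λ i → subalgebra 𝐋 P-sub ≅ finitePowers 𝐀 i) →
      (σ : subalgebra 𝐋 P-sub ≅ subalgebra 𝐋 Q-sub) →
      Σ (𝐋 ≅ 𝐋) λ α → ∀ a → _≅_.map α (proj₁ a) L.≈ proj₁ (_≅_.map σ a)
    rich-homogeneous P-sub Q-sub ((k , 1≤k) , α) σ = B.iso , λ a →
      L.trans (Iso.cong B.iso (L.sym (Iso.from∘map α a)))
        (L.trans (B.iso-extends (_≅_.map α a)) (Iso.cong σ (Iso.from∘map α a)))
      where
      from-P : Embedding (𝐀 ↑ k) (subalgebra 𝐋 P-sub)
      from-P = Iso.embedding (Iso.inverse α)
      start : PartialIso 𝐋 𝐋
      start = record
        { positive = 1≤k
        ; left     = subalgebra-inclusion 𝐋 P-sub ∘ₑ from-P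
        ; right    = subalgebra-inclusion 𝐋 Q-sub ∘ₑ Iso.embedding σ ∘ₑ from-P
        }
      module B = BackAndForth rich rich start

    rich-age⊆ : (P : FGSubalgebra 𝐋) → ∃[ i ] Σ (FGSubalgebra (finitePowers 𝐀 i)) λ Q →
      FGSubalgebra.algebra P ≅ FGSubalgebra.algebra Q
    rich-age⊆ P =
      let n , g , P-g , P-least = isFinitelyGenerated
          l , 1≤l , w , covered = Rich.cover rich g
          module W = Embedding w
          open Image w
          b        = proj₁ ∘ covered
          wb≈g     = proj₂ ∘ covered
          in-range : ∀ {y} → pred y → range y
          in-range = P-least range range-isSubuniverse (λ i → b i , tt , wb≈g i)
      in (l , 1≤l) ,
         record
           { pred                = pred ∘ W.map
           ; isSubuniverse       = preimage-isSubuniverse isSubuniverse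
           ; nonempty            =
               let y , p = nonempty ; c , _ , q = in-range p
               in c , respects (L.sym q) p
           ; isFinitelyGenerated = n , b , (λ i → respects (L.sym (wb≈g i)) (P-g i)) ,
               λ Q Q-sub Q-b {c} p →
                 let c′ , q , r = P-least (image Q) (image-isSubuniverse Q-sub)
                                    (λ i → b i , Q-b i , wb≈g i) p
                 in IsSubuniverse.respects Q-sub (W.injective r) q
           } ,
         Iso.inverse (bijection⇒≅
           (record { map      = λ { (c , p) → W.map c , p }
                   ; cong     = W.cong
                   ; preserve = λ f u → W.preserve f (proj₁ ∘ u) })
           W.injective
           (λ { (y , p) → let c , _ , q = in-range p in (c , respects (L.sym q) p) , q }))
      where
      open FGSubalgebra P
      open IsSubuniverse isSubuniverse using (respects)

    rich-age⊇ : ∀ i (Q : FGSubalgebra (finitePowers 𝐀 i)) → Σ (FGSubalgebra 𝐋) λ P →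
      FGSubalgebra.algebra P ≅ FGSubalgebra.algebra Q
    rich-age⊇ (k , 1≤k) Q =
      record
        { pred                = image pred
        ; isSubuniverse       = image-isSubuniverse isSubuniverse
        ; nonempty            = let c , q = nonempty in W.map c , c , q , L.refl
        ; isFinitelyGenerated =
            let n , g , Q-g , Q-least = isFinitelyGenerated
            in n , W.map ∘ g , (λ i → g i , Q-g i , L.refl) , λ P P-sub P-g → λ { (c , q , p) →
              IsSubuniverse.respects P-sub p
                (Q-least (P ∘ W.map) (preimage-isSubuniverse P-sub) P-g q) }
        } , Iso.inverse (image-≅ isSubuniverse)
      where
      open FGSubalgebra Q
      w = power-embedding rich 1≤k
      module W = Embedding w
      open Image w

    private module E = Surjection (Rich.countable rich)

    stage : ℕ → ∃[ k ] 1 ≤ k × Embedding (𝐀 ↑ k) 𝐋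
    stage zero    = 1 , s≤s z≤n , power-embedding rich (s≤s z≤n)
    stage (suc n) =
      let _ , _ , u = stage n
          l , 1≤l , w , _ = cover-range rich u (E.to n)
      in l , 1≤l , w

    stage-inclusion : ∀ n → Embedding (𝐀 ↑ proj₁ (stage n)) 𝐋
    stage-inclusion n = proj₂ (proj₂ (stage n))

    stage-⊆ : ∀ {n k} → n ≤ k → ∀ a →
      ∃[ b ] Embedding.map (stage-inclusion k) b L.≈ Embedding.map (stage-inclusion n) a
    stage-⊆ {n} n≤k = go (ℕ.≤⇒≤′ n≤k)
      where
      go : ∀ {k} → n ≤′ k → ∀ a →
        ∃[ b ] Embedding.map (stage-inclusion k) b L.≈ Embedding.map (stage-inclusion n) a
      go ≤′-refl a = a , L.refl
      go {suc k} (≤′-step p) a =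
        let b , q = go p a
            _ , _ , _ , contains , _ = cover-range rich (stage-inclusion k) (E.to k)
            c , r = contains b
        in c , L.trans r q

    connecting : ∀ {n k} (n≤k : n ≤ k) →
      Σ (Embedding (𝐀 ↑ proj₁ (stage n)) (𝐀 ↑ proj₁ (stage k))) λ v →
        ∀ a → Embedding.map (stage-inclusion k) (Embedding.map v a) L.≈
              Embedding.map (stage-inclusion n) a
    connecting {n} {k} n≤k = Image.factor (stage-inclusion k) (stage-inclusion n) (stage-⊆ n≤k)

    directSystem : DirectSystem (finitePowers 𝐀)
    directSystem = record
      { poset     = ℕ.≤-poset
      ; inhabited = 0
      ; directed  = λ i j → i ⊔ j , ℕ.m≤m⊔n i j , ℕ.m≤n⊔m i j
      ; obj       = λ n → proj₁ (stage n) , proj₁ (proj₂ (stage n))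
      ; φ         = proj₁ ∘ connecting
      ; φ-id      = λ {i} a →
          Embedding.injective (stage-inclusion i) (proj₂ (connecting {i} {i} ℕ.≤-refl) a)
      ; φ-∘       = λ {_} {_} {k} p q r a → Embedding.injective (stage-inclusion k)
          (L.trans (proj₂ (connecting r) a) (L.sym
            (L.trans (proj₂ (connecting q) _) (proj₂ (connecting p) a))))
      }

    isDirectLimit : IsDirectLimit (finitePowers 𝐀) 𝐋 directSystem
    isDirectLimit = record
      { ι         = Embedding.hom ∘ stage-inclusion
      ; commute   = λ p → proj₂ (connecting p)
      ; covers    = λ y →
          let n , hit = E.surjective y
              _ , _ , _ , _ , b , p = cover-range rich (stage-inclusion n) (E.to n)
          in suc n , b , L.trans p (hit ≡.refl)
      ; separates = λ i j a b e →
          let i≤ = ℕ.m≤m⊔n i j ; j≤ = ℕ.m≤n⊔m i j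
          in i ⊔ j , i≤ , j≤ , Embedding.injective (stage-inclusion (i ⊔ j))
            (L.trans (proj₂ (connecting i≤) a) (L.trans e (L.sym (proj₂ (connecting j≤) b))))
      }

    rich⇒limit : IsGeneralizedFraisseLimit (finitePowers 𝐀) 𝐋
    rich⇒limit = record
      { countable   = Rich.countable rich
      ; age⊆        = rich-age⊆
      ; age⊇        = rich-age⊇
      ; directLimit = directSystem , isDirectLimit
      ; homogeneous = λ P-sub Q-sub α _ σ → rich-homogeneous P-sub Q-sub α σ
      }

  module _ {𝐋 : Algebra 𝑆} (limit : IsGeneralizedFraisseLimit (finitePowers 𝐀) 𝐋) where
    private module L = Algebra 𝐋
    open IsGeneralizedFraisseLimit limit

    private
      𝒟 = proj₁ directLimit
      module 𝒟 = DirectSystem 𝒟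
      open IsDirectLimit (proj₂ directLimit)

    -- `separates` compares `a` and `b` through two possibly different proofs of the same
    -- inequality; composing with `≼-refl` identifies the two connecting maps.
    ι-embedding : ∀ j → Embedding (finitePowers 𝐀 (𝒟.obj j)) 𝐋
    ι-embedding j = record
      { hom       = ι j
      ; injective = λ {a} {b} e →
          let k , p , q , r = separates j j a b e
              module K = Algebra (finitePowers 𝐀 (𝒟.obj k))
          in Embedding.injective (𝒟.φ p) (K.trans r (K.trans (𝒟.φ-∘ 𝒟.≼-refl p q b)
               (Embedding.cong (𝒟.φ p) (𝒟.φ-id b))))
      }

    limit-cover : ∀ {N} (d : Fin N → L.Carrier) →
      ∃[ j ] ∀ i → ∃[ b ] Hom.map (ι j) b L.≈ d i
    limit-cover {zero}  d = 𝒟.inhabited , λ ()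
    limit-cover {suc N} d =
      let j , p         = limit-cover (d ∘ suc)
          j′ , a , q    = covers (d zero)
          k , j≼k , j′≼k = 𝒟.directed j j′
      in k , λ { zero    → _ , L.trans (commute j′≼k a) q
               ; (suc i) → let b , r = p i in _ , L.trans (commute j≼k b) r }

    limit⇒rich : Rich 𝐋
    limit⇒rich = record
      { countable = countable
      ; cover     = λ d →
          let j , p   = limit-cover d
          in proj₁ (𝒟.obj j) , proj₂ (𝒟.obj j) , ι-embedding j , p
      ; adjoin    = adjoin
      }
      where
      -- The age contains some copy of `𝐀 ↑ suc k`, but in it the graph of `h` is a copy of `𝐀 ↑ k`
      -- unrelated to `u`. Homogeneity provides an automorphism that moves this graph onto the range
      -- of `u` compatibly with both parametrisations.
      adjoin : ∀ {k} → 1 ≤ k → (u : Embedding (𝐀 ↑ k) 𝐋) (h : Hom (𝐀 ↑ k) 𝐀) →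
        Σ (Embedding (𝐀 ↑ suc k) 𝐋) λ w →
          ∀ a → Embedding.map w (Hom.map h a ∷ a) L.≈ Embedding.map u a
      adjoin {k} 1≤k u h = Iso.embedding (proj₁ α) ∘ₑ w ,
        λ a → L.trans (Iso.cong (proj₁ α) (Embedding.cong w λ { zero → refl ; (suc i) → refl }))
          (proj₂ α (_ , a , tt , L.refl))
        where
        v : Embedding (𝐀 ↑ k) (𝐀 ↑ suc k)
        v = record
          { hom = tuple (λ { zero → h ; (suc i) → projection 𝐀 i })
          ; injective = λ p → p ∘ suc
          }

        all : FGSubalgebra (𝐀 ↑ suc k)
        all = record
          { pred                = λ _ → ⊤
          ; isSubuniverse       = everything (𝐀 ↑ suc k)
          ; nonempty            = (λ _ → x₀) , tt
          ; isFinitelyGenerated = M ^ suc k , decode , (λ _ → tt) , λ Q Q-sub Q-g {a} _ →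
              IsSubuniverse.respects Q-sub (decode∘encode a) (Q-g (encode a))
          }

        copy = age⊇ (suc k , s≤s z≤n) all

        w : Embedding (𝐀 ↑ suc k) 𝐋
        w = subalgebra-inclusion 𝐋 (FGSubalgebra.isSubuniverse (proj₁ copy)) ∘ₑ
          Iso.embedding (Iso.inverse (proj₂ copy)) ∘ₑ record
            { hom = record { map = _, tt ; cong = id ; preserve = λ _ _ _ → refl }
            ; injective = id }

        module V = Image (w ∘ₑ v)
        module U = Image u

        σ : subalgebra 𝐋 V.range-isSubuniverse ≅ subalgebra 𝐋 U.range-isSubuniverse
        σ = ≅-trans (Iso.inverse V.range-≅) U.range-≅

        α : Σ (𝐋 ≅ 𝐋) λ α → ∀ a → _≅_.map α (proj₁ a) L.≈ proj₁ (_≅_.map σ a)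
        α = homogeneous V.range-isSubuniverse U.range-isSubuniverse
          ((k , 1≤k) , Iso.inverse V.range-≅) ((k , 1≤k) , Iso.inverse U.range-≅) σ

does⇒ : {P : Set} (d : Dec P) → does d ≡ true → P
does⇒ (yes p) _ = p

⇒does : {P : Set} (d : Dec P) → P → does d ≡ true
⇒does (yes _) _ = ≡.refl
⇒does (no ¬p) p = contradiction p ¬p

-- The Stone space of a countable Boolean algebra.

module StoneSpace (em : ExcludedMiddle 0ℓ) (𝐁 : BooleanAlgebra 0ℓ 0ℓ)
                  (countable : Countable (BooleanAlgebra.setoid 𝐁)) where
  open Classical em
  open BooleanAlgebra 𝐁 renaming (¬_ to ∁_; ⊤ to 1ᴮ; ⊥ to 0ᴮ)
  open BAProps 𝐁 using (∧-idem; ∧-identityʳ; ∧-identityˡ; ∧-zeroʳ; ∨-identityˡ)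
  open Ultrafilter using (χ)

  private
    infix 4 _≼_
    _≼_ : Rel Carrier 0ℓ
    _≼_ = _⊑_ 𝐁

  Point : Set
  Point = Ultrafilter 𝐁

  ≈⇒≼ : ∀ {a b} → a ≈ b → a ≼ b
  ≈⇒≼ p = trans (∧-congˡ (sym p)) (∧-idem _)

  ≼-trans : ∀ {a b c} → a ≼ b → b ≼ c → a ≼ c
  ≼-trans p q = trans (∧-congʳ (sym p)) (trans (∧-assoc _ _ _) (trans (∧-congˡ q) p))

  ∧-≼ʳ : ∀ a b → a ∧ b ≼ b
  ∧-≼ʳ a b = trans (∧-assoc a b b) (∧-congˡ (∧-idem b))

  ∧-≼ˡ : ∀ a b → a ∧ b ≼ a
  ∧-≼ˡ a b = ≼-trans (≈⇒≼ (∧-comm a b)) (∧-≼ʳ b a)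

  ∧-greatest : ∀ {a b c} → a ≼ b → a ≼ c → a ≼ b ∧ c
  ∧-greatest p q = trans (sym (∧-assoc _ _ _)) (trans (∧-congʳ p) q)

  ∧-mono : ∀ {a b c} → a ≼ b → a ∧ c ≼ b ∧ c
  ∧-mono {a} {b} {c} p = ∧-greatest (≼-trans (∧-≼ˡ a c) p) (∧-≼ʳ a c)

  ≼0 : ∀ {a} → a ≼ 0ᴮ → a ≈ 0ᴮ
  ≼0 p = trans (sym p) (∧-zeroʳ _)

  ∧∁-split : ∀ a b → a ≈ (a ∧ b) ∨ (a ∧ ∁ b)
  ∧∁-split a b = trans (sym (∧-identityʳ a))
    (trans (∧-congˡ (sym (∨-complementʳ b))) (∧-distribˡ-∨ a b (∁ b)))

  ∨∧∁ : ∀ a b → (a ∨ b) ∧ ∁ a ≼ b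
  ∨∧∁ a b = ≼-trans (≈⇒≼ (trans (∧-distribʳ-∨ (∁ a) a b)
    (trans (∨-congʳ (∧-complementʳ a)) (∨-identityˡ _)))) (∧-≼ˡ b (∁ a))

  module _ (x : Point) where
    open Ultrafilter x

    ∁-excludes : ∀ {b} → b ∈ᵤ x → ¬ (∁ b) ∈ᵤ x
    ∁-excludes p q = proper (upward (≈⇒≼ (∧-complementʳ _)) (∧-closed p q))

    ∉⇒∁∈ : ∀ {b} → ¬ b ∈ᵤ x → (∁ b) ∈ᵤ x
    ∉⇒∁∈ {b} b∉x with ultra b
    ... | inj₁ p = contradiction p b∉x
    ... | inj₂ q = q

    ∨-prime : ∀ {a b} → (a ∨ b) ∈ᵤ x → a ∈ᵤ x ⊎ b ∈ᵤ x
    ∨-prime {a} {b} p with ultra a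
    ... | inj₁ q = inj₁ q
    ... | inj₂ q = inj₂ (upward (∨∧∁ a b) (∧-closed p q))

    member-nonzero : ∀ {b} → b ∈ᵤ x → ¬ b ≈ 0ᴮ
    member-nonzero p b≈0 = proper (upward (≈⇒≼ b≈0) p)

  private module E = Surjection countable

  module PrimeIdeal (I : Pred Carrier 0ℓ)
                    (I-down : ∀ {a b} → a ≼ b → I b → I a)
                    (I-∨ : ∀ {a b} → I a → I b → I (a ∨ b))
                    (I-0 : I 0ᴮ) (I-proper : ¬ I 1ᴮ) where

    -- The prime ideal theorem along the enumeration: `b` is met into the current element unless
    -- this falls into `I`. The descending sequence `s` stays outside `I`, and the filter that it
    -- generates is the point sought.
    step : Carrier → Carrier → Carrier
    step a b = if does (decide (I (a ∧ b))) then a else a ∧ b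

    step-≼ : ∀ a b → step a b ≼ a
    step-≼ a b with decide (I (a ∧ b))
    ... | yes _ = ∧-idem a
    ... | no  _ = ∧-≼ˡ a b

    step-∉ : ∀ a b → ¬ I a → ¬ I (step a b)
    step-∉ a b a∉I with decide (I (a ∧ b))
    ... | yes _ = a∉I
    ... | no  p = p

    step-decides : ∀ a b → I (a ∧ b) ⊎ step a b ≼ b
    step-decides a b with decide (I (a ∧ b))
    ... | yes p = inj₁ p
    ... | no  _ = inj₂ (∧-≼ʳ a b)

    s : ℕ → Carrier
    s zero    = 1ᴮ
    s (suc n) = step (s n) (E.to n)

    s-∉ : ∀ n → ¬ I (s n)
    s-∉ zero    = I-proper
    s-∉ (suc n) = step-∉ (s n) (E.to n) (s-∉ n)

    s-antitone : ∀ {n k} → n ≤ k → s k ≼ s n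
    s-antitone n≤k = go (ℕ.≤⇒≤′ n≤k)
      where
      go : ∀ {n k} → n ≤′ k → s k ≼ s n
      go ≤′-refl     = ∧-idem _
      go (≤′-step p) = ≼-trans (step-≼ _ _) (go p)

    Generated : Carrier → Set
    Generated b = ∃[ n ] s n ≼ b

    s-decides : ∀ b → (∃[ n ] I (s n ∧ b)) ⊎ Generated b
    s-decides b with E.surjective b
    ... | n , hit with step-decides (s n) (E.to n)
    ...   | inj₁ p = inj₁ (n , I-down (≈⇒≼ (∧-congˡ (sym (hit ≡.refl)))) p)
    ...   | inj₂ q = inj₂ (suc n , ≼-trans q (≈⇒≼ (hit ≡.refl)))

    generated-ultra : ∀ b → Generated b ⊎ Generated (∁ b)
    generated-ultra b with s-decides b | s-decides (∁ b)
    ... | inj₂ p       | _            = inj₁ p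
    ... | inj₁ _       | inj₂ q       = inj₂ q
    ... | inj₁ (n , p) | inj₁ (k , q) = contradiction
      (I-down (≈⇒≼ (∧∁-split (s (n ⊔ k)) b))
        (I-∨ (I-down (∧-mono (s-antitone (ℕ.m≤m⊔n n k))) p)
             (I-down (∧-mono (s-antitone (ℕ.m≤n⊔m n k))) q)))
      (s-∉ (n ⊔ k))

    generated : ∀ b → Dec (Generated b)
    generated b = decide (Generated b)

    point : Point
    point = record
      { χ        = does ∘ generated
      ; upward   = λ p q → let n , r = does⇒ (generated _) q
                           in ⇒does (generated _) (n , ≼-trans r p)
      ; ∧-closed = λ p q →
          let n , r = does⇒ (generated _) p ; k , t = does⇒ (generated _) q
          in ⇒does (generated _) (n ⊔ k , ∧-greatest
               (≼-trans (s-antitone (ℕ.m≤m⊔n n k)) r) (≼-trans (s-antitone (ℕ.m≤n⊔m n k)) t))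
      ; has-⊤    = ⇒does (generated _) (0 , ∧-idem _)
      ; proper   = λ p → let n , r = does⇒ (generated _) p in s-∉ n (I-down r I-0)
      ; ultra    = λ b → ultra′ b (generated-ultra b)
      }
      where
      ultra′ : ∀ b → Generated b ⊎ Generated (∁ b) →
        (does (generated b) ≡ true) ⊎ (does (generated (∁ b)) ≡ true)
      ultra′ b (inj₁ p) = inj₁ (⇒does (generated b) p)
      ultra′ b (inj₂ p) = inj₂ (⇒does (generated (∁ b)) p)

    abstract
      avoiding-point : Σ Point λ x → ∀ b → b ∈ᵤ x → ¬ I b
      avoiding-point = point , λ b p q →
        let n , r = does⇒ (generated b) p in s-∉ n (I-down r q)

  abstract
    -- The elements disjoint from `b` form an ideal, proper because `b` is nonzero; a point that
    -- avoids it cannot contain `∁ b`.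
    point-in : ∀ b → ¬ b ≈ 0ᴮ → Σ Point λ x → b ∈ᵤ x
    point-in b b≉0 =
      let x , disjoint = PrimeIdeal.avoiding-point (λ c → c ∧ b ≈ 0ᴮ)
            (λ p q → ≼0 (≼-trans (∧-mono p) (≈⇒≼ q)))
            (λ {a} {c} p q → trans (∧-distribʳ-∨ b a c) (trans (∨-cong p q) (∨-identityˡ 0ᴮ)))
            (trans (∧-comm 0ᴮ b) (∧-zeroʳ b))
            (λ p → b≉0 (trans (sym (∧-identityˡ b)) p))
      in x , by-contradiction (λ b∉x →
           disjoint (∁ b) (∉⇒∁∈ x b∉x) (trans (∧-comm _ _) (∧-complementʳ b)))

  Near : Point → Pred Point 0ℓ → Set
  Near x Q = ∃[ b ] b ∈ᵤ x × (∀ y → b ∈ᵤ y → Q y)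

  near-∩ : ∀ x {P Q : Pred Point 0ℓ} → Near x P → Near x Q → Near x (λ y → P y × Q y)
  near-∩ x (b , b∈x , p) (c , c∈x , q) = b ∧ c , Ultrafilter.∧-closed x b∈x c∈x , λ y r →
    p y (Ultrafilter.upward y (∧-≼ˡ b c) r) , q y (Ultrafilter.upward y (∧-≼ʳ b c) r)

  near-map : ∀ x {P Q : Pred Point 0ℓ} → (∀ y → P y → Q y) → Near x P → Near x Q
  near-map x f (b , b∈x , p) = b , b∈x , λ y r → f y (p y r)

  near-χ : ∀ b x → Near x (λ y → χ y b ≡ χ x b)
  near-χ b x with χ x b in eq
  ... | true  = b , eq , λ y p → p
  ... | false = ∁ b , ∉⇒∁∈ x (λ p → contradiction (≡.trans (≡.sym eq) p) λ ()) , χ-false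
    where
    χ-false : ∀ y → (∁ b) ∈ᵤ y → χ y b ≡ false
    χ-false y p with χ y b in eq′
    ... | true  = contradiction p (∁-excludes y eq′)
    ... | false = ≡.refl

  -- Compactness of the Stone space, in the form that glues local answers into one element.
  locallyDecided⇒clopen : (Q : Pred Point 0ℓ) → (∀ x → Near x Q ⊎ Near x (λ y → ¬ Q y)) →
    ∃[ b ] ∀ x → (b ∈ᵤ x → Q x) × (Q x → b ∈ᵤ x)
  locallyDecided⇒clopen Q local = by-contradiction impossible
    where
    Represents : Carrier → Carrier → Set
    Represents b c = ∀ x → b ∈ᵤ x → (c ∈ᵤ x → Q x) × (Q x → c ∈ᵤ x)

    -- If this ideal is proper, some point avoids it; but Q is constant near that point.
    I : Pred Carrier 0ℓ
    I b = ∃[ c ] Represents b c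

    I-∨ : ∀ {a b} → I a → I b → I (a ∨ b)
    I-∨ {a} {b} (c , p) (d , q) = (a ∧ c) ∨ (b ∧ d) , λ x r → sound x , complete x (∨-prime x r)
      where
      module _ (x : Point) where
        open Ultrafilter x
        sound : ((a ∧ c) ∨ (b ∧ d)) ∈ᵤ x → Q x
        sound r with ∨-prime x r
        ... | inj₁ t = proj₁ (p x (upward (∧-≼ˡ a c) t)) (upward (∧-≼ʳ a c) t)
        ... | inj₂ t = proj₁ (q x (upward (∧-≼ˡ b d) t)) (upward (∧-≼ʳ b d) t)
        complete : a ∈ᵤ x ⊎ b ∈ᵤ x → Q x → ((a ∧ c) ∨ (b ∧ d)) ∈ᵤ x
        complete (inj₁ a∈x) Qx = upward (∧-absorbs-∨ _ _) (∧-closed a∈x (proj₂ (p x a∈x) Qx))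
        complete (inj₂ b∈x) Qx = upward
          (≼-trans (∧-absorbs-∨ _ _) (≈⇒≼ (∨-comm _ _))) (∧-closed b∈x (proj₂ (q x b∈x) Qx))

    impossible : ¬ ¬ (∃[ b ] ∀ x → (b ∈ᵤ x → Q x) × (Q x → b ∈ᵤ x))
    impossible none = good (local x)
      where
      avoiding = PrimeIdeal.avoiding-point I
        (λ { a≼b (c , p) → c , λ x a∈x → p x (Ultrafilter.upward x a≼b a∈x) })
        I-∨
        (0ᴮ , λ x 0∈x → contradiction 0∈x (Ultrafilter.proper x))
        (λ { (c , p) → none (c , λ x → p x (Ultrafilter.has-⊤ x)) })
      x = proj₁ avoiding
      good : ¬ (Near x Q ⊎ Near x (λ y → ¬ Q y))
      good (inj₁ (b , b∈x , p)) = proj₂ avoiding b b∈x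
        (1ᴮ , λ x b∈x → (λ _ → p x b∈x) , λ _ → Ultrafilter.has-⊤ x)
      good (inj₂ (b , b∈x , p)) = proj₂ avoiding b b∈x
        (0ᴮ , λ x b∈x → (λ 0∈x → contradiction 0∈x (Ultrafilter.proper x)) ,
                         λ Qx → contradiction Qx (p x b∈x))

  Distinct : ∀ {N} → (Fin N → Point) → Set
  Distinct z = ∀ i j → z i ≈ᵤ z j → i ≡ j

  abstract
    separate : ∀ {N} (z : Fin N → Point) → Distinct z →
      Σ (Fin N → Carrier) λ b → (∀ i → b i ∈ᵤ z i) × (∀ i j → b i ∈ᵤ z j → i ≡ j)
    separate z distinct = proj₁ ∘ isolated , proj₁ ∘ proj₂ ∘ isolated ,
      λ i j p → by-contradiction (λ i≢j → proj₂ (proj₂ (isolated i)) (z j) p j i≢j (λ _ → ≡.refl))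
      where
      isolated : ∀ i → Near (z i) (λ y → ∀ j → ¬ i ≡ j → ¬ y ≈ᵤ z j)
      isolated i = common (z i) (λ j y → ¬ i ≡ j → ¬ y ≈ᵤ z j) away
        where
        away : ∀ j → Near (z i) (λ y → ¬ i ≡ j → ¬ y ≈ᵤ z j)
        away j with decide (i ≡ j)
        ... | yes i≡j = 1ᴮ , Ultrafilter.has-⊤ (z i) , λ y _ i≢j → contradiction i≡j i≢j
        ... | no  i≢j =
          let b , χ≢ = find-failure (λ same → i≢j (distinct i j same))
          in near-map (z i) (λ y p _ same → χ≢ (≡.trans (≡.sym p) (same b))) (near-χ b (z i))

  module _ {Y : Set} where

    -- The first `b i` in the point decides. The `b i` may overlap, but those from `separate` have
    -- each prescribed point in exactly one of them.
    piecewise : ∀ {N} → (Fin N → Carrier) → (Fin N → Y) → Y → Point → Y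
    piecewise {zero}  b v y₀ x = y₀
    piecewise {suc N} b v y₀ x =
      if χ x (b zero) then v zero else piecewise (b ∘ suc) (v ∘ suc) y₀ x

    piecewise-local : ∀ {N} (b : Fin N → Carrier) v y₀ x →
      Near x (λ y → piecewise b v y₀ y ≡ piecewise b v y₀ x)
    piecewise-local {zero}  b v y₀ x = 1ᴮ , Ultrafilter.has-⊤ x , λ _ _ → ≡.refl
    piecewise-local {suc N} b v y₀ x = near-map x
      (λ { y (p , q) → ≡.cong₂ (if_then v zero else_) p q })
      (near-∩ x (near-χ (b zero) x) (piecewise-local (b ∘ suc) (v ∘ suc) y₀ x))

    piecewise-value : ∀ {N} (b : Fin N → Carrier) v y₀ x i → b i ∈ᵤ x →
      (∀ j → b j ∈ᵤ x → j ≡ i) → piecewise b v y₀ x ≡ v i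
    piecewise-value {suc N} b v y₀ x i b∈x only with χ x (b zero) in eq
    piecewise-value {suc N} b v y₀ x i       b∈x only | true = ≡.cong v (only zero eq)
    piecewise-value {suc N} b v y₀ x zero    b∈x only | false =
      contradiction (≡.trans (≡.sym eq) b∈x) λ ()
    piecewise-value {suc N} b v y₀ x (suc i) b∈x only | false =
      piecewise-value (b ∘ suc) (v ∘ suc) y₀ x i b∈x (λ j p → Fin.suc-injective (only (suc j) p))

    abstract
      interpolate : ∀ {N} (z : Fin N → Point) → Distinct z → (Fin N → Y) → Y →
        Σ (Point → Y) λ g → (∀ x → Near x (λ y → g y ≡ g x))
      interpolate z distinct v y₀ =
        let b , _ = separate z distinct
        in piecewise b v y₀ , piecewise-local b v y₀

      interpolate-value : ∀ {N} (z : Fin N → Point) (distinct : Distinct z) (v : Fin N → Y) y₀ →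
        ∀ i → proj₁ (interpolate z distinct v y₀) (z i) ≡ v i
      interpolate-value z distinct v y₀ i =
        let b , b∈ , only = separate z distinct
        in piecewise-value b v y₀ (z i) i (b∈ i) (λ j → only j i)

  module Atomless (atomless : IsAtomless 𝐁) where

    abstract
      split : ∀ b → ¬ b ≈ 0ᴮ → ∃[ c ] c ≼ b × ¬ c ≈ 0ᴮ × ¬ b ∧ ∁ c ≈ 0ᴮ
      split b b≉0 = find λ none → proj₂ atomless b (b≉0 , λ c c≼b → atom c c≼b (none c))
        where
        atom : ∀ c → c ≼ b → ¬ (c ≼ b × ¬ c ≈ 0ᴮ × ¬ b ∧ ∁ c ≈ 0ᴮ) → c ≈ 0ᴮ ⊎ c ≈ b
        atom c c≼b p with decide (c ≈ 0ᴮ)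
        ... | yes c≈0 = inj₁ c≈0
        ... | no  c≉0 = inj₂ (trans (sym c≼b) (trans (∧-comm c b) (sym b≈b∧c)))
          where
          b∧∁c≈0 : b ∧ ∁ c ≈ 0ᴮ
          b∧∁c≈0 = by-contradiction (λ q → p (c≼b , c≉0 , q))
          b≈b∧c : b ≈ b ∧ c
          b≈b∧c = trans (∧∁-split b c) (trans (∨-congˡ b∧∁c≈0)
            (trans (∨-comm _ _) (∨-identityˡ _)))

      -- Points are dodged one at a time: `d` and its complement in `c` are disjoint and nonzero, so
      -- one of them misses the next point.
      avoid : ∀ {N} (z : Fin N → Point) b → ¬ b ≈ 0ᴮ →
        ∃[ c ] c ≼ b × ¬ c ≈ 0ᴮ × (∀ i → ¬ c ∈ᵤ z i)
      avoid {zero}  z b b≉0 = b , ∧-idem b , b≉0 , λ ()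
      avoid {suc N} z b b≉0 with avoid (z ∘ suc) b b≉0
      ... | c , c≼b , c≉0 , c∉z with split c c≉0
      ...   | d , d≼c , d≉0 , c∧∁d≉0 with decide (d ∈ᵤ z zero)
      ...     | no d∉z = d , ≼-trans d≼c c≼b , d≉0 ,
        λ { zero → d∉z ; (suc i) p → c∉z i (Ultrafilter.upward (z (suc i)) d≼c p) }
      ...     | yes d∈z = c ∧ ∁ d , ≼-trans (∧-≼ˡ c (∁ d)) c≼b , c∧∁d≉0 ,
        λ { zero p    → ∁-excludes (z zero) d∈z (Ultrafilter.upward (z zero) (∧-≼ʳ c (∁ d)) p)
          ; (suc i) p → c∉z i (Ultrafilter.upward (z (suc i)) (∧-≼ˡ c (∁ d)) p) }

    distinct-points : ∀ {N} (b : Fin N → Carrier) → (∀ i → ¬ b i ≈ 0ᴮ) →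
      Σ (Fin N → Point) λ y → Distinct y × (∀ i → b i ∈ᵤ y i)
    distinct-points {zero}  b b≉0 = (λ ()) , (λ ()) , λ ()
    distinct-points {suc N} b b≉0 = x ∷ y , distinct , member
      where
      rest = distinct-points (b ∘ suc) (b≉0 ∘ suc)
      y    = proj₁ rest
      away = avoid y (b zero) (b≉0 zero)
      c    = proj₁ away
      c∉y  = proj₂ (proj₂ (proj₂ away))
      new  = point-in c (proj₁ (proj₂ (proj₂ away)))
      x    = proj₁ new
      c∈x  = proj₂ new

      distinct : Distinct (x ∷ y)
      distinct zero    zero    _ = ≡.refl
      distinct zero    (suc j) p = contradiction (≡.trans (≡.sym (p c)) c∈x) (c∉y j)
      distinct (suc i) zero    p = contradiction (≡.trans (p c) c∈x) (c∉y i)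
      distinct (suc i) (suc j) p = ≡.cong suc (proj₁ (proj₂ rest) i j p)

      member : ∀ i → b i ∈ᵤ (x ∷ y) i
      member zero    = Ultrafilter.upward x (proj₁ (proj₂ away)) c∈x
      member (suc i) = proj₂ (proj₂ rest) i

-- Countability and finite systems of representatives.

next-pair : ℕ × ℕ → ℕ × ℕ
-- The walk follows the antidiagonals; here one ends and the next begins.
next-pair (zero  , b) = suc b , 0
next-pair (suc a , b) = a , suc b

unpair : ℕ → ℕ × ℕ
unpair zero    = 0 , 0
unpair (suc n) = next-pair (unpair n)

unpair-surjective : ∀ a b → ∃[ n ] unpair n ≡ (a , b)
unpair-surjective a b = go (a + b) b a ≡.refl
  where
  go : ∀ s b a → a + b ≡ s → ∃[ n ] unpair n ≡ (a , b)
  go s       (suc b) a       p with go s b (suc a) (≡.trans (≡.sym (ℕ.+-suc a b)) p)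
  ... | n , q = suc n , ≡.cong next-pair q
  go s       zero    zero    p = 0 , ≡.refl
  go zero    zero    (suc a) ()
  go (suc s) zero    (suc a) p
    with go s a zero (ℕ.suc-injective (≡.trans (≡.cong suc (≡.sym (ℕ.+-identityʳ a))) p))
  ... | n , q = suc n , ≡.cong next-pair q

unpack : ∀ k → ℕ → Vector ℕ k
unpack zero    n = []
unpack (suc k) n = proj₁ (unpair n) ∷ unpack k (proj₂ (unpair n))

unpack-surjective : ∀ {k} (v : Vector ℕ k) → ∃[ n ] ∀ i → unpack k n i ≡ v i
unpack-surjective {zero}  v = 0 , λ ()
unpack-surjective {suc k} v =
  let l , p = unpack-surjective (v ∘ suc)
      n , q = unpair-surjective (v zero) l
  in n , λ { zero    → ≡.cong proj₁ q
           ; (suc i) → ≡.trans (≡.cong (λ z → unpack k (proj₂ z) i) q) (p i) }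

Fin⇒1≤ : ∀ {k} → Fin k → 1 ≤ k
Fin⇒1≤ zero    = s≤s z≤n
Fin⇒1≤ (suc _) = s≤s z≤n

module ClassicalCounting (em : ExcludedMiddle 0ℓ) where
  open Classical em

  module _ (S : Setoid 0ℓ 0ℓ) where
    open Setoid S

    -- Excluded middle decides whether a number is a code at all; the other numbers are sent to the
    -- default `y₀`.
    coded⇒countable : Carrier → (_codes_ : ℕ → Carrier → Set) → (∀ y → ∃[ n ] n codes y) →
      (∀ {n y z} → n codes y → n codes z → y ≈ z) → Countable S
    coded⇒countable y₀ _codes_ has-code unique = record
      { to         = λ n → decoded n (decide (∃[ y ] n codes y))
      ; cong       = λ { ≡.refl → refl }
      ; surjective = λ y →
          let n , p = has-code y
          in n , λ { ≡.refl → correct n p (decide (∃[ y ] n codes y)) }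
      }
      where
      decoded : ∀ n → Dec (∃[ y ] n codes y) → Carrier
      decoded n (yes (y , _)) = y
      decoded n (no _)        = y₀

      correct : ∀ n {y} → n codes y → (d : Dec (∃[ y ] n codes y)) → decoded n d ≈ y
      correct n p (yes (_ , q)) = unique q p
      correct n p (no none)     = contradiction (_ , p) none

  module _ {X : Set} {N : ℕ} (code : X → Fin N) (P : Pred X 0ℓ) (_~_ : Rel X 0ℓ)
           (~-sym : ∀ {y z} → y ~ z → z ~ y) (same-code : ∀ {y z} → code y ≡ code z → y ~ z) where

    -- The system is built by running through the codes, and `Q` restricts the covering clause to
    -- those already treated. A code contributes a representative only if some `P`-element with it
    -- is unrelated to all earlier ones.
    Representatives : Pred X 0ℓ → Set
    Representatives Q = ∃[ r ] Σ (Fin r → X) λ rep → (∀ i → P (rep i)) ×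
      (∀ i j → rep i ~ rep j → i ≡ j) × (∀ y → P y → Q y → ∃[ i ] y ~ rep i)

    abstract
      representatives : Representatives (λ _ → ⊤)
      representatives =
        let r , rep , P-rep , distinct , covers = below N
        in r , rep , P-rep , distinct , λ y Py _ → covers y Py (Fin.toℕ<n (code y))
        where
        below : ∀ n → Representatives (λ y → toℕ (code y) < n)
        below zero    = 0 , (λ ()) , (λ ()) , (λ ()) , λ _ _ ()
        below (suc n) with below n
        ... | r , rep , P-rep , distinct , covers
          with decide (∃[ z ] P z × toℕ (code z) ≡ n × (∀ i → ¬ z ~ rep i))
        ... | yes (z , Pz , cz , new) = suc r , (z ∷ rep) ,
          (λ { zero → Pz ; (suc i) → P-rep i }) ,
          (λ { zero    zero    _ → ≡.refl
             ; zero    (suc j) p → contradiction p (new j)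
             ; (suc i) zero    p → contradiction (~-sym p) (new i)
             ; (suc i) (suc j) p → ≡.cong suc (distinct i j p) }) ,
          covers′
          where
          covers′ : ∀ y → P y → toℕ (code y) < suc n → ∃[ i ] y ~ (z ∷ rep) i
          covers′ y Py (s≤s cy≤n) with ℕ.m≤n⇒m<n∨m≡n cy≤n
          ... | inj₁ cy<n = let i , p = covers y Py cy<n in suc i , p
          ... | inj₂ cy≡n = zero , same-code (Fin.toℕ-injective (≡.trans cy≡n (≡.sym cz)))
        ... | no none = r , rep , P-rep , distinct , covers′
          where
          covers′ : ∀ y → P y → toℕ (code y) < suc n → ∃[ i ] y ~ rep i
          covers′ y Py (s≤s cy≤n) with ℕ.m≤n⇒m<n∨m≡n cy≤n
          ... | inj₁ cy<n = covers y Py cy<n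
          ... | inj₂ cy≡n = find (λ new → none (y , Py , cy≡n , new))

-- The filtered Boolean power is rich.

module LocalConstancy {𝑆 : Signature} (𝒮 : SimpleMalcevAlgebra 𝑆)
    (𝐁 : BooleanAlgebra 0ℓ 0ℓ) (𝐁-countable : Countable (BooleanAlgebra.setoid 𝐁)) where

  open Tuples 𝒮
  open StoneSpace excludedMiddle 𝐁 𝐁-countable

  LocallyConstant : (Point → Carrier) → Set
  LocallyConstant g = ∀ y → Near y (λ z → g z ≈ g y)

  locallyConstant⇒continuous : ∀ {g} → LocallyConstant g → Continuous 𝐀 𝐁 g
  locallyConstant⇒continuous local a y p = near-map y (λ z q → trans q p) (local y)

module FilteredPower {𝑆 : Signature} (𝒮 : SimpleMalcevAlgebra 𝑆)
    (n : ℕ) (e : Fin n → Algebra.Carrier (SimpleMalcevAlgebra.𝐀 𝒮))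
    (e-idem : ∀ i → IsIdempotent (SimpleMalcevAlgebra.𝐀 𝒮) (e i))
    (e-all : ∀ a → IsIdempotent (SimpleMalcevAlgebra.𝐀 𝒮) a →
      ∃[ i ] SimpleMalcevAlgebra.𝐀 𝒮 ∋ a ≈ e i)
    (𝐁 : BooleanAlgebra 0ℓ 0ℓ) (𝐁-countable : Countable (BooleanAlgebra.setoid 𝐁))
    (atomless : IsAtomless 𝐁)
    (x : Fin n → Ultrafilter 𝐁) (x-distinct : Injective _≡_ _≈ᵤ_ x) where

  open Tuples 𝒮
  open Homs 𝒮
  open RichAlgebras 𝒮
  open ClassicalCounting excludedMiddle
  open StoneSpace excludedMiddle 𝐁 𝐁-countable
  open LocalConstancy 𝒮 𝐁 𝐁-countable
  open Atomless atomless
  open BooleanAlgebra 𝐁 using () renaming (¬_ to ∁_; ⊤ to 1ᴮ; ⊥ to 0ᴮ; _∧_ to _∧ᴮ_)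
  open Ultrafilter using (χ; upward)

  𝐃 : Algebra 𝑆
  𝐃 = filteredBooleanPower 𝐀 𝐁 x e e-idem

  private module D = Algebra 𝐃

  evaluate : Point → Hom 𝐃 𝐀
  evaluate y = record
    { map = λ d → proj₁ (proj₁ d) y ; cong = λ p → p y ; preserve = λ _ _ → refl }

  _at_ : D.Carrier → Point → Carrier
  d at y = proj₁ (proj₁ d) y

  at-local : ∀ d → LocallyConstant (d at_)
  at-local d y = proj₂ (proj₁ d) (d at y) y refl

  into-𝐃 : {𝐂 : Algebra 𝑆} (w : Point → Hom 𝐂 𝐀) →
    (∀ c → LocallyConstant (λ y → Hom.map (w y) c)) →
    (∀ c i → Hom.map (w (x i)) c ≈ e i) → Hom 𝐂 𝐃
  into-𝐃 w local filter = record
    { map      = λ c → ((λ y → Hom.map (w y) c) , locallyConstant⇒continuous (local c)) , filter c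
    ; cong     = λ p y → Hom.cong (w y) p
    ; preserve = λ f u y → Hom.preserve (w y) f u
    }

  χ-false : ∀ {b} (y : Point) → ¬ b ∈ᵤ y → χ y b ≡ false
  χ-false {b} y b∉y with χ y b
  ... | true  = contradiction ≡.refl b∉y
  ... | false = ≡.refl

  true≢false : ∀ {b} (y : Point) → b ∈ᵤ y → ¬ χ y b ≡ false
  true≢false y p q = contradiction (≡.trans (≡.sym p) q) λ ()

  abstract
    base : Σ (Point → Carrier) λ g → (∀ y → Near y (λ z → g z ≡ g y)) × (∀ i → g (x i) ≡ e i)
    base = let distinct : Distinct x ; distinct = λ i j → x-distinct
               g , local = interpolate x distinct e x₀
           in g , local , interpolate-value x distinct e x₀

  d⋆ : Point → Carrier
  d⋆ = proj₁ base

  d⋆-local : ∀ y → Near y (λ z → d⋆ z ≡ d⋆ y)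
  d⋆-local = proj₁ (proj₂ base)

  d⋆-value : ∀ i → d⋆ (x i) ≡ e i
  d⋆-value = proj₂ (proj₂ base)

  𝐃-inhabited : D.Carrier
  𝐃-inhabited =
    (d⋆ , locallyConstant⇒continuous (λ y → near-map y (λ z → reflexive) (d⋆-local y))) ,
    λ i → reflexive (d⋆-value i)

  module _ where
    private module E = Surjection 𝐁-countable

    -- One number encodes an element of `𝐁` for each value in 𝐀: the clopen level sets of `d`.
    _codes_ : ℕ → D.Carrier → Set
    k codes d = ∀ a y → (E.to (unpack M k a) ∈ᵤ y → d at y ≈ from a) ×
                        (d at y ≈ from a → E.to (unpack M k a) ∈ᵤ y)

    abstract
      level-clopen : ∀ d a → ∃[ b ] ∀ y → (b ∈ᵤ y → d at y ≈ a) × (d at y ≈ a → b ∈ᵤ y)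
      level-clopen d a = locallyDecided⇒clopen (λ y → d at y ≈ a) local
        where
        local : ∀ y → Near y (λ z → d at z ≈ a) ⊎ Near y (λ z → ¬ d at z ≈ a)
        local y with decide (d at y ≈ a)
        ... | yes p = inj₁ (near-map y (λ z q → trans q p) (at-local d y))
        ... | no  p = inj₂ (near-map y (λ z q r → p (trans (sym q) r)) (at-local d y))

    has-code : ∀ d → ∃[ k ] k codes d
    has-code d =
      let b      = λ a → proj₁ (level-clopen d (from a))
          b-spec = λ a → proj₂ (level-clopen d (from a))
          k , p  = unpack-surjective (λ a → proj₁ (E.surjective (b a)))
          hit    = λ a → proj₂ (E.surjective (b a)) (p a)
      in k , λ a y →
        (λ m → proj₁ (b-spec a y) (upward y (≈⇒≼ (hit a)) m)) ,
        (λ q → upward y (≈⇒≼ (BooleanAlgebra.sym 𝐁 (hit a))) (proj₂ (b-spec a y) q))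

    𝐃-countable : Countable D.setoid
    𝐃-countable = coded⇒countable D.setoid 𝐃-inhabited _codes_ has-code
      λ {k} {d} {d′} p q y →
        let d≈ = sym (from∘to (d at y))
        in trans d≈ (sym (proj₁ (q (to (d at y)) y) (proj₂ (p (to (d at y)) y) d≈)))

  module Cover {N : ℕ} (d : Fin N → D.Carrier) where

    -- The region b₀ is never excluded, which makes r positive.
    private
      reserved = avoid x 1ᴮ (proj₁ atomless)
      b₀ = proj₁ reserved

    -- By continuity the values `e i` at `x i` spread to a neighbourhood. On this region, which
    -- contains all `x i`, the members of the copy are frozen at `d⋆`, which the `d j` equal there;
    -- its values are idempotent, so freezing is a homomorphism. Elsewhere members are arbitrary
    -- functions of the joint value of the `d j`.
    Excluded : Pred Point 0ℓ
    Excluded y = χ y b₀ ≡ false × (∃[ i ] d⋆ y ≈ e i) × (∀ j → d j at y ≈ d⋆ y)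

    _~_ : Rel Point 0ℓ
    y ~ z = ∀ j → d j at y ≈ d j at z

    private
      reps = representatives (λ y → encode (λ j → d j at y)) (λ y → ¬ Excluded y) _~_
        (λ p j → sym (p j)) encode-injective

    r : ℕ
    r = proj₁ reps

    rep : Fin r → Point
    rep = proj₁ (proj₂ reps)

    rep-included : ∀ i → ¬ Excluded (rep i)
    rep-included = proj₁ (proj₂ (proj₂ reps))

    rep-distinct : ∀ i j → rep i ~ rep j → i ≡ j
    rep-distinct = proj₁ (proj₂ (proj₂ (proj₂ reps)))

    class : ∀ y → ¬ Excluded y → ∃[ i ] y ~ rep i
    class y p = proj₂ (proj₂ (proj₂ (proj₂ reps))) y p tt

    component : ∀ y → Dec (Excluded y) → Hom (𝐀 ↑ r) 𝐀
    component y (yes (_ , (i , _) , _)) = constHom (e i) (e-idem i)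
    component y (no p)                  = projection 𝐀 (proj₁ (class y p))

    w : Point → Hom (𝐀 ↑ r) 𝐀
    w y = component y (decide (Excluded y))

    w-excluded : ∀ c {y} → Excluded y → Hom.map (w y) c ≈ d⋆ y
    w-excluded c {y} p with decide (Excluded y)
    ... | yes (_ , (i , q) , _) = sym q
    ... | no ¬p                 = contradiction p ¬p

    w-included : ∀ c {y} i → ¬ Excluded y → y ~ rep i → Hom.map (w y) c ≈ c i
    w-included c {y} i ¬p q with decide (Excluded y)
    ... | yes p = contradiction p ¬p
    ... | no ¬p′ = reflexive (≡.cong c (rep-distinct _ i
      (λ j → trans (sym (proj₂ (class y ¬p′) j)) (q j))))

    w-local : ∀ c → LocallyConstant (λ y → Hom.map (w y) c)
    w-local c y = near-map y same
      (near-∩ y (near-χ b₀ y) (near-∩ y (d⋆-local y)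
        (common y (λ j z → d j at z ≈ d j at y) (λ j → at-local (d j) y))))
      where
      same : ∀ z → χ z b₀ ≡ χ y b₀ × d⋆ z ≡ d⋆ y × z ~ y → Hom.map (w z) c ≈ Hom.map (w y) c
      same z (p , q , z~y) with decide (Excluded y)
      ... | yes (s , (i , t) , v) = trans
        (w-excluded c (≡.trans p s , (i , trans (reflexive q) t) ,
          λ j → trans (z~y j) (trans (v j) (reflexive (≡.sym q)))))
        (trans (reflexive q) t)
      ... | no ¬p = w-included c (proj₁ (class y ¬p))
        (λ { (s , (i , t) , v) → ¬p (≡.trans (≡.sym p) s , (i , trans (reflexive (≡.sym q)) t) ,
          λ j → trans (sym (z~y j)) (trans (v j) (reflexive q))) })
        (λ j → trans (z~y j) (proj₂ (class y ¬p) j))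

    x-excluded : ∀ i → Excluded (x i)
    x-excluded i = χ-false (x i) (proj₂ (proj₂ (proj₂ reserved)) i) ,
      (i , reflexive (d⋆-value i)) ,
      λ j → trans (proj₂ (d j) i) (reflexive (≡.sym (d⋆-value i)))

    embedding : Embedding (𝐀 ↑ r) 𝐃
    embedding = record
      { hom       = into-𝐃 w w-local
          (λ c i → trans (w-excluded c (x-excluded i)) (reflexive (d⋆-value i)))
      ; injective = λ {c} {c′} p i → trans
          (sym (w-included c i (rep-included i) (λ _ → refl)))
          (trans (p (rep i)) (w-included c′ i (rep-included i) (λ _ → refl)))
      }

    positive : 1 ≤ r
    positive =
      let y , b₀∈y = point-in b₀ (proj₁ (proj₂ (proj₂ reserved)))
      in Fin⇒1≤ (proj₁ (class y (λ { (p , _) → true≢false y b₀∈y p })))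

    covers : ∀ j → ∃[ c ] Embedding.map embedding c D.≈ d j
    covers j = c , covered
      where
      c : Vector Carrier r
      c i = d j at rep i
      covered : ∀ y → Hom.map (w y) c ≈ d j at y
      covered y with decide (Excluded y)
      ... | yes (_ , (i , p) , q) = sym (trans (q j) p)
      ... | no ¬p                 = sym (proj₂ (class y ¬p) j)

  module Adjoin {k : ℕ} (u : Embedding (𝐀 ↑ k) 𝐃) (h : Hom (𝐀 ↑ k) 𝐀) where

    u-at : Point → Hom (𝐀 ↑ k) 𝐀
    u-at y = evaluate y ∘ₕ Embedding.hom u

    u-local : ∀ y → Near y (λ z → ∀ a → Hom.map (u-at z) a ≈ Hom.map (u-at y) a)
    u-local y = near-map y
      (λ z p a → trans (Hom.cong (u-at z) (λ i → sym (decode∘encode a i)))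
        (trans (p (encode a)) (Hom.cong (u-at y) (decode∘encode a))))
      (common y (λ c z → Hom.map (u-at z) (decode c) ≈ Hom.map (u-at y) (decode c))
        (λ c → at-local (Embedding.map u (decode c)) y))

    -- For surjective `h`, primeness applies to the evaluations of `u` at all points, which fall
    -- into finitely many tables. A constant `h` is realised at the filter point whose prescribed
    -- value is that idempotent.
    realised : ∃[ y ] Σ (𝐀 ≅ 𝐀) λ σ → ∀ a → Hom.map h a ≈ _≅_.map σ (Hom.map (u-at y) a)
    realised with surjective-or-constant h
    ... | inj₁ surj = Prime.factors-through-automorphism 𝒮 power-malcev h surj u-at
      (λ y → table (Hom.map (u-at y)))
      (λ {y} {z} → table-injective (Hom.cong (u-at y)) (Hom.cong (u-at z)))
      (λ p → Hom.cong h (Embedding.injective u p))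
    ... | inj₂ (a , a-idem , const) =
      let i , p = e-all a a-idem
      in x i , identity-automorphism , λ c →
        trans (const c) (trans p (sym (proj₂ (Embedding.map u c) i)))

    private
      y₀ = proj₁ realised
      module σ = Iso (proj₁ (proj₂ realised))
      h≈σu = proj₂ (proj₂ realised)
      -- `u` is constant on `b`; `c` is a nonzero part of `b` without any `x i`; `N` is a proper
      -- nonzero part of `c`. The new coordinate is written on `N`, and `c` minus `N` retains the
      -- old value.
      b = proj₁ (u-local y₀)
      away = avoid x b (member-nonzero y₀ (proj₁ (proj₂ (u-local y₀))))
      c = proj₁ away
      halves = split c (proj₁ (proj₂ (proj₂ away)))
      N = proj₁ halves
      inside = point-in N (proj₁ (proj₂ (proj₂ halves)))
      outside = point-in (c ∧ᴮ ∁ N) (proj₂ (proj₂ (proj₂ halves)))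

      u-constant : ∀ z → c ∈ᵤ z → ∀ a → Hom.map (u-at z) a ≈ Hom.map (u-at y₀) a
      u-constant z c∈z = proj₂ (proj₂ (u-local y₀)) z (upward z (proj₁ (proj₂ away)) c∈z)

      N⇒c : (z : Point) → N ∈ᵤ z → c ∈ᵤ z
      N⇒c z = upward z (proj₁ (proj₂ halves))

    new : Hom (𝐀 ↑ suc k) 𝐀
    new = σ.from-hom ∘ₕ projection 𝐀 zero

    old : Point → Hom (𝐀 ↑ suc k) 𝐀
    old z = u-at z ∘ₕ tuple (λ i → projection 𝐀 (suc i))

    w : Point → Hom (𝐀 ↑ suc k) 𝐀
    w z = if χ z N then new else old z

    w-inside : ∀ z a → N ∈ᵤ z → Hom.map (w z) a ≈ σ.from (a zero)
    w-inside z a p = reflexive (≡.cong (λ t → Hom.map (if t then new else old z) a) p)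

    w-outside : ∀ z a → ¬ N ∈ᵤ z → Hom.map (w z) a ≈ Hom.map (u-at z) (a ∘ suc)
    w-outside z a p =
      reflexive (≡.cong (λ t → Hom.map (if t then new else old z) a) (χ-false z p))

    w-local : ∀ a → LocallyConstant (λ z → Hom.map (w z) a)
    w-local a y = near-map y same (near-∩ y (near-χ N y) (u-local y))
      where
      same : ∀ z → χ z N ≡ χ y N × (∀ c → Hom.map (u-at z) c ≈ Hom.map (u-at y) c) →
        Hom.map (w z) a ≈ Hom.map (w y) a
      same z (p , q) with decide (N ∈ᵤ y)
      ... | yes r = trans (w-inside z a (≡.trans p r)) (sym (w-inside y a r))
      ... | no  r = trans (w-outside z a (λ s → r (≡.trans (≡.sym p) s)))
        (trans (q _) (sym (w-outside y a r)))

    x-outside : ∀ i → ¬ N ∈ᵤ x i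
    x-outside i p = proj₂ (proj₂ (proj₂ away)) i (N⇒c (x i) p)

    w-hom : Hom (𝐀 ↑ suc k) 𝐃
    w-hom = into-𝐃 w w-local λ a i →
      trans (w-outside (x i) a (x-outside i)) (proj₂ (Embedding.map u (a ∘ suc)) i)

    -- On N the map u is constant, and c ∖ N contains a point where it has
    -- the same value, so the tail of an argument can be recovered.
    w-injective : ∀ {a a′} → (∀ z → Hom.map (w z) a ≈ Hom.map (w z) a′) → ∀ i → a i ≈ a′ i
    w-injective {a} {a′} p zero =
      let z , N∈z = inside
      in trans (sym (σ.map∘from _)) (trans
        (σ.cong (trans (sym (w-inside z a N∈z)) (trans (p z) (w-inside z a′ N∈z))))
        (σ.map∘from _))
    w-injective {a} {a′} p (suc i) = Embedding.injective u tails i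
      where
      off-N : ∀ z → ¬ N ∈ᵤ z → Hom.map (u-at z) (a ∘ suc) ≈ Hom.map (u-at z) (a′ ∘ suc)
      off-N z q = trans (sym (w-outside z a q)) (trans (p z) (w-outside z a′ q))

      at-y₀ : Hom.map (u-at y₀) (a ∘ suc) ≈ Hom.map (u-at y₀) (a′ ∘ suc)
      at-y₀ =
        let z , q = outside
            c∈z   = upward z (∧-≼ˡ c (∁ N)) q
        in trans (sym (u-constant z c∈z _)) (trans
             (off-N z (λ N∈z → ∁-excludes z N∈z (upward z (∧-≼ʳ c (∁ N)) q)))
             (u-constant z c∈z _))

      tails : ∀ z → Hom.map (u-at z) (a ∘ suc) ≈ Hom.map (u-at z) (a′ ∘ suc)
      tails z with decide (N ∈ᵤ z)
      ... | yes q = trans (u-constant z (N⇒c z q) _)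
        (trans at-y₀ (sym (u-constant z (N⇒c z q) _)))
      ... | no q  = off-N z q

    embedding : Embedding (𝐀 ↑ suc k) 𝐃
    embedding = record { hom = w-hom ; injective = w-injective }

    -- On `N` the new coordinate `h a`, carried back along the automorphism, is just the value that
    -- `u a` has there.
    extends : ∀ a → Embedding.map embedding (Hom.map h a ∷ a) D.≈ Embedding.map u a
    extends a z with decide (N ∈ᵤ z)
    ... | yes q = trans (w-inside z _ q) (trans (σ.from-cong (h≈σu a))
      (trans (σ.from∘map _) (sym (u-constant z (N⇒c z q) a))))
    ... | no q  = w-outside z _ q

  𝐃-rich : Rich 𝐃
  𝐃-rich = record
    { countable = 𝐃-countable
    ; cover     = λ d → let open Cover d in r , positive , embedding , covers
    ; adjoin    = λ _ u h → let open Adjoin u h in embedding , extends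
    }

-- The free algebra as functions of finitely many coordinates.

module _ {X : Set} where

  -- Concatenation: after `K` entries of `ρ` the sequence `τ` starts from its own index 0.
  splice : ℕ → (ℕ → X) → (ℕ → X) → ℕ → X
  splice zero    ρ τ i       = τ i
  splice (suc K) ρ τ zero    = ρ zero
  splice (suc K) ρ τ (suc i) = splice K (ρ ∘ suc) τ i

  splice-< : ∀ K ρ τ {i} → i < K → splice K ρ τ i ≡ ρ i
  splice-< (suc K) ρ τ {zero}  _         = ≡.refl
  splice-< (suc K) ρ τ {suc i} (s≤s i<K) = splice-< K (ρ ∘ suc) τ i<K

  splice-+ : ∀ K ρ τ j → splice K ρ τ (K + j) ≡ τ j
  splice-+ zero    ρ τ j = ≡.refl
  splice-+ (suc K) ρ τ j = splice-+ K (ρ ∘ suc) τ j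

splice-rel : {X Y : Set} (R : X → Y → Set) → ∀ K ρ τ ρ′ τ′ →
  (∀ i → i < K → R (ρ i) (ρ′ i)) → (∀ i → R (τ i) (τ′ i)) →
  ∀ i → R (splice K ρ τ i) (splice K ρ′ τ′ i)
splice-rel R zero    ρ τ ρ′ τ′ p q i       = q i
splice-rel R (suc K) ρ τ ρ′ τ′ p q zero    = p zero (s≤s z≤n)
splice-rel R (suc K) ρ τ ρ′ τ′ p q (suc i) =
  splice-rel R K (ρ ∘ suc) τ (ρ′ ∘ suc) τ′ (λ i i<K → p (suc i) (s≤s i<K)) q i

module FreeAlgebra {𝑆 : Signature} (𝒮 : SimpleMalcevAlgebra 𝑆)
    (𝐅 : Algebra 𝑆) (gen : ℕ → Algebra.Carrier 𝐅)
    (free : IsFree (InVarietyOf {I = ⊤} (λ _ → SimpleMalcevAlgebra.𝐀 𝒮)) 𝐅 gen) where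

  open Tuples 𝒮
  open Homs 𝒮
  open ClassicalCounting excludedMiddle
  private
    module F = Algebra 𝐅
    module Free = IsFree free

  Assignment : Set
  Assignment = ℕ → Carrier

  𝐀-in-V : InVarietyOf {I = ⊤} (λ _ → 𝐀) 𝐀
  𝐀-in-V E models = models tt

  abstract
    ev : Assignment → Hom 𝐅 𝐀
    ev ρ = proj₁ (Free.extend {𝐂 = 𝐀} 𝐀-in-V ρ)

    ev-gen : ∀ ρ i → Hom.map (ev ρ) (gen i) ≈ ρ i
    ev-gen ρ = proj₂ (Free.extend {𝐂 = 𝐀} 𝐀-in-V ρ)

  infix 10 _[_]
  _[_] : F.Carrier → Assignment → Carrier
  f [ ρ ] = Hom.map (ev ρ) f

  ev-unique : ∀ ρ (h : Hom 𝐅 𝐀) → (∀ i → Hom.map h (gen i) ≈ ρ i) → ∀ f → Hom.map h f ≈ f [ ρ ]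
  ev-unique ρ h p = Free.unique {𝐂 = 𝐀} 𝐀-in-V h (ev ρ) (λ i → trans (p i) (sym (ev-gen ρ i)))

  ev-cong : ∀ {ρ τ} → (∀ i → ρ i ≈ τ i) → ∀ f → f [ ρ ] ≈ f [ τ ]
  ev-cong {ρ} {τ} p = ev-unique τ (ev ρ) (λ i → trans (ev-gen ρ i) (p i))

  private
    IsValue : Pred F.Carrier 0ℓ
    IsValue f = ∃[ t ] eval 𝐅 t gen F.≈ f

    IsValue-sub : IsSubuniverse 𝐅 IsValue
    IsValue-sub = record
      { respects = λ { p (t , q) → t , F.trans q p }
      ; closed   = λ f u p → op f (proj₁ ∘ p) , F.⟦⟧-cong f (proj₂ ∘ p)
      }

    values : Algebra 𝑆
    values = subalgebra 𝐅 IsValue-sub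

    inclusion : Hom values 𝐅
    inclusion = Embedding.hom (subalgebra-inclusion 𝐅 IsValue-sub)

    values-in-V : InVarietyOf {I = ⊤} (λ _ → 𝐀) values
    values-in-V E models {s} {t} Est ρ =
      F.trans (eval-hom {𝐂 = values} inclusion s ρ)
        (F.trans (Free.member E models Est (proj₁ ∘ ρ))
          (F.sym (eval-hom {𝐂 = values} inclusion t ρ)))

  -- `IsFree` gives only the universal property. The values of terms form a subalgebra in the
  -- variety, and the induced homomorphism into it, followed by the inclusion, fixes the generators
  -- and hence is the identity.
  as-term : ∀ f → ∃[ t ] eval 𝐅 t gen F.≈ f
  as-term f =
    let h , h-gen = Free.extend {𝐂 = values} values-in-V (λ i → gen i , var i , F.refl)
        t , p     = proj₂ (Hom.map h f)
    in t , F.trans p (Free.unique {𝐂 = 𝐅} Free.member (inclusion ∘ₕ h) (idHom 𝐅) h-gen f)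

  ev-term : ∀ t {f} → eval 𝐅 t gen F.≈ f → ∀ ρ → eval 𝐀 t ρ ≈ f [ ρ ]
  ev-term t p ρ = trans (eval-cong 𝐀 t (λ i → sym (ev-gen ρ i)))
    (trans (sym (eval-hom (ev ρ) t gen)) (Hom.cong (ev ρ) p))

  -- Terms for `f` and `g` form an equation of 𝐀; it also holds in 𝐅, where it is instantiated at
  -- the generators.
  separated : ∀ {f g} → (∀ ρ → f [ ρ ] ≈ g [ ρ ]) → f F.≈ g
  separated {f} {g} p =
    let s , s≈f = as-term f
        t , t≈g = as-term g
    in F.trans (F.sym s≈f) (F.trans
         (Free.member (_≡ (s , t))
           (λ { _ ≡.refl ρ → trans (ev-term s s≈f ρ) (trans (p ρ) (sym (ev-term t t≈g ρ))) })
           ≡.refl gen)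
         t≈g)

  DependsOn : ℕ → Pred F.Carrier 0ℓ
  DependsOn K f = ∀ {ρ τ} → (∀ i → i < K → ρ i ≈ τ i) → f [ ρ ] ≈ f [ τ ]

  dependsOn-mono : ∀ {K L f} → K ≤ L → DependsOn K f → DependsOn L f
  dependsOn-mono K≤L p q = p (λ i i<K → q i (ℕ.≤-trans i<K K≤L))

  dependsOn-gen : ∀ {K i} → i < K → DependsOn K (gen i)
  dependsOn-gen {i = i} i<K p = trans (ev-gen _ i) (trans (p i i<K) (sym (ev-gen _ i)))

  dependsOn-isSubuniverse : ∀ K → IsSubuniverse 𝐅 (DependsOn K)
  dependsOn-isSubuniverse K = record
    { respects = λ p q {ρ} {τ} r →
        trans (Hom.cong (ev ρ) (F.sym p)) (trans (q r) (Hom.cong (ev τ) p))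
    ; closed   = λ f u p {ρ} {τ} r → trans (Hom.preserve (ev ρ) f u)
        (trans (⟦⟧-cong f (λ i → p i r)) (sym (Hom.preserve (ev τ) f u)))
    }

  support : ∀ f → ∃[ K ] DependsOn K f
  support f =
    let t , t≈f = as-term f
        K , p   = term-support t
    in K , λ {ρ} {τ} q → trans (sym (ev-term t t≈f ρ)) (trans (p q) (ev-term t t≈f τ))
    where
    term-support : (t : Term 𝑆 ℕ) →
      ∃[ K ] ∀ {ρ τ} → (∀ i → i < K → ρ i ≈ τ i) → eval 𝐀 t ρ ≈ eval 𝐀 t τ
    term-support (var i)   = suc i , λ p → p i ℕ.≤-refl
    term-support (op f ts) =
      let K , ≤K = upperBound (λ i → proj₁ (term-support (ts i)))
      in K , λ p → ⟦⟧-cong f (λ i →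
           proj₂ (term-support (ts i)) (λ j j< → p j (ℕ.≤-trans j< (≤K i))))

  common-support : ∀ {N} (d : Fin N → F.Carrier) → ∃[ K ] ∀ i → DependsOn K (d i)
  common-support d =
    let K , ≤K = upperBound (λ i → proj₁ (support (d i)))
    in K , λ i → dependsOn-mono (≤K i) (proj₂ (support (d i)))

  truncated : ℕ → Algebra 𝑆
  truncated K = subalgebra 𝐅 (dependsOn-isSubuniverse K)

  evₖ : ∀ K → Assignment → Hom (truncated K) 𝐀
  evₖ K ρ = ev ρ ∘ₕ Embedding.hom (subalgebra-inclusion 𝐅 (dependsOn-isSubuniverse K))

  truncated-malcev : ∀ K → IsMalcevTerm term (truncated K)
  truncated-malcev K = malcev-separated term malcev (evₖ K) (λ _ _ → separated)

  GeneratesAt : ℕ → Pred Assignment 0ℓ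
  GeneratesAt K ρ = ∀ a → ∃[ f ] DependsOn K f × f [ ρ ] ≈ a

  generatesAt⇒surjective : ∀ {K ρ} → GeneratesAt K ρ → IsSurjective (evₖ K ρ)
  generatesAt⇒surjective g a = let f , p , q = g a in (f , p) , q

  -- On entries this says that `σ` maps the first `K` terms of `ρ` to those of `τ`; the formulation
  -- by elements of 𝐅 matches the output of primeness.
  Equivalent : ℕ → Rel Assignment 0ℓ
  Equivalent K τ ρ = Σ (𝐀 ≅ 𝐀) λ σ → ∀ f → DependsOn K f → f [ τ ] ≈ _≅_.map σ (f [ ρ ])

  equivalent-sym : ∀ {K τ ρ} → Equivalent K τ ρ → Equivalent K ρ τ
  equivalent-sym (σ , p) = Iso.inverse σ , λ f q →
    trans (sym (Iso.from∘map σ _)) (Iso.from-cong σ (sym (p f q)))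

  equivalent-generates : ∀ {K τ ρ} → Equivalent K τ ρ → GeneratesAt K ρ → GeneratesAt K τ
  equivalent-generates (σ , p) g a =
    let f , q , r = g (Iso.from σ a)
    in f , q , trans (p f q) (trans (Iso.cong σ r) (Iso.map∘from σ a))

  restrict : ∀ K → Assignment → Fin (M ^ K)
  restrict K ρ = encode {K} (ρ ∘ toℕ)

  restrict-faithful : ∀ {K ρ τ} → restrict K ρ ≡ restrict K τ →
    ∀ f → DependsOn K f → f [ ρ ] ≈ f [ τ ]
  restrict-faithful {K} {ρ} {τ} p f q = q (λ i i<K →
    ≡.subst (λ j → ρ j ≈ τ j) (Fin.toℕ-fromℕ< i<K) (encode-injective p (fromℕ< i<K)))

  restrict-equivalent : ∀ {K ρ τ} → restrict K ρ ≡ restrict K τ → Equivalent K ρ τ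
  restrict-equivalent p = identity-automorphism , restrict-faithful p

  module _ {K ρ} (generates : GeneratesAt K ρ) where
    private
      module P = Prime 𝒮 (truncated-malcev K) (evₖ K ρ) (generatesAt⇒surjective generates)

      Elsewhere : Set
      Elsewhere = ∃[ τ ] ¬ Equivalent K τ ρ

      α : Congruence (truncated K)
      α = intersection (λ (z : Elsewhere) → kernel (evₖ K (proj₁ z)))

      α-transversal : P.Transversal α
      α-transversal with P.⊆ker-or-transversal α
      ... | inj₂ transversal = transversal
      ... | inj₁ α⊆ker =
        let (τ , τ≁ρ) , σ , p = P.factors-through-automorphism
              (λ (z : Elsewhere) → evₖ K (proj₁ z)) (λ z → restrict K (proj₁ z))
              (λ q f → restrict-faithful {K} q (proj₁ f) (proj₂ f))
              (λ {x} {y} → α⊆ker {x} {y})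
        in contradiction (equivalent-sym (σ , λ f q → p (f , q))) τ≁ρ

    -- Here `α` is agreement at all sequences not equivalent to `ρ`. If it were below the kernel at
    -- `ρ`, primeness would make `ρ` equivalent to one of these sequences; so `α` is transversal,
    -- and `c` can be moved inside its `α`-class.
    change : ∀ c a → DependsOn K c → ∃[ f ] DependsOn K f × f [ ρ ] ≈ a ×
      (∀ τ → ¬ Equivalent K τ ρ → f [ τ ] ≈ c [ τ ])
    change c a p =
      let (f , q) , r , s = α-transversal (c , p) a
      in f , q , s , λ τ τ≁ρ → r (τ , τ≁ρ)

  -- Each element of 𝐀 occurs among the first `M` entries, so `M` coordinates added to any tuple
  -- make it generating; `x₀` merely fills the rest.
  listing : Assignment
  listing i with i ℕ.<? M
  ... | yes i<M = from (fromℕ< i<M)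
  ... | no _    = x₀

  listing-toℕ : ∀ j → listing (toℕ j) ≡ from j
  listing-toℕ j with toℕ j ℕ.<? M
  ... | yes p = ≡.cong from (Fin.fromℕ<-toℕ j p)
  ... | no ¬p = contradiction (Fin.toℕ<n j) ¬p

  complete : ℕ → Assignment → Assignment
  complete K ρ = splice K ρ listing

  complete-generates : ∀ K ρ → GeneratesAt (K + M) (complete K ρ)
  complete-generates K ρ a = gen (K + toℕ (to a)) ,
    dependsOn-gen (ℕ.+-monoʳ-< K (Fin.toℕ<n (to a))) ,
    trans (ev-gen _ _) (trans
      (reflexive (≡.trans (splice-+ K ρ listing _) (listing-toℕ (to a)))) (from∘to a))

  agree-complete : ∀ {K f} ρ → DependsOn K f → f [ complete K ρ ] ≈ f [ ρ ]
  agree-complete ρ p = p (λ i i<K → reflexive (splice-< _ ρ listing i<K))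

  trim : ℕ → Assignment → Assignment
  trim K ρ = splice K ρ (λ _ → ρ 0)

  -- This links θ, which concerns whole sequences, with `K`-tuples. Substituting `gen 0` for all
  -- generators from `gen K` on turns any element into one that depends on `K` coordinates, with the
  -- former value at `trim K ρ` as its value at `ρ`.
  trim-generates : ∀ {K ρ} → 1 ≤ K → IsSurjective (ev (trim K ρ)) → GeneratesAt K ρ
  trim-generates {K} {ρ} 1≤K surj a =
    let f , p = surj a
    in Hom.map s f ,
       (λ {ρ} {τ} q → trans (s-ev f ρ) (trans
         (ev-cong (splice-rel _≈_ K ρ _ τ _ q (λ _ → q 0 1≤K)) f) (sym (s-ev f τ)))) ,
       trans (s-ev f ρ) p
    where
    substitution = Free.extend {𝐂 = 𝐅} Free.member (splice K gen (λ _ → gen 0))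
    s = proj₁ substitution

    s-ev : ∀ f τ → Hom.map s f [ τ ] ≈ f [ trim K τ ]
    s-ev f τ = ev-unique (trim K τ) (ev τ ∘ₕ s) (λ i → trans
      (Hom.cong (ev τ) (proj₂ substitution i))
      (splice-rel (λ g a → g [ τ ] ≈ a) K gen _ τ _ (λ i _ → ev-gen τ i) (λ _ → ev-gen τ 0) i)) f

  pad : ∀ {K} → Vector Carrier K → Assignment
  pad {zero}  v i       = x₀
  pad {suc K} v zero    = v zero
  pad {suc K} v (suc i) = pad (v ∘ suc) i

  pad-restrict : ∀ {K} (v : Vector Carrier K) (ρ : Assignment) → (∀ i → v i ≈ ρ (toℕ i)) →
    ∀ i → i < K → pad v i ≈ ρ i
  pad-restrict {suc K} v ρ p zero    _         = p zero
  pad-restrict {suc K} v ρ p (suc i) (s≤s i<K) = pad-restrict (v ∘ suc) (ρ ∘ suc) (p ∘ suc) i i<K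

  private
    valueTable : ℕ → F.Carrier → ℕ
    valueTable K f = toℕ (encode {M ^ K} (λ c → f [ pad (decode {K} c) ]))

    _codes_ : ℕ → F.Carrier → Set
    n codes f = DependsOn (proj₁ (unpair n)) f × valueTable (proj₁ (unpair n)) f ≡ proj₂ (unpair n)

    has-code : ∀ f → ∃[ n ] n codes f
    has-code f =
      let K , p = support f
          n , q = unpair-surjective K (valueTable K f)
      in n , ≡.subst (λ z → DependsOn (proj₁ z) f × valueTable (proj₁ z) f ≡ proj₂ z)
               (≡.sym q) (p , ≡.refl)

    code-unique : ∀ {n f g} → n codes f → n codes g → f F.≈ g
    code-unique {n} {f} {g} (p , q) (p′ , q′) = separated λ ρ →
      let K = proj₁ (unpair n)
          c = restrict K ρ
          near = pad-restrict (decode {K} c) ρ (λ i → decode∘encode {K} (ρ ∘ toℕ) i)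
      in trans (sym (p near)) (trans
           (encode-injective (Fin.toℕ-injective (≡.trans q (≡.sym q′))) c) (p′ near))

  subset-countable : {P : Pred F.Carrier 0ℓ} (P-sub : IsSubuniverse 𝐅 P) → ∃ P →
    Countable (Algebra.setoid (subalgebra 𝐅 P-sub))
  subset-countable P-sub inhabited = coded⇒countable (Algebra.setoid (subalgebra 𝐅 P-sub))
    inhabited (λ n f → n codes proj₁ f) (has-code ∘ proj₁)
    (λ {n} → code-unique {n})

-- The classes of θ that are subalgebras are rich.

module ThetaClass {𝑆 : Signature} (𝒮 : SimpleMalcevAlgebra 𝑆)
    (n : ℕ) (e : Fin n → Algebra.Carrier (SimpleMalcevAlgebra.𝐀 𝒮))
    (e-idem : ∀ i → IsIdempotent (SimpleMalcevAlgebra.𝐀 𝒮) (e i))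
    (e-all : ∀ a → IsIdempotent (SimpleMalcevAlgebra.𝐀 𝒮) a →
      ∃[ i ] SimpleMalcevAlgebra.𝐀 𝒮 ∋ a ≈ e i)
    (𝐅 : Algebra 𝑆) (gen : ℕ → Algebra.Carrier 𝐅)
    (free : IsFree (InVarietyOf {I = ⊤} (λ _ → SimpleMalcevAlgebra.𝐀 𝒮)) 𝐅 gen)
    (θ : Congruence 𝐅)
    (θ-least : IsLeastCongruence
      (InVarietyOf (properSubalgebras (SimpleMalcevAlgebra.𝐀 𝒮))) 𝐅 θ) where

  open Tuples 𝒮
  open Homs 𝒮
  open RichAlgebras 𝒮
  open ClassicalCounting excludedMiddle
  open FreeAlgebra 𝒮 𝐅 gen free
  private
    module F = Algebra 𝐅
    module θ = Congruence θ

  Nongenerating : Pred Assignment 0ℓ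
  Nongenerating ρ = ¬ IsSurjective (ev ρ)

  generatedSubalgebra : ∀ ρ → Nongenerating ρ → ProperSubalgebra 𝐀
  generatedSubalgebra ρ ρ-non = record
    { pred          = λ a → ∃[ f ] f [ ρ ] ≈ a
    ; isSubuniverse = record
      { respects = λ { p (f , q) → f , trans q p }
      ; closed   = λ g u p → F.⟦ g ⟧ (proj₁ ∘ p) ,
          trans (Hom.preserve (ev ρ) g _) (⟦⟧-cong g (proj₂ ∘ p))
      }
    ; nonempty      = gen 0 [ ρ ] , gen 0 , refl
    ; proper        = ρ-non
    }

  ψ : Congruence 𝐅
  ψ = intersection (λ (z : ∃ Nongenerating) → kernel (ev (proj₁ z)))

  ψ-member : InVarietyOf (properSubalgebras 𝐀) (quotient 𝐅 ψ)
  ψ-member E models {s} {t} Est υ (ρ , ρ-non) = trans (eval-hom h s υ)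
    (trans (models (generatedSubalgebra ρ ρ-non) Est (Hom.map h ∘ υ)) (sym (eval-hom h t υ)))
    where
    h : Hom (quotient 𝐅 ψ) (properSubalgebras 𝐀 (generatedSubalgebra ρ ρ-non))
    h = record
      { map      = λ f → f [ ρ ] , f , refl
      ; cong     = λ p → p (ρ , ρ-non)
      ; preserve = Hom.preserve (ev ρ)
      }

  θ⇒ψ : ∀ {f g} → θ.rel f g → ∀ {ρ} → Nongenerating ρ → f [ ρ ] ≈ g [ ρ ]
  θ⇒ψ p {ρ} ρ-non = IsLeastCongruence.least θ-least ψ ψ-member p (ρ , ρ-non)

  -- Terms for `f` and `g` agree under all assignments into a proper subalgebra, for these are
  -- nongenerating. So they form an identity of all proper subalgebras, and the quotient by θ
  -- satisfies it at the generators.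
  ψ⇒θ : ∀ {f g} → (∀ {ρ} → Nongenerating ρ → f [ ρ ] ≈ g [ ρ ]) → θ.rel f g
  ψ⇒θ {f} {g} p = Q.trans (represents s s≈f) (Q.trans
    (IsLeastCongruence.member θ-least (_≡ (s , t)) models ≡.refl gen) (Q.sym (represents t t≈g)))
    where
    module Q = Algebra (quotient 𝐅 θ)
    s = proj₁ (as-term f)
    s≈f = proj₂ (as-term f)
    t = proj₁ (as-term g)
    t≈g = proj₂ (as-term g)

    represents : ∀ r {c} → eval 𝐅 r gen F.≈ c → θ.rel c (eval (quotient 𝐅 θ) r gen)
    represents r r≈c = Q.trans (θ.contains-≈ (F.sym r≈c)) (eval-hom toQuotient r gen)
      where
      toQuotient : Hom 𝐅 (quotient 𝐅 θ)
      toQuotient = record { map = id ; cong = θ.contains-≈ ; preserve = λ _ _ → Q.refl }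

    models : ∀ P → Models (_≡ (s , t)) (properSubalgebras 𝐀 P)
    models P ≡.refl ρ = begin
      proj₁ (eval 𝐏 s ρ)     ≈⟨ eval-hom inclusion s ρ ⟩
      eval 𝐀 s (proj₁ ∘ ρ)   ≈⟨ ev-term s s≈f (proj₁ ∘ ρ) ⟩
      f [ proj₁ ∘ ρ ]        ≈⟨ p ρ-non ⟩
      g [ proj₁ ∘ ρ ]        ≈⟨ ev-term t t≈g (proj₁ ∘ ρ) ⟨
      eval 𝐀 t (proj₁ ∘ ρ)   ≈⟨ eval-hom inclusion t ρ ⟨
      proj₁ (eval 𝐏 t ρ)     ∎
      where
      open SetoidReasoning setoid
      open ProperSubalgebra P
      𝐏 = properSubalgebras 𝐀 P
      inclusion = Embedding.hom (subalgebra-inclusion 𝐀 isSubuniverse)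

      ρ-non : Nongenerating (proj₁ ∘ ρ)
      ρ-non surj = proper λ a →
        let c , c≈a = surj a
            r , r≈c = as-term c
        in IsSubuniverse.respects isSubuniverse
             (trans (eval-hom inclusion r ρ) (trans (ev-term r r≈c (proj₁ ∘ ρ)) c≈a))
             (proj₂ (eval 𝐏 r ρ))

  nongenerating⇒inequivalent : ∀ {K ρ τ} → GeneratesAt K ρ → Nongenerating τ → ¬ Equivalent K τ ρ
  nongenerating⇒inequivalent gens τ-non q = τ-non λ a →
    let f , _ , r = equivalent-generates q gens a in f , r

  module _ (c : F.Carrier) (c/θ : IsSubuniverse 𝐅 (θ.rel c)) where

    𝐄 : Algebra 𝑆
    𝐄 = subalgebra 𝐅 c/θ

    private
      module E = Algebra 𝐄
      θ-refl : θ.rel c c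
      θ-refl = IsEquivalence.refl θ.rel-equivalence

    agree-c : ∀ {f ρ} → θ.rel c f → Nongenerating ρ → f [ ρ ] ≈ c [ ρ ]
    agree-c p ρ-non = sym (θ⇒ψ p ρ-non)

    in-class : ∀ {f} → (∀ {ρ} → Nongenerating ρ → f [ ρ ] ≈ c [ ρ ]) → θ.rel c f
    in-class p = ψ⇒θ (λ ρ-non → sym (p ρ-non))

    const-value : ∀ i f → f [ (λ _ → e i) ] ≈ e i
    const-value i f = sym (ev-unique (λ _ → e i) (constHom (e i) (e-idem i)) (λ _ → refl) f)

    module _ {k : ℕ} (u : Embedding (𝐀 ↑ k) 𝐄) where

      u-at : Assignment → Hom (𝐀 ↑ k) 𝐀
      u-at ρ = ev ρ ∘ₕ Embedding.hom (subalgebra-inclusion 𝐅 c/θ) ∘ₕ Embedding.hom u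

      realised : (h : Hom (𝐀 ↑ k) 𝐀) →
        Σ Assignment λ ρ → Σ (𝐀 ≅ 𝐀) λ σ → ∀ a → Hom.map h a ≈ _≅_.map σ (Hom.map (u-at ρ) a)
      realised h with surjective-or-constant h
      ... | inj₁ surj = Prime.factors-through-automorphism 𝒮 power-malcev h surj u-at
        (λ ρ → table (Hom.map (u-at ρ)))
        (λ {ρ} {τ} → table-injective (Hom.cong (u-at ρ)) (Hom.cong (u-at τ)))
        (λ p → Hom.cong h (Embedding.injective u (separated p)))
      ... | inj₂ (a , a-idem , const) =
        let i , p = e-all a a-idem
        in (λ _ → e i) , identity-automorphism , λ b →
          trans (const b) (trans p (sym (const-value i _)))

    -- The exponent `r` is the number of orbits of generating `K`-tuples under automorphisms: a
    -- member of the class that depends on `K` coordinates has free values at one representative of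
    -- each orbit and no other freedom.
    module AtLevel (K : ℕ) (1≤K : 1 ≤ K) (c-support : DependsOn K c) where
      private
        reps = representatives (restrict K) (GeneratesAt K) (Equivalent K)
          equivalent-sym restrict-equivalent

      r : ℕ
      r = proj₁ reps

      rep : Fin r → Assignment
      rep = proj₁ (proj₂ reps)

      rep-generates : ∀ i → GeneratesAt K (rep i)
      rep-generates = proj₁ (proj₂ (proj₂ reps))

      rep-distinct : ∀ i j → Equivalent K (rep i) (rep j) → i ≡ j
      rep-distinct = proj₁ (proj₂ (proj₂ (proj₂ reps)))

      class : ∀ ρ → GeneratesAt K ρ → ∃[ i ] Equivalent K ρ (rep i)
      class ρ p = proj₂ (proj₂ (proj₂ (proj₂ reps))) ρ p tt

      Member : Pred F.Carrier 0ℓ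
      Member f = DependsOn K f × θ.rel c f

      Prescribed : ∀ {q} → (Fin q → Assignment) → Vector Carrier q → Pred F.Carrier 0ℓ
      Prescribed p b f = DependsOn K f × (∀ i → f [ p i ] ≈ b i) ×
        (∀ τ → ¬ GeneratesAt K τ → f [ τ ] ≈ c [ τ ])

      -- The values are set one at a time; a later change does not disturb the earlier ones, since
      -- the `p i` are pairwise inequivalent.
      prescribe : ∀ {q} (p : Fin q → Assignment) → (∀ i → GeneratesAt K (p i)) →
        (∀ i j → Equivalent K (p i) (p j) → i ≡ j) → ∀ b → ∃ (Prescribed p b)
      prescribe {zero}  p gens distinct b = c , c-support , (λ ()) , λ _ _ → refl
      prescribe {suc q} p gens distinct b =
        let f , f-dep , f-val , f-c = prescribe (p ∘ suc) (gens ∘ suc)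
              (λ i j q → Fin.suc-injective (distinct (suc i) (suc j) q)) (b ∘ suc)
            g , g-dep , g-val , g-f = change (gens zero) f (b zero) f-dep
        in g , g-dep ,
           (λ { zero    → g-val
              ; (suc i) → trans
                  (g-f (p (suc i)) (λ q → contradiction (distinct (suc i) zero q) λ ()))
                                  (f-val i) }) ,
           λ τ τ-non → trans
             (g-f τ (λ q → τ-non (equivalent-generates q (gens zero)))) (f-c τ τ-non)

      -- A value at a generating tuple is transported from the representative of its orbit. Any
      -- other tuple becomes a nongenerating sequence by trimming, and there all members of the
      -- class agree with `c`.
      determined : ∀ {f g} → Member f → Member g →
        (∀ i → f [ rep i ] ≈ g [ rep i ]) → f F.≈ g
      determined {f} {g} (f-dep , f-θ) (g-dep , g-θ) p = separated λ τ → compare τ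
        where
        trimmed : ∀ {f} τ → DependsOn K f → f [ trim K τ ] ≈ f [ τ ]
        trimmed τ q = q (λ i i<K → reflexive (splice-< K τ _ i<K))

        compare : ∀ τ → f [ τ ] ≈ g [ τ ]
        compare τ with decide (GeneratesAt K τ)
        ... | yes gens =
          let i , σ , q = class τ gens
          in trans (q f f-dep) (trans (_≅_.cong σ (p i)) (sym (q g g-dep)))
        ... | no ¬gens = begin
          f [ τ ]         ≈⟨ trimmed τ f-dep ⟨
          f [ trim K τ ]  ≈⟨ agree-c f-θ τ-non ⟩
          c [ trim K τ ]  ≈⟨ agree-c g-θ τ-non ⟨
          g [ trim K τ ]  ≈⟨ trimmed τ g-dep ⟩
          g [ τ ]         ∎
          where
          open SetoidReasoning setoid
          τ-non : Nongenerating (trim K τ)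
          τ-non surj = ¬gens (trim-generates 1≤K surj)

      build : ∀ b → ∃ (Prescribed rep b)
      build = prescribe rep rep-generates rep-distinct

      value : ∀ b i → proj₁ (build b) [ rep i ] ≈ b i
      value b = proj₁ (proj₂ (proj₂ (build b)))

      build-member : ∀ b → Member (proj₁ (build b))
      build-member b =
        let f , f-dep , _ , f-c = build b
        in f-dep , in-class (λ {ρ} ρ-non → f-c ρ (λ gens → ρ-non (λ a →
             let g , _ , q = gens a in g , q)))

      embedding : Embedding (𝐀 ↑ r) 𝐄
      embedding = record
        { hom       = record
          { map      = λ b → proj₁ (build b) , proj₂ (build-member b)
          ; cong     = λ {a} {b} p → determined (build-member a) (build-member b)
              (λ i → trans (value a i) (trans (p i) (sym (value b i))))
          ; preserve = λ f u → determined (build-member _)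
              ( IsSubuniverse.closed (dependsOn-isSubuniverse K) f _
                  (λ j → proj₁ (build-member (u j)))
              , IsSubuniverse.closed c/θ f _ (λ j → proj₂ (build-member (u j))) )
              (λ i → trans (value _ i) (sym (trans (Hom.preserve (ev (rep i)) f _)
                (⟦⟧-cong f (λ j → value (u j) i)))))
          }
        ; injective = λ {a} {b} p i → trans (sym (value a i))
            (trans (Hom.cong (ev (rep i)) p) (value b i))
        }

      contains : ∀ f (p : Member f) → ∃[ b ] Embedding.map embedding b E.≈ (f , proj₂ p)
      contains f p = (λ i → f [ rep i ]) , determined (build-member _) p (value _)

    cover : ∀ {N} (d : Fin N → E.Carrier) →
      ∃[ l ] 1 ≤ l × Σ (Embedding (𝐀 ↑ l) 𝐄) λ w → ∀ i → ∃[ b ] Embedding.map w b E.≈ d i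
    -- The `M` coordinates beyond the common support `K₀` guarantee a generating tuple, so that the
    -- exponent is positive.
    cover d = r , Fin⇒1≤ (proj₁ (class _ (complete-generates K₀ (λ _ → x₀)))) , embedding ,
      λ i → contains (proj₁ (d i)) (supported (suc i) , proj₂ (d i))
      where
      bound = common-support (c ∷ (proj₁ ∘ d))
      K₀ = proj₁ bound

      supported : ∀ i → DependsOn (K₀ + M) ((c ∷ (proj₁ ∘ d)) i)
      supported i = dependsOn-mono (ℕ.m≤m+n K₀ M) (proj₂ bound i)

      open AtLevel (K₀ + M) (ℕ.≤-trans (Fin⇒1≤ (to x₀)) (ℕ.m≤n+m M K₀)) (supported zero)

    module AdjoinAt {k : ℕ} (u : Embedding (𝐀 ↑ k) 𝐄) (h : Hom (𝐀 ↑ k) 𝐀) (K₀ : ℕ)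
        (u-support : ∀ a → DependsOn K₀ (proj₁ (Embedding.map u a)))
        (ρ₀ : Assignment) (σ : 𝐀 ≅ 𝐀)
        (h≈σu₀ : ∀ a → Hom.map h a ≈ _≅_.map σ (Hom.map (u-at u ρ₀) a)) where
      private
        module U = Embedding u
        module σ = Iso σ

        -- `K₀` bounds the support of the given copy, `M` coordinates make `ρ` generating, and the
        -- last one tells `ρ` from `twin`.
        K₁ K₂ : ℕ
        K₁ = K₀ + M
        K₂ = suc K₁

        K₀≤K₁ : K₀ ≤ K₁
        K₀≤K₁ = ℕ.m≤m+n K₀ M

        u-support₂ : ∀ a → DependsOn K₂ (proj₁ (U.map a))
        u-support₂ a = dependsOn-mono (ℕ.m≤n⇒m≤1+n K₀≤K₁) (u-support a)

      ρ : Assignment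
      ρ = complete K₀ ρ₀

      h≈σu : ∀ a → Hom.map h a ≈ σ.map (proj₁ (U.map a) [ ρ ])
      h≈σu a = trans (h≈σu₀ a) (σ.cong (sym (agree-complete ρ₀ (u-support a))))

      ρ-generates₁ : GeneratesAt K₁ ρ
      ρ-generates₁ = complete-generates K₀ ρ₀

      ρ-generates : GeneratesAt K₂ ρ
      ρ-generates a =
        let f , p , q = ρ-generates₁ a in f , dependsOn-mono (ℕ.n≤1+n K₁) p , q

      -- The old element for `b ∘ suc` is overwritten on the orbit of `ρ` by the new coordinate,
      -- carried back along `σ`. It stays in the class, as nongenerating sequences are never
      -- equivalent to `ρ`.
      changed : (b : Vector Carrier (suc k)) → ∃[ f ] DependsOn K₂ f × f [ ρ ] ≈ σ.from (b zero) ×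
        (∀ τ → ¬ Equivalent K₂ τ ρ → f [ τ ] ≈ proj₁ (U.map (b ∘ suc)) [ τ ])
      changed b = change ρ-generates (proj₁ (U.map (b ∘ suc))) (σ.from (b zero)) (u-support₂ _)

      w : Vector Carrier (suc k) → F.Carrier
      w b = proj₁ (changed b)

      w-support : ∀ b → DependsOn K₂ (w b)
      w-support b = proj₁ (proj₂ (changed b))

      w-here : (b : Vector Carrier (suc k)) → w b [ ρ ] ≈ σ.from (b zero)
      w-here b = proj₁ (proj₂ (proj₂ (changed b)))

      w-elsewhere : (b : Vector Carrier (suc k)) {τ : Assignment} → ¬ Equivalent K₂ τ ρ →
        w b [ τ ] ≈ proj₁ (U.map (b ∘ suc)) [ τ ]
      w-elsewhere b {τ} = proj₂ (proj₂ (proj₂ (changed b))) τ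

      w-class : ∀ b → θ.rel c (w b)
      w-class b = in-class λ τ-non → trans
        (w-elsewhere b (nongenerating⇒inequivalent ρ-generates τ-non))
        (agree-c (proj₂ (U.map (b ∘ suc))) τ-non)

      compare : ∀ {f g} → DependsOn K₂ f → DependsOn K₂ g → f [ ρ ] ≈ g [ ρ ] →
        (∀ {τ} → ¬ Equivalent K₂ τ ρ → f [ τ ] ≈ g [ τ ]) → ∀ τ → f [ τ ] ≈ g [ τ ]
      compare {f} {g} f-dep g-dep here elsewhere τ = by-cases (decide (Equivalent K₂ τ ρ))
        where
        by-cases : Dec (Equivalent K₂ τ ρ) → f [ τ ] ≈ g [ τ ]
        by-cases (yes (σ′ , p)) = trans (p f f-dep) (trans (_≅_.cong σ′ here) (sym (p g g-dep)))
        by-cases (no τ≁ρ)       = elsewhere τ≁ρ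

      -- u takes the same values at twin and at ρ, and w keeps those at twin; hence no
      -- information on u is lost by overwriting the values at ρ.
      twin : Assignment
      twin = splice K₁ ρ (λ _ → proj₁ (different (ρ K₁)))

      twin-agrees : ∀ {f} → DependsOn K₁ f → f [ twin ] ≈ f [ ρ ]
      twin-agrees p = p (λ i i<K₁ → reflexive (splice-< K₁ ρ _ i<K₁))

      -- An equivalence `σ′` would be the identity, since elements depending on `K₁` coordinates
      -- take every value at `ρ` and the same value at `twin`. But `gen K₁` takes different values
      -- there.
      twin-inequivalent : ¬ Equivalent K₂ twin ρ
      twin-inequivalent (σ′ , p) = proj₂ (different (ρ K₁)) (begin
        proj₁ (different (ρ K₁))   ≡⟨ splice-+ K₁ ρ _ 0 ⟨
        twin (K₁ + 0)              ≡⟨ ≡.cong twin (ℕ.+-identityʳ K₁) ⟩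
        twin K₁                    ≈⟨ ev-gen twin K₁ ⟨
        gen K₁ [ twin ]            ≈⟨ p (gen K₁) (dependsOn-gen ℕ.≤-refl) ⟩
        _≅_.map σ′ (gen K₁ [ ρ ])  ≈⟨ fixes _ ⟩
        gen K₁ [ ρ ]               ≈⟨ ev-gen ρ K₁ ⟩
        ρ K₁                       ∎)
        where
        open SetoidReasoning setoid
        fixes : ∀ a → _≅_.map σ′ a ≈ a
        fixes a =
          let f , f-dep , q = ρ-generates₁ a
          in trans (_≅_.cong σ′ (sym q)) (trans
               (sym (p f (dependsOn-mono (ℕ.n≤1+n K₁) f-dep))) (trans (twin-agrees f-dep) q))

      w-injective : ∀ {a b} → w a F.≈ w b → ∀ i → a i ≈ b i
      w-injective {a} {b} p zero = trans (sym (σ.map∘from _)) (trans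
        (σ.cong (trans (sym (w-here a)) (trans (Hom.cong (ev ρ) p) (w-here b)))) (σ.map∘from _))
      w-injective {a} {b} p (suc i) = U.injective (separated
        (compare (u-support₂ _) (u-support₂ _)
          (trans (sym (at-twin a)) (trans (tails twin-inequivalent) (at-twin b))) tails)) i
        where
        tails : ∀ {τ} → ¬ Equivalent K₂ τ ρ →
          proj₁ (U.map (a ∘ suc)) [ τ ] ≈ proj₁ (U.map (b ∘ suc)) [ τ ]
        tails {τ} τ≁ρ = trans (sym (w-elsewhere a τ≁ρ))
          (trans (Hom.cong (ev τ) p) (w-elsewhere b τ≁ρ))

        at-twin : ∀ b → proj₁ (U.map (b ∘ suc)) [ twin ] ≈ proj₁ (U.map (b ∘ suc)) [ ρ ]
        at-twin b = twin-agrees (dependsOn-mono K₀≤K₁ (u-support (b ∘ suc)))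

      embedding : Embedding (𝐀 ↑ suc k) 𝐄
      embedding = record
        { hom       = record
          { map      = λ b → w b , w-class b
          ; cong     = λ {a} {b} p → separated (compare (w-support a) (w-support b)
              (trans (w-here a) (trans (σ.from-cong (p zero)) (sym (w-here b))))
              (λ {τ} τ≁ρ → trans (w-elsewhere a τ≁ρ) (trans
                (Hom.cong (ev τ) (U.cong (p ∘ suc))) (sym (w-elsewhere b τ≁ρ)))))
          ; preserve = λ f b → let b̂ = Algebra.⟦_⟧ (𝐀 ↑ suc k) f b in
              separated (compare (w-support b̂)
                (IsSubuniverse.closed (dependsOn-isSubuniverse K₂) f _ (w-support ∘ b))
                (trans (w-here b̂) (trans (Hom.preserve σ.from-hom f _)
                  (sym (trans (Hom.preserve (ev ρ) f _) (⟦⟧-cong f (λ j → w-here (b j)))))))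
                (λ {τ} τ≁ρ → trans (w-elsewhere b̂ τ≁ρ) (trans
                  (Hom.cong (ev τ) (U.preserve f (λ j → b j ∘ suc))) (trans
                  (Hom.preserve (ev τ) f _)
                  (sym (trans (Hom.preserve (ev τ) f _)
                    (⟦⟧-cong f (λ j → w-elsewhere (b j) τ≁ρ))))))))
          }
        ; injective = w-injective
        }

      extends : ∀ a → Embedding.map embedding (Hom.map h a ∷ a) E.≈ U.map a
      extends a = separated (compare (w-support (Hom.map h a ∷ a)) (u-support₂ a)
        (trans (w-here (Hom.map h a ∷ a)) (trans (σ.from-cong (h≈σu a)) (σ.from∘map _)))
        (w-elsewhere (Hom.map h a ∷ a)))

    adjoin : ∀ {k} (u : Embedding (𝐀 ↑ k) 𝐄) (h : Hom (𝐀 ↑ k) 𝐀) →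
      Σ (Embedding (𝐀 ↑ suc k) 𝐄) λ w →
        ∀ a → Embedding.map w (Hom.map h a ∷ a) E.≈ Embedding.map u a
    adjoin {k} u h =
      let K₀ , p         = common-support (λ i → proj₁ (Embedding.map u (decode {k} i)))
          ρ₀ , σ , h≈σu₀ = realised u h
          u-support : ∀ a → DependsOn K₀ (proj₁ (Embedding.map u a))
          u-support = λ a → IsSubuniverse.respects (dependsOn-isSubuniverse K₀)
            (Embedding.cong u (decode∘encode a)) (p (encode a))
          open AdjoinAt u h K₀ u-support ρ₀ σ h≈σu₀
      in embedding , extends

    𝐄-rich : Rich 𝐄
    𝐄-rich = record
      { countable = subset-countable c/θ (c , θ-refl)
      ; cover     = cover
      ; adjoin    = λ _ → adjoin
      }

-- Embedding the free algebra into the Boolean power.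

module FreeEmbedding {𝑆 : Signature} (𝒮 : SimpleMalcevAlgebra 𝑆)
    (𝐅 : Algebra 𝑆) (gen : ℕ → Algebra.Carrier 𝐅)
    (free : IsFree (InVarietyOf {I = ⊤} (λ _ → SimpleMalcevAlgebra.𝐀 𝒮)) 𝐅 gen)
    (𝐁 : BooleanAlgebra 0ℓ 0ℓ) (𝐁-countable : Countable (BooleanAlgebra.setoid 𝐁))
    (atomless : IsAtomless 𝐁) where

  open Tuples 𝒮
  open FreeAlgebra 𝒮 𝐅 gen free
  open StoneSpace excludedMiddle 𝐁 𝐁-countable
  open LocalConstancy 𝒮 𝐁 𝐁-countable
  open Atomless atomless

  -- `K` independent functions: together they form a continuous map of the Stone space onto `𝐀 ↑ K`.
  record OntoFamily (K : ℕ) : Set where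
    field
      family : Vector (Point → Carrier) K
      local  : ∀ j → LocallyConstant (family j)
      onto   : (v : Vector Carrier K) → Σ Point λ y → ∀ j → family j y ≈ v j

  module _ {K : ℕ} (G : OntoFamily K) where
    open OntoFamily G

    private
      around : (q : Fin (M ^ suc K)) →
        let y = proj₁ (onto (decode {suc K} q ∘ suc))
        in Near y (λ z → ∀ j → family j z ≈ family j y)
      around q = common y (λ j z → family j z ≈ family j y) (λ j → local j y)
        where y = proj₁ (onto (decode {suc K} q ∘ suc))

      spread = distinct-points (proj₁ ∘ around)
        (λ q → member-nonzero (proj₁ (onto (decode {suc K} q ∘ suc))) (proj₁ (proj₂ (around q))))

      z : Fin (M ^ suc K) → Point
      z = proj₁ spread

      z-value : ∀ q j → family j (z q) ≈ decode {suc K} q (suc j)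
      z-value q j = trans
        (proj₂ (proj₂ (around q)) (z q) (proj₂ (proj₂ spread) q) j)
        (proj₂ (onto (decode {suc K} q ∘ suc)) j)

      values : Fin (M ^ suc K) → Carrier
      values q = decode {suc K} q zero

      new = interpolate z (proj₁ (proj₂ spread)) values x₀

    -- The family takes each `K`-tuple of values throughout a nonzero element of `𝐁`. As there are
    -- no atoms, distinct points for all `M ^ suc K` longer tuples can be chosen in these elements,
    -- and the new function is interpolated at them.
    grow : OntoFamily (suc K)
    grow = record
      { family = proj₁ new ∷ family
      ; local  = λ { zero y    → near-map y (λ _ → reflexive) (proj₂ new y)
                   ; (suc j) y → local j y }
      ; onto   = λ v → z (encode v) ,
          λ { zero    → trans (reflexive (interpolate-value z _ values x₀ (encode v)))
                          (decode∘encode v zero)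
            ; (suc j) → trans (z-value (encode v) j) (decode∘encode v (suc j)) }
      }

  families : ∀ K → OntoFamily K
  families zero    = record
    { family = []
    ; local  = λ ()
    ; onto   = λ _ → proj₁ (point-in _ (proj₁ atomless)) , λ ()
    }
  families (suc K) = grow (families K)

  coordinate : ℕ → Point → Carrier
  coordinate i = OntoFamily.family (families (suc i)) zero

  -- `grow` puts the new function first, so a family lists the coordinates in descending order.
  reversed : Assignment → ∀ K → Vector Carrier K
  reversed ρ zero    = []
  reversed ρ (suc K) = ρ K ∷ reversed ρ K

  families-coordinates : ∀ K {ρ y} →
    (∀ j → OntoFamily.family (families K) j y ≈ reversed ρ K j) →
    ∀ i → i < K → coordinate i y ≈ ρ i
  families-coordinates (suc K) p i (s≤s i≤K) with ℕ.m≤n⇒m<n∨m≡n i≤K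
  ... | inj₁ i<K    = families-coordinates K (p ∘ suc) i i<K
  ... | inj₂ ≡.refl = p zero

  -- Density of the sequences `assignment y` is enough for injectivity of `free-embedding`, since
  -- elements of 𝐅 have finite support.
  coordinates-dense : ∀ K ρ → Σ Point λ y → ∀ i → i < K → coordinate i y ≈ ρ i
  coordinates-dense K ρ =
    let y , p = OntoFamily.onto (families K) (reversed ρ K)
    in y , families-coordinates K p

  assignment : Point → Assignment
  assignment y i = coordinate i y

  local-at : ∀ f → LocallyConstant (λ y → f [ assignment y ])
  local-at f y =
    let K , p = support f
    in near-map y
         (λ z q → p (λ i i<K → ≡.subst (λ j → coordinate j z ≈ coordinate j y)
           (Fin.toℕ-fromℕ< i<K) (q (fromℕ< i<K))))
         (common y (λ (i : Fin K) z → coordinate (toℕ i) z ≈ coordinate (toℕ i) y)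
           (λ i → OntoFamily.local (families (suc (toℕ i))) zero y))

  free-embedding : Embedding 𝐅 (booleanPower 𝐀 𝐁)
  free-embedding = record
    { hom       = record
      { map      = λ f → (λ y → f [ assignment y ]) , locallyConstant⇒continuous (local-at f)
      ; cong     = λ p y → Hom.cong (ev (assignment y)) p
      ; preserve = λ f u y → Hom.preserve (ev (assignment y)) f u
      }
    ; injective = λ {f} {g} p → separated λ ρ →
        let K , f-dep = support f
            L , g-dep = support g
            y , q     = coordinates-dense (K ⊔ L) ρ
        in trans (sym (dependsOn-mono (ℕ.m≤m⊔n K L) f-dep q))
             (trans (p y) (dependsOn-mono (ℕ.m≤n⊔m K L) g-dep q))
    }

theorem1p1 : ExcludedMiddle (lsuc 0ℓ) →
    (𝑆 : Signature) (𝐀 : Algebra 𝑆) →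
    Finite (Algebra.setoid 𝐀) → IsSimple 𝐀 → IsMalcev 𝐀 → ¬ IsAbelian 𝐀 →
    (n : ℕ) (e : Fin n → Algebra.Carrier 𝐀) →
    Injective _≡_ (Algebra._≈_ 𝐀) e →
    (e-idem : ∀ i → IsIdempotent 𝐀 (e i)) →
    (∀ a → IsIdempotent 𝐀 a → ∃[ i ] Algebra._≈_ 𝐀 a (e i)) →
    (𝐁 : BooleanAlgebra 0ℓ 0ℓ) →
    Countable (BooleanAlgebra.setoid 𝐁) → IsAtomless 𝐁 →
    (x : Fin n → Ultrafilter 𝐁) → Injective _≡_ _≈ᵤ_ x →
    (JEP (finitePowers 𝐀) × AP (finitePowers 𝐀) ×
    GeneralizedFraisseLimitIs (finitePowers 𝐀) (filteredBooleanPower 𝐀 𝐁 x e e-idem))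
    ×
    (∀ (𝐅 : Algebra 𝑆) (gen : ℕ → Algebra.Carrier 𝐅) →
    IsFree (InVarietyOf {I = ⊤} (λ _ → 𝐀)) 𝐅 gen →
    (θ : Congruence 𝐅) →
    IsLeastCongruence (InVarietyOf (properSubalgebras 𝐀)) 𝐅 θ →
    Embedding 𝐅 (booleanPower 𝐀 𝐁) ×
    (∀ c (c/θ : IsSubuniverse 𝐅 (Congruence.rel θ c)) →
    subalgebra 𝐅 c/θ ≅ filteredBooleanPower 𝐀 𝐁 x e e-idem))
theorem1p1 em 𝑆 𝐀 finite simple (term , malcev) nonabelian
           n e _ e-idem e-all 𝐁 𝐁-countable atomless x x-distinct =
  (powers-JEP , powers-AP , rich⇒limit 𝐃-rich ,
   λ 𝐋 limit → rich-unique (limit⇒rich limit) 𝐃-rich) ,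
  λ 𝐅 gen free θ θ-least →
    FreeEmbedding.free-embedding 𝒮 𝐅 gen free 𝐁 𝐁-countable atomless ,
    λ c c/θ → rich-unique
      (ThetaClass.𝐄-rich 𝒮 n e e-idem e-all 𝐅 gen free θ θ-least c c/θ) 𝐃-rich
  where
  lower-em : ExcludedMiddle 0ℓ
  lower-em {P} with em {Lift (lsuc 0ℓ) P}
  ... | yes (lift p) = yes p
  ... | no ¬p        = no (λ p → ¬p (lift p))

  𝒮 : SimpleMalcevAlgebra 𝑆
  𝒮 = record
    { excludedMiddle = lower-em
    ; 𝐀              = 𝐀
    ; finite         = finite
    ; simple         = simple
    ; term           = term
    ; malcev         = malcev
    ; nonabelian     = nonabelian
    }

  open Homs 𝒮
  open RichAlgebras 𝒮
  open FilteredPower 𝒮 n e e-idem e-all 𝐁 𝐁-countable atomless x x-distinct
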